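{- Let $\mathbb{K}$ be a field and let $\mathcal{C}$ be a $d$-clutter on vertex set $[n]$ obtained from $K_n^d$ by removing a sequence of exposed circuits $(e_1, e_2, \dots, e_r)$. Let $(K_n^d = \mathcal{C}_1, \mathcal{C}_2, \dots, \mathcal{C}_{r+1} = \mathcal{C})$ be the sequence of $d$-clutters obtained in this process, so that $\mathcal{C}_{j+1}=\mathcal{C}_j\setminus\{e_j\}$ and $e_j$ is exposed in $\mathcal{C}_j$ for $j=1,\dots,r$. Let $K_j$ be the unique maximal clique of $\mathcal{C}_j$ containing $e_j$, and let $k_j = n-|K_j|$. Then for all $i\ge 0$ the Betti numbers of $I_{\overline{\mathcal{C}}}\subset R=\mathbb{K}[x_1,\dots,x_n]$ are given by $$\beta_i(I_{\overline{\mathcal{C}}}) = \sum_{j=1}^r \binom{k_j}{i}.$$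
   Context: A $d$-clutter ($d\ge1$) on $[n]=\{1,\dots,n\}$ is a collection $\mathcal{C}$ of $d$-element subsets of $[n]$, called circuits. The complete $d$-clutter $K_n^d$ consists of all $d$-subsets of $[n]$. The complement $\overline{\mathcal{C}}$ consists of all $d$-subsets of $[n]$ not in $\mathcal{C}$. A clique of $\mathcal{C}$ is a nonempty $S \subset [n]$ such that either $|S|<d$, or $|S|\ge d$ and every $d$-subset of $S$ is a circuit of $\mathcal{C}$; it is maximal if it is maximal under inclusion among cliques. A circuit $e\in\mathcal{C}$ is exposed if it is contained in a unique maximal clique of $\mathcal{C}$. For $e=\{v_1,\dots,v_d\}$, $\mathbf{x}_e = x_{v_1}\cdots x_{v_d}$, and the circuit ideal of a $d$-clutter $\mathcal{D}$ is $I_{\mathcal{D}} = \langle \mathbf{x}_f : f\in\mathcal{D}\rangle\subset R$. The (total) Betti numbers of a graded ideal $I$, regarded as an $R$-module, are $\beta_i(I)=\dim_{\mathbb{K}}\operatorname{Tor}_i^R(I,\mathbb{K})$. -}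

module Defs where

open import Algebra.Apartness.Bundles using (HeytingField; HeytingCommutativeRing)
open import Algebra.Bundles using (CommutativeRing; CommutativeMonoid; AbelianGroup)
open import Algebra.Module.Bundles using (LeftModule)
open import Algebra.Module.Structures using (IsLeftModule)
open import Algebra.Morphism.Bundles using (RingHomomorphism)
open import Data.Bool.Base using (if_then_else_)
open import Data.Empty using (⊥-elim)
open import Data.Fin.Base using (Fin; zero; suc)
open import Data.Fin.Subset using (Subset; _⊆_; ∣_∣; Nonempty)
open import Data.List.Base using (List; []; _∷_; [_]; _++_; length)
open import Data.Nat.Base as ℕ using (ℕ; zero; suc; z≤n; s≤s)
open import Data.Product using (Σ-syntax; ∃; ∃!; ∃-syntax; _×_; _,_; proj₁; proj₂)
open import Data.Sum.Base using (_⊎_)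
open import Data.Vec.Base as Vec using (Vec; zipWith)
open import Function.Base using (_∘_; _on_)
open import Function.Bundles using (_⇔_)
open import Function.Definitions using (Surjective)
open import Level using (Level; 0ℓ; _⊔_)
open import Relation.Binary.Core using (Rel)
open import Relation.Binary.PropositionalEquality using (_≡_; _≢_)
open import Relation.Binary.Structures using (IsEquivalence)
open import Relation.Nullary using (Dec; yes; no; does; ¬?; _×-dec_)
open import Relation.Unary using (Pred; Decidable; _∈_; _∉_; _≐_)
import Algebra.Definitions.RawMonoid as RawMonoidDefs
import Algebra.Module.Construct.TensorUnit as TensorUnit
import Algebra.Module.Construct.Zero as Zero
import Algebra.Module.Morphism.Structures as ModuleMorphisms
import Algebra.Properties.AbelianGroup as AbelianGroupProperties
import Algebra.Properties.CommutativeSemigroup as CommutativeSemigroupProperties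
import Algebra.Properties.Ring as RingProperties
import Data.Bool.Properties as Boolₚ
import Data.Nat.Properties as ℕₚ
import Data.Vec.Properties as Vecₚ
import Relation.Binary.PropositionalEquality as ≡
import Relation.Binary.Reasoning.Setoid as SetoidReasoning

private
  variable
    c ℓ m ℓm m′ ℓm′ m″ ℓm″ p q : Level

record Clutter (n d : ℕ) : Set₁ where
  field
    circuits : Pred (Subset n) 0ℓ
    circuit? : Decidable circuits
    uniform  : ∀ {S} → S ∈ circuits → ∣ S ∣ ≡ d

open Clutter public using (circuits)

module _ {n d : ℕ} where

  infix 4 _≐ᶜ_
  _≐ᶜ_ : Rel (Clutter n d) 0ℓ
  _≐ᶜ_ = _≐_ on circuits

  complete : Clutter n d
  complete = record
    { circuits = λ S → ∣ S ∣ ≡ d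
    ; circuit? = λ S → ∣ S ∣ ℕₚ.≟ d
    ; uniform  = λ eq → eq
    }

  complement : Clutter n d → Clutter n d
  complement C = record
    { circuits = λ S → ∣ S ∣ ≡ d × S ∉ circuits C
    ; circuit? = λ S → (∣ S ∣ ℕₚ.≟ d) ×-dec ¬? (Clutter.circuit? C S)
    ; uniform  = proj₁
    }

  infixl 6 _∖_
  _∖_ : Clutter n d → Subset n → Clutter n d
  C ∖ e = record
    { circuits = λ S → S ∈ circuits C × S ≢ e
    ; circuit? = λ S → Clutter.circuit? C S ×-dec ¬? (Vecₚ.≡-dec Boolₚ._≟_ S e)
    ; uniform  = Clutter.uniform C ∘ proj₁
    }

  IsClique : Clutter n d → Pred (Subset n) 0ℓ
  IsClique C S =
    Nonempty S ×
    (∣ S ∣ ℕ.< d ⊎ (d ℕ.≤ ∣ S ∣ × (∀ e → e ⊆ S → ∣ e ∣ ≡ d → e ∈ circuits C)))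

  IsMaximalClique : Clutter n d → Pred (Subset n) 0ℓ
  IsMaximalClique C S = IsClique C S × (∀ T → IsClique C T → S ⊆ T → T ≡ S)

  IsExposed : Clutter n d → Pred (Subset n) 0ℓ
  IsExposed C e = e ∈ circuits C × ∃! _≡_ (λ S → IsMaximalClique C S × e ⊆ S)

module Modules (R : CommutativeRing c ℓ) where

  open CommutativeRing R using (ring; 1#; 0#; _≈_; _+_; _*_; -_)
    renaming (Carrier to ∣R∣)
  private module R = CommutativeRing R

  -- A presentation of the left module axioms without the derivable ones.
  record IsLeftModule′ {A : Set m} (_≈ᴹ_ : Rel A ℓm) (_+ᴹ_ : A → A → A) (0ᴹ : A)
                       (-ᴹ_ : A → A) (_*ₗ_ : ∣R∣ → A → A) : Set (c ⊔ ℓ ⊔ m ⊔ ℓm) where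
    field
      isEquivalence : IsEquivalence _≈ᴹ_
      +ᴹ-cong       : ∀ {x x′ y y′} → x ≈ᴹ x′ → y ≈ᴹ y′ → (x +ᴹ y) ≈ᴹ (x′ +ᴹ y′)
      -ᴹ‿cong       : ∀ {x x′} → x ≈ᴹ x′ → (-ᴹ x) ≈ᴹ (-ᴹ x′)
      *ₗ-cong       : ∀ {r r′ x x′} → r ≈ r′ → x ≈ᴹ x′ → (r *ₗ x) ≈ᴹ (r′ *ₗ x′)
      +ᴹ-assoc      : ∀ x y z → ((x +ᴹ y) +ᴹ z) ≈ᴹ (x +ᴹ (y +ᴹ z))
      +ᴹ-comm       : ∀ x y → (x +ᴹ y) ≈ᴹ (y +ᴹ x)
      +ᴹ-identityˡ  : ∀ x → (0ᴹ +ᴹ x) ≈ᴹ x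
      -ᴹ‿inverseˡ   : ∀ x → ((-ᴹ x) +ᴹ x) ≈ᴹ 0ᴹ
      *ₗ-distribˡ   : ∀ r x y → (r *ₗ (x +ᴹ y)) ≈ᴹ ((r *ₗ x) +ᴹ (r *ₗ y))
      *ₗ-distribʳ   : ∀ x r s → ((r + s) *ₗ x) ≈ᴹ ((r *ₗ x) +ᴹ (s *ₗ x))
      *ₗ-assoc      : ∀ r s x → ((r * s) *ₗ x) ≈ᴹ (r *ₗ (s *ₗ x))
      *ₗ-identityˡ  : ∀ x → (1# *ₗ x) ≈ᴹ x

    private
      module E = IsEquivalence isEquivalence

      +ᴹ-abelianGroup : AbelianGroup m ℓm
      +ᴹ-abelianGroup = record
        { isAbelianGroup = record
          { isGroup = record
            { isMonoid = record
              { isSemigroup = record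
                { isMagma = record { isEquivalence = isEquivalence ; ∙-cong = +ᴹ-cong }
                ; assoc   = +ᴹ-assoc
                }
              ; identity = +ᴹ-identityˡ , λ x → E.trans (+ᴹ-comm _ _) (+ᴹ-identityˡ x)
              }
            ; inverse = -ᴹ‿inverseˡ , λ x → E.trans (+ᴹ-comm _ _) (-ᴹ‿inverseˡ x)
            ; ⁻¹-cong = -ᴹ‿cong
            }
          ; comm = +ᴹ-comm
          }
        }
      module A = AbelianGroup +ᴹ-abelianGroup
      open AbelianGroupProperties +ᴹ-abelianGroup using (identityˡ-unique)

    isLeftModule : IsLeftModule ring _≈ᴹ_ _+ᴹ_ 0ᴹ -ᴹ_ _*ₗ_
    isLeftModule = record
      { isLeftSemimodule = record
        { +ᴹ-isCommutativeMonoid = A.isCommutativeMonoid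
        ; isPreleftSemimodule = record
          { *ₗ-cong      = *ₗ-cong
          ; *ₗ-zeroˡ     = λ x → identityˡ-unique _ _
              (E.trans (E.sym (*ₗ-distribʳ x 0# 0#)) (*ₗ-cong (R.+-identityˡ 0#) E.refl))
          ; *ₗ-distribʳ  = *ₗ-distribʳ
          ; *ₗ-identityˡ = *ₗ-identityˡ
          ; *ₗ-assoc     = *ₗ-assoc
          ; *ₗ-zeroʳ     = λ r → identityˡ-unique _ _
              (E.trans (E.sym (*ₗ-distribˡ r 0ᴹ 0ᴹ)) (*ₗ-cong R.refl (+ᴹ-identityˡ 0ᴹ)))
          ; *ₗ-distribˡ  = *ₗ-distribˡ
          }
        }
      ; -ᴹ‿cong    = -ᴹ‿cong
      ; -ᴹ‿inverse = A.inverse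
      }

  infix 4 _⟶_
  record _⟶_ (M : LeftModule ring m ℓm) (N : LeftModule ring m′ ℓm′)
         : Set (c ⊔ m ⊔ ℓm ⊔ m′ ⊔ ℓm′) where
    private
      module M = LeftModule M
      module N = LeftModule N
    open ModuleMorphisms.LeftModuleMorphisms M.rawLeftModule N.rawLeftModule
    field
      to                       : M.Carrierᴹ → N.Carrierᴹ
      isLeftModuleHomomorphism : IsLeftModuleHomomorphism to
    open IsLeftModuleHomomorphism isLeftModuleHomomorphism public

  open _⟶_ public using (to)

  module _ {M : LeftModule ring m ℓm} {N : LeftModule ring m′ ℓm′} where
    private
      module M = LeftModule M
      module N = LeftModule N
      module G = AbelianGroupProperties N.+ᴹ-abelianGroup

    linear : (f : M.Carrierᴹ → N.Carrierᴹ) →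
             (∀ {x y} → x M.≈ᴹ y → f x N.≈ᴹ f y) →
             (∀ x y → f (x M.+ᴹ y) N.≈ᴹ f x N.+ᴹ f y) →
             (∀ r x → f (r M.*ₗ x) N.≈ᴹ r N.*ₗ f x) →
             M ⟶ N
    linear f f-cong f-+ f-* = record
      { to = f
      ; isLeftModuleHomomorphism = record
        { +ᴹ-isGroupHomomorphism = record
          { isMonoidHomomorphism = record
            { isMagmaHomomorphism = record
              { isRelHomomorphism = record { cong = f-cong }
              ; homo              = f-+
              }
            ; ε-homo = f-0
            }
          ; ⁻¹-homo = λ x → G.inverseˡ-unique _ _
              (N.≈ᴹ-trans (N.≈ᴹ-sym (f-+ _ _))
                (N.≈ᴹ-trans (f-cong (M.-ᴹ‿inverseˡ x)) f-0))
          }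
        ; *ₗ-homo = f-*
        }
      }
      where
      f-0 : f M.0ᴹ N.≈ᴹ N.0ᴹ
      f-0 = G.identityˡ-unique _ _
        (N.≈ᴹ-trans (N.≈ᴹ-sym (f-+ M.0ᴹ M.0ᴹ)) (f-cong (M.+ᴹ-identityˡ M.0ᴹ)))

  𝟎 : ∀ {a b} → LeftModule ring a b
  𝟎 = Zero.leftModule

  toZero : ∀ {a b} {M : LeftModule ring m ℓm} → M ⟶ 𝟎 {a} {b}
  toZero {M = M} = linear {M = M} (λ _ → _) (λ _ → _) (λ _ _ → _) (λ _ _ → _)

  infixr 8 R^_
  R^_ : ℕ → LeftModule ring c ℓ
  R^ k = record
    { Carrierᴹ = Fin k → ∣R∣
    ; _≈ᴹ_     = λ x y → ∀ i → x i ≈ y i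
    ; _+ᴹ_     = λ x y i → x i + y i
    ; _*ₗ_     = λ r x i → r * x i
    ; 0ᴹ       = λ _ → 0#
    ; -ᴹ_      = λ x i → - x i
    ; isLeftModule = IsLeftModule′.isLeftModule record
      { isEquivalence = record
        { refl  = λ _ → R.refl
        ; sym   = λ e i → R.sym (e i)
        ; trans = λ e f i → R.trans (e i) (f i)
        }
      ; +ᴹ-cong      = λ e f i → R.+-cong (e i) (f i)
      ; -ᴹ‿cong      = λ e i → R.-‿cong (e i)
      ; *ₗ-cong      = λ e f i → R.*-cong e (f i)
      ; +ᴹ-assoc     = λ x y z i → R.+-assoc (x i) (y i) (z i)
      ; +ᴹ-comm      = λ x y i → R.+-comm (x i) (y i)
      ; +ᴹ-identityˡ = λ x i → R.+-identityˡ (x i)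
      ; -ᴹ‿inverseˡ  = λ x i → R.-‿inverseˡ (x i)
      ; *ₗ-distribˡ  = λ r x y i → R.distribˡ r (x i) (y i)
      ; *ₗ-distribʳ  = λ x r s i → R.distribʳ (x i) r s
      ; *ₗ-assoc     = λ r s x i → R.*-assoc r s (x i)
      ; *ₗ-identityˡ = λ x i → R.*-identityˡ (x i)
      }
    }

  record Basis (M : LeftModule ring m ℓm) (k : ℕ) : Set (c ⊔ ℓ ⊔ m ⊔ ℓm) where
    open LeftModule M
    open RawMonoidDefs +ᴹ-rawMonoid using (sum)
    field
      vector      : Fin k → Carrierᴹ
      spanning    : ∀ x → Σ[ a ∈ (Fin k → ∣R∣) ] x ≈ᴹ sum (λ i → a i *ₗ vector i)
      independent : ∀ (a : Fin k → ∣R∣) → sum (λ i → a i *ₗ vector i) ≈ᴹ 0ᴹ → ∀ i → a i ≈ 0#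

  record Submodule (M : LeftModule ring m ℓm) p : Set (c ⊔ m ⊔ ℓm ⊔ Level.suc p) where
    open LeftModule M
    field
      pred     : Pred Carrierᴹ p
      resp     : ∀ {x y} → x ≈ᴹ y → x ∈ pred → y ∈ pred
      0-closed : 0ᴹ ∈ pred
      +-closed : ∀ {x y} → x ∈ pred → y ∈ pred → x +ᴹ y ∈ pred
      *-closed : ∀ r {x} → x ∈ pred → r *ₗ x ∈ pred

  open Submodule public using (pred)

  module _ {M : LeftModule ring m ℓm} {N : LeftModule ring m′ ℓm′} (f : M ⟶ N) where
    private
      module M = LeftModule M
      module N = LeftModule N
      module f = _⟶_ f

    kernel : Submodule M ℓm′
    kernel = record
      { pred     = λ x → f.to x N.≈ᴹ N.0ᴹ
      ; resp     = λ x≈y fx≈0 → N.≈ᴹ-trans (f.⟦⟧-cong (M.≈ᴹ-sym x≈y)) fx≈0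
      ; 0-closed = f.0ᴹ-homo
      ; +-closed = λ fx≈0 fy≈0 → N.≈ᴹ-trans (f.+ᴹ-homo _ _)
                     (N.≈ᴹ-trans (N.+ᴹ-cong fx≈0 fy≈0) (N.+ᴹ-identityˡ _))
      ; *-closed = λ r fx≈0 → N.≈ᴹ-trans (f.*ₗ-homo r _)
                     (N.≈ᴹ-trans (N.*ₗ-congˡ fx≈0) (N.*ₗ-zeroʳ r))
      }

    image : Submodule N (m ⊔ ℓm′)
    image = record
      { pred     = λ y → ∃[ x ] f.to x N.≈ᴹ y
      ; resp     = λ y≈z (x , e) → x , N.≈ᴹ-trans e y≈z
      ; 0-closed = M.0ᴹ , f.0ᴹ-homo
      ; +-closed = λ (x , e) (y , e′) → x M.+ᴹ y , N.≈ᴹ-trans (f.+ᴹ-homo x y) (N.+ᴹ-cong e e′)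
      ; *-closed = λ r (x , e) → r M.*ₗ x , N.≈ᴹ-trans (f.*ₗ-homo r x) (N.*ₗ-congˡ e)
      }

    preimage : Submodule N p → Submodule M p
    preimage P = record
      { pred     = λ x → f.to x ∈ pred P
      ; resp     = λ x≈y → P.resp (f.⟦⟧-cong x≈y)
      ; 0-closed = P.resp (N.≈ᴹ-sym f.0ᴹ-homo) P.0-closed
      ; +-closed = λ u v → P.resp (N.≈ᴹ-sym (f.+ᴹ-homo _ _)) (P.+-closed u v)
      ; *-closed = λ r u → P.resp (N.≈ᴹ-sym (f.*ₗ-homo r _)) (P.*-closed r u)
      }
      where module P = Submodule P

  module _ (M : LeftModule ring m ℓm) where
    open LeftModule M

    data Span {J : Set q} (g : J → Carrierᴹ) : Pred Carrierᴹ (c ⊔ m ⊔ ℓm ⊔ q) where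
      gen  : ∀ j → g j ∈ Span g
      resp : ∀ {x y} → x ≈ᴹ y → x ∈ Span g → y ∈ Span g
      zero : 0ᴹ ∈ Span g
      add  : ∀ {x y} → x ∈ Span g → y ∈ Span g → x +ᴹ y ∈ Span g
      mul  : ∀ r {x} → x ∈ Span g → r *ₗ x ∈ Span g

    span : {J : Set q} → (J → Carrierᴹ) → Submodule M (c ⊔ m ⊔ ℓm ⊔ q)
    span g = record
      { pred     = Span g
      ; resp     = resp
      ; 0-closed = zero
      ; +-closed = add
      ; *-closed = mul
      }

  module _ (M : LeftModule ring m ℓm) (P : Submodule M p) where
    private
      module M = LeftModule M
      module P = Submodule P
      open M using (Carrierᴹ; _≈ᴹ_; _+ᴹ_; -ᴹ_; 0ᴹ; _*ₗ_)
      module G = AbelianGroupProperties M.+ᴹ-abelianGroup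
      open CommutativeSemigroupProperties
        (CommutativeMonoid.commutativeSemigroup M.+ᴹ-commutativeMonoid) using (interchange)
      open SetoidReasoning M.≈ᴹ-setoid

      neg-scale : ∀ x → - 1# *ₗ x ≈ᴹ -ᴹ x
      neg-scale x = G.inverseˡ-unique _ _ (begin
        - 1# *ₗ x +ᴹ x         ≈⟨ M.+ᴹ-congˡ (M.*ₗ-identityˡ x) ⟨
        - 1# *ₗ x +ᴹ 1# *ₗ x   ≈⟨ M.*ₗ-distribʳ x (- 1#) 1# ⟨
        (- 1# + 1#) *ₗ x       ≈⟨ M.*ₗ-congʳ (R.-‿inverseˡ 1#) ⟩
        0# *ₗ x                ≈⟨ M.*ₗ-zeroˡ x ⟩
        0ᴹ                     ∎)

      scale-neg : ∀ r x → r *ₗ (-ᴹ x) ≈ᴹ -ᴹ (r *ₗ x)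
      scale-neg r x = G.inverseˡ-unique _ _ (begin
        r *ₗ (-ᴹ x) +ᴹ r *ₗ x  ≈⟨ M.*ₗ-distribˡ r (-ᴹ x) x ⟨
        r *ₗ (-ᴹ x +ᴹ x)       ≈⟨ M.*ₗ-congˡ (M.-ᴹ‿inverseˡ x) ⟩
        r *ₗ 0ᴹ                ≈⟨ M.*ₗ-zeroʳ r ⟩
        0ᴹ                     ∎)

      neg-closed : ∀ {x} → x ∈ P.pred → -ᴹ x ∈ P.pred
      neg-closed x∈P = P.resp (neg-scale _) (P.*-closed (- 1#) x∈P)

    submodule : LeftModule ring (m ⊔ p) ℓm
    submodule = record
      { Carrierᴹ = ∃ P.pred
      ; _≈ᴹ_     = _≈ᴹ_ on proj₁
      ; _+ᴹ_     = λ (x , u) (y , v) → x +ᴹ y , P.+-closed u v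
      ; _*ₗ_     = λ r (x , u) → r *ₗ x , P.*-closed r u
      ; 0ᴹ       = 0ᴹ , P.0-closed
      ; -ᴹ_      = λ (x , u) → -ᴹ x , neg-closed u
      ; isLeftModule = IsLeftModule′.isLeftModule record
        { isEquivalence = record { refl = M.≈ᴹ-refl ; sym = M.≈ᴹ-sym ; trans = M.≈ᴹ-trans }
        ; +ᴹ-cong      = M.+ᴹ-cong
        ; -ᴹ‿cong      = M.-ᴹ‿cong
        ; *ₗ-cong      = M.*ₗ-cong
        ; +ᴹ-assoc     = λ _ _ _ → M.+ᴹ-assoc _ _ _
        ; +ᴹ-comm      = λ _ _ → M.+ᴹ-comm _ _
        ; +ᴹ-identityˡ = λ _ → M.+ᴹ-identityˡ _
        ; -ᴹ‿inverseˡ  = λ _ → M.-ᴹ‿inverseˡ _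
        ; *ₗ-distribˡ  = λ _ _ _ → M.*ₗ-distribˡ _ _ _
        ; *ₗ-distribʳ  = λ _ _ _ → M.*ₗ-distribʳ _ _ _
        ; *ₗ-assoc     = λ _ _ _ → M.*ₗ-assoc _ _ _
        ; *ₗ-identityˡ = λ _ → M.*ₗ-identityˡ _
        }
      }

    inclusion : submodule ⟶ M
    inclusion = linear proj₁ (λ e → e) (λ _ _ → M.≈ᴹ-refl) (λ _ _ → M.≈ᴹ-refl)

    private
      infix 4 _∼_
      _∼_ : Rel Carrierᴹ p
      x ∼ y = x +ᴹ -ᴹ y ∈ P.pred

      ≈⇒∼ : ∀ {x y} → x ≈ᴹ y → x ∼ y
      ≈⇒∼ {x} {y} x≈y = P.resp
        (M.≈ᴹ-sym (M.≈ᴹ-trans (M.+ᴹ-congʳ x≈y) (M.-ᴹ‿inverseʳ y))) P.0-closed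

      ∼-sym : ∀ {x y} → x ∼ y → y ∼ x
      ∼-sym {x} {y} x∼y = P.resp (G.⁻¹-anti-homo-// x y) (neg-closed x∼y)

      ∼-trans : ∀ {x y z} → x ∼ y → y ∼ z → x ∼ z
      ∼-trans {x} {y} {z} x∼y y∼z = P.resp (begin
        (x +ᴹ -ᴹ y) +ᴹ (y +ᴹ -ᴹ z)   ≈⟨ M.+ᴹ-assoc x (-ᴹ y) _ ⟩
        x +ᴹ (-ᴹ y +ᴹ (y +ᴹ -ᴹ z))   ≈⟨ M.+ᴹ-congˡ (M.+ᴹ-assoc (-ᴹ y) y _) ⟨
        x +ᴹ ((-ᴹ y +ᴹ y) +ᴹ -ᴹ z)   ≈⟨ M.+ᴹ-congˡ (M.+ᴹ-congʳ (M.-ᴹ‿inverseˡ y)) ⟩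
        x +ᴹ (0ᴹ +ᴹ -ᴹ z)            ≈⟨ M.+ᴹ-congˡ (M.+ᴹ-identityˡ _) ⟩
        x +ᴹ -ᴹ z                    ∎) (P.+-closed x∼y y∼z)

      +-cong-∼ : ∀ {x y u v} → x ∼ y → u ∼ v → x +ᴹ u ∼ y +ᴹ v
      +-cong-∼ {x} {y} {u} {v} x∼y u∼v = P.resp (begin
        (x +ᴹ -ᴹ y) +ᴹ (u +ᴹ -ᴹ v)   ≈⟨ interchange x (-ᴹ y) u (-ᴹ v) ⟩
        (x +ᴹ u) +ᴹ (-ᴹ y +ᴹ -ᴹ v)   ≈⟨ M.+ᴹ-congˡ (G.⁻¹-∙-comm y v) ⟩
        (x +ᴹ u) +ᴹ -ᴹ (y +ᴹ v)      ∎) (P.+-closed x∼y u∼v)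

      scale-cong-∼ : ∀ r {x y} → x ∼ y → r *ₗ x ∼ r *ₗ y
      scale-cong-∼ r {x} {y} x∼y = P.resp
        (M.≈ᴹ-trans (M.*ₗ-distribˡ r x (-ᴹ y)) (M.+ᴹ-congˡ (scale-neg r y)))
        (P.*-closed r x∼y)

    quotient : LeftModule ring m p
    quotient = record
      { Carrierᴹ = Carrierᴹ
      ; _≈ᴹ_     = λ x y → x +ᴹ -ᴹ y ∈ P.pred
      ; _+ᴹ_     = _+ᴹ_
      ; _*ₗ_     = _*ₗ_
      ; 0ᴹ       = 0ᴹ
      ; -ᴹ_      = -ᴹ_
      ; isLeftModule = IsLeftModule′.isLeftModule record
        { isEquivalence = record { refl = ≈⇒∼ M.≈ᴹ-refl ; sym = ∼-sym ; trans = ∼-trans }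
        ; +ᴹ-cong      = +-cong-∼
        ; -ᴹ‿cong      = λ {x} {y} x∼y →
            ∼-trans (≈⇒∼ (M.≈ᴹ-sym (neg-scale x)))
              (∼-trans (scale-cong-∼ (- 1#) x∼y) (≈⇒∼ (neg-scale y)))
        ; *ₗ-cong      = λ {r} {r′} {x} {x′} r≈r′ x∼x′ →
            ∼-trans (≈⇒∼ (M.*ₗ-congʳ r≈r′)) (scale-cong-∼ r′ x∼x′)
        ; +ᴹ-assoc     = λ x y z → ≈⇒∼ (M.+ᴹ-assoc x y z)
        ; +ᴹ-comm      = λ x y → ≈⇒∼ (M.+ᴹ-comm x y)
        ; +ᴹ-identityˡ = λ x → ≈⇒∼ (M.+ᴹ-identityˡ x)
        ; -ᴹ‿inverseˡ  = λ x → ≈⇒∼ (M.-ᴹ‿inverseˡ x)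
        ; *ₗ-distribˡ  = λ r x y → ≈⇒∼ (M.*ₗ-distribˡ r x y)
        ; *ₗ-distribʳ  = λ x r s → ≈⇒∼ (M.*ₗ-distribʳ x r s)
        ; *ₗ-assoc     = λ r s x → ≈⇒∼ (M.*ₗ-assoc r s x)
        ; *ₗ-identityˡ = λ x → ≈⇒∼ (M.*ₗ-identityˡ x)
        }
      }

  module _ {A : LeftModule ring m ℓm} {B : LeftModule ring m′ ℓm′}
           {C : LeftModule ring m″ ℓm″} (f : A ⟶ B) (g : B ⟶ C) where

    Exact : Set (m ⊔ m′ ⊔ ℓm′ ⊔ ℓm″)
    Exact = ∀ y → (y ∈ pred (kernel g)) ⇔ (y ∈ pred (image f))

    -- ker g / im f; only used when g ∘ f vanishes, which the construction itself
    -- does not need.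
    homology : LeftModule ring (m′ ⊔ ℓm″) (m ⊔ ℓm′)
    homology = quotient (submodule B (kernel g)) (preimage (inclusion B (kernel g)) (image f))

  -- Tensor products: formal expressions in elementary tensors, modulo the least
  -- module congruence making _⊗_ bilinear.

  module _ (M : LeftModule ring m ℓm) (N : LeftModule ring m′ ℓm′) where
    private
      module M = LeftModule M
      module N = LeftModule N

    infixr 7 _·_
    infix  8 _⊗_ ⊖_
    infixl 6 _⊕_
    data Tensor : Set (c ⊔ m ⊔ m′) where
      _⊗_ : M.Carrierᴹ → N.Carrierᴹ → Tensor
      _⊕_ : Tensor → Tensor → Tensor
      _·_ : ∣R∣ → Tensor → Tensor
      ⊖_  : Tensor → Tensor
      𝟘   : Tensor

    infix 4 _≈ᵀ_
    data _≈ᵀ_ : Rel Tensor (c ⊔ ℓ ⊔ m ⊔ ℓm ⊔ m′ ⊔ ℓm′) where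
      refl  : ∀ {t} → t ≈ᵀ t
      sym   : ∀ {t u} → t ≈ᵀ u → u ≈ᵀ t
      trans : ∀ {t u v} → t ≈ᵀ u → u ≈ᵀ v → t ≈ᵀ v

      ⊗-cong : ∀ {x x′ y y′} → x M.≈ᴹ x′ → y N.≈ᴹ y′ → x ⊗ y ≈ᵀ x′ ⊗ y′
      ⊕-cong : ∀ {t t′ u u′} → t ≈ᵀ t′ → u ≈ᵀ u′ → t ⊕ u ≈ᵀ t′ ⊕ u′
      ·-cong : ∀ {r r′ t t′} → r ≈ r′ → t ≈ᵀ t′ → r · t ≈ᵀ r′ · t′
      ⊖-cong : ∀ {t t′} → t ≈ᵀ t′ → ⊖ t ≈ᵀ ⊖ t′

      ⊕-assoc     : ∀ t u v → (t ⊕ u) ⊕ v ≈ᵀ t ⊕ (u ⊕ v)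
      ⊕-comm      : ∀ t u → t ⊕ u ≈ᵀ u ⊕ t
      ⊕-identityˡ : ∀ t → 𝟘 ⊕ t ≈ᵀ t
      ⊖-inverseˡ  : ∀ t → ⊖ t ⊕ t ≈ᵀ 𝟘
      ·-distribˡ  : ∀ r t u → r · (t ⊕ u) ≈ᵀ r · t ⊕ r · u
      ·-distribʳ  : ∀ t r s → (r + s) · t ≈ᵀ r · t ⊕ s · t
      ·-assoc     : ∀ r s t → (r * s) · t ≈ᵀ r · s · t
      ·-identityˡ : ∀ t → 1# · t ≈ᵀ t

      ⊗-distribʳ : ∀ y x x′ → (x M.+ᴹ x′) ⊗ y ≈ᵀ x ⊗ y ⊕ x′ ⊗ y
      ⊗-distribˡ : ∀ x y y′ → x ⊗ (y N.+ᴹ y′) ≈ᵀ x ⊗ y ⊕ x ⊗ y′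
      ⊗-scaleˡ   : ∀ r x y → (r M.*ₗ x) ⊗ y ≈ᵀ r · (x ⊗ y)
      ⊗-scaleʳ   : ∀ r x y → x ⊗ (r N.*ₗ y) ≈ᵀ r · (x ⊗ y)

    tensor : LeftModule ring (c ⊔ m ⊔ m′) (c ⊔ ℓ ⊔ m ⊔ ℓm ⊔ m′ ⊔ ℓm′)
    tensor = record
      { Carrierᴹ = Tensor
      ; _≈ᴹ_     = _≈ᵀ_
      ; _+ᴹ_     = _⊕_
      ; _*ₗ_     = _·_
      ; 0ᴹ       = 𝟘
      ; -ᴹ_      = ⊖_
      ; isLeftModule = IsLeftModule′.isLeftModule record
        { isEquivalence = record { refl = refl ; sym = sym ; trans = trans }
        ; +ᴹ-cong      = ⊕-cong
        ; -ᴹ‿cong      = ⊖-cong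
        ; *ₗ-cong      = ·-cong
        ; +ᴹ-assoc     = ⊕-assoc
        ; +ᴹ-comm      = ⊕-comm
        ; +ᴹ-identityˡ = ⊕-identityˡ
        ; -ᴹ‿inverseˡ  = ⊖-inverseˡ
        ; *ₗ-distribˡ  = ·-distribˡ
        ; *ₗ-distribʳ  = ·-distribʳ
        ; *ₗ-assoc     = ·-assoc
        ; *ₗ-identityˡ = ·-identityˡ
        }
      }

  module _ {M : LeftModule ring m ℓm} {M′ : LeftModule ring m′ ℓm′}
           (f : M ⟶ M′) (N : LeftModule ring m″ ℓm″) where
    private
      module f = _⟶_ f
      module N = LeftModule N

      map : Tensor M N → Tensor M′ N
      map (x ⊗ y) = f.to x ⊗ y
      map (t ⊕ u) = map t ⊕ map u
      map (r · t) = r · map t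
      map (⊖ t)   = ⊖ map t
      map 𝟘       = 𝟘

      map-cong : ∀ {t u} → _≈ᵀ_ M N t u → _≈ᵀ_ M′ N (map t) (map u)
      map-cong refl                = refl
      map-cong (sym e)             = sym (map-cong e)
      map-cong (trans e e′)        = trans (map-cong e) (map-cong e′)
      map-cong (⊗-cong e e′)       = ⊗-cong (f.⟦⟧-cong e) e′
      map-cong (⊕-cong e e′)       = ⊕-cong (map-cong e) (map-cong e′)
      map-cong (·-cong e e′)       = ·-cong e (map-cong e′)
      map-cong (⊖-cong e)          = ⊖-cong (map-cong e)
      map-cong (⊕-assoc t u v)     = ⊕-assoc _ _ _
      map-cong (⊕-comm t u)        = ⊕-comm _ _
      map-cong (⊕-identityˡ t)     = ⊕-identityˡ _
      map-cong (⊖-inverseˡ t)      = ⊖-inverseˡ _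
      map-cong (·-distribˡ r t u)  = ·-distribˡ _ _ _
      map-cong (·-distribʳ t r s)  = ·-distribʳ _ _ _
      map-cong (·-assoc r s t)     = ·-assoc _ _ _
      map-cong (·-identityˡ t)     = ·-identityˡ _
      map-cong (⊗-distribʳ y x x′) =
        trans (⊗-cong (f.+ᴹ-homo x x′) N.≈ᴹ-refl) (⊗-distribʳ y _ _)
      map-cong (⊗-distribˡ x y y′) = ⊗-distribˡ _ y y′
      map-cong (⊗-scaleˡ r x y)    =
        trans (⊗-cong (f.*ₗ-homo r x) N.≈ᴹ-refl) (⊗-scaleˡ r _ y)
      map-cong (⊗-scaleʳ r x y)    = ⊗-scaleʳ r _ y

    tensorMap : tensor M N ⟶ tensor M′ N
    tensorMap = linear map map-cong (λ _ _ → refl) (λ _ _ → refl)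

  record FreeResolution (M : LeftModule ring m ℓm) : Set (c ⊔ ℓ ⊔ m ⊔ ℓm) where
    field
      rank         : ℕ → ℕ
      ∂            : ∀ i → R^ rank (suc i) ⟶ R^ rank i
      augmentation : R^ rank 0 ⟶ M
      surjective   : Surjective (LeftModule._≈ᴹ_ (R^ rank 0)) (LeftModule._≈ᴹ_ M) (to augmentation)
      exact₀       : Exact (∂ 0) augmentation
      exact        : ∀ i → Exact (∂ (suc i)) (∂ i)

  -- Tor_i(M, N) as the i-th homology of F ⊗ N, with F ⊗ N zero in degree -1.
  Tor : {M : LeftModule ring m ℓm} → FreeResolution M → (N : LeftModule ring m′ ℓm′) →
        ℕ → LeftModule ring (c ⊔ ℓ ⊔ m′ ⊔ ℓm′) (c ⊔ ℓ ⊔ m′ ⊔ ℓm′)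
  Tor {m′ = m′} {ℓm′} F N zero    =
    homology (tensorMap (∂ 0) N) (toZero {a = c ⊔ m′} {b = c ⊔ ℓ ⊔ m′ ⊔ ℓm′})
    where open FreeResolution F
  Tor F N (suc i) = homology (tensorMap (∂ (suc i)) N) (tensorMap (∂ i) N)
    where open FreeResolution F

module _ (R : CommutativeRing c ℓ) (S : CommutativeRing p q)
         (f : RingHomomorphism (CommutativeRing.rawRing R) (CommutativeRing.rawRing S)) where
  private
    module f = RingHomomorphism f
    module S = CommutativeRing S

  restrictScalars : LeftModule S.ring m ℓm → LeftModule (CommutativeRing.ring R) m ℓm
  restrictScalars M = record
    { Carrierᴹ = Carrierᴹ
    ; _≈ᴹ_     = _≈ᴹ_
    ; _+ᴹ_     = _+ᴹ_
    ; _*ₗ_     = λ r x → f.⟦ r ⟧ *ₗ x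
    ; 0ᴹ       = 0ᴹ
    ; -ᴹ_      = -ᴹ_
    ; isLeftModule = Modules.IsLeftModule′.isLeftModule {R = R} record
      { isEquivalence = ≈ᴹ-isEquivalence
      ; +ᴹ-cong      = +ᴹ-cong
      ; -ᴹ‿cong      = -ᴹ‿cong
      ; *ₗ-cong      = λ e → *ₗ-cong (f.⟦⟧-cong e)
      ; +ᴹ-assoc     = +ᴹ-assoc
      ; +ᴹ-comm      = +ᴹ-comm
      ; +ᴹ-identityˡ = +ᴹ-identityˡ
      ; -ᴹ‿inverseˡ  = -ᴹ‿inverseˡ
      ; *ₗ-distribˡ  = λ r → *ₗ-distribˡ f.⟦ r ⟧
      ; *ₗ-distribʳ  = λ x r s → ≈ᴹ-trans (*ₗ-congʳ (f.+-homo r s)) (*ₗ-distribʳ x _ _)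
      ; *ₗ-assoc     = λ r s x → ≈ᴹ-trans (*ₗ-congʳ (f.*-homo r s)) (*ₗ-assoc _ _ x)
      ; *ₗ-identityˡ = λ x → ≈ᴹ-trans (*ₗ-congʳ f.1#-homo) (*ₗ-identityˡ x)
      }
    }
    where open LeftModule M

module Polynomials (K : CommutativeRing c ℓ) (n : ℕ) where

  open CommutativeRing K
  open SetoidReasoning setoid
  private
    module KP = RingProperties ring
    open CommutativeSemigroupProperties +-commutativeSemigroup using (interchange)

  Monomial : Set
  Monomial = Vec ℕ n

  infixl 7 _∙_
  _∙_ : Monomial → Monomial → Monomial
  _∙_ = zipWith ℕ._+_

  𝟏 : Monomial
  𝟏 = Vec.replicate n 0

  infix 4 _≟ᴹ_
  _≟ᴹ_ : (α β : Monomial) → Dec (α ≡ β)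
  _≟ᴹ_ = Vecₚ.≡-dec ℕₚ._≟_

  -- A monomial is its exponent vector; a polynomial is a list of terms, possibly with
  -- repeated monomials and zero coefficients; equality is equality of all coefficients.
  Polynomial : Set c
  Polynomial = List (Carrier × Monomial)

  -- The linear extension of φ to polynomials.
  ⟦_⟧ : Polynomial → (Monomial → Carrier) → Carrier
  ⟦ [] ⟧          φ = 0#
  ⟦ (a , α) ∷ f ⟧ φ = a * φ α + ⟦ f ⟧ φ

  δ : Monomial → Monomial → Carrier
  δ α β = if does (β ≟ᴹ α) then 1# else 0#

  coeff : Polynomial → Monomial → Carrier
  coeff f α = ⟦ f ⟧ (δ α)

  infix 4 _≈ᴾ_
  record _≈ᴾ_ (f g : Polynomial) : Set ℓ where
    constructor mk≈
    field coeff-≈ : ∀ α → coeff f α ≈ coeff g α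

  open _≈ᴾ_ public

  infixr 8 _·ᵗ_
  _·ᵗ_ : Carrier × Monomial → Polynomial → Polynomial
  t       ·ᵗ []            = []
  (a , α) ·ᵗ ((b , β) ∷ f) = (a * b , α ∙ β) ∷ ((a , α) ·ᵗ f)

  infixl 7 _*ᴾ_
  _*ᴾ_ : Polynomial → Polynomial → Polynomial
  []      *ᴾ g = []
  (t ∷ f) *ᴾ g = t ·ᵗ g ++ f *ᴾ g

  infix 8 -ᴾ_
  -ᴾ_ : Polynomial → Polynomial
  -ᴾ []            = []
  -ᴾ ((a , α) ∷ f) = (- a , α) ∷ -ᴾ f

  ⟦⟧-congʳ : ∀ f {φ ψ} → (∀ α → φ α ≈ ψ α) → ⟦ f ⟧ φ ≈ ⟦ f ⟧ ψ
  ⟦⟧-congʳ []            e = refl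
  ⟦⟧-congʳ ((a , α) ∷ f) e = +-cong (*-congˡ (e α)) (⟦⟧-congʳ f e)

  ⟦⟧-++ : ∀ f g φ → ⟦ f ++ g ⟧ φ ≈ ⟦ f ⟧ φ + ⟦ g ⟧ φ
  ⟦⟧-++ []            g φ = sym (+-identityˡ _)
  ⟦⟧-++ ((a , α) ∷ f) g φ = trans (+-congˡ (⟦⟧-++ f g φ)) (sym (+-assoc _ _ _))

  ⟦⟧-neg : ∀ f φ → ⟦ -ᴾ f ⟧ φ ≈ - ⟦ f ⟧ φ
  ⟦⟧-neg []            φ = sym KP.-0#≈0#
  ⟦⟧-neg ((a , α) ∷ f) φ = trans
    (+-cong (sym (KP.-‿distribˡ-* a (φ α))) (⟦⟧-neg f φ)) (KP.-‿+-comm _ _)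

  ⟦⟧-0 : ∀ f → ⟦ f ⟧ (λ _ → 0#) ≈ 0#
  ⟦⟧-0 []            = refl
  ⟦⟧-0 ((a , α) ∷ f) = trans (+-cong (zeroʳ a) (⟦⟧-0 f)) (+-identityˡ 0#)

  ⟦⟧-+ : ∀ f φ ψ → ⟦ f ⟧ (λ α → φ α + ψ α) ≈ ⟦ f ⟧ φ + ⟦ f ⟧ ψ
  ⟦⟧-+ []            φ ψ = sym (+-identityˡ 0#)
  ⟦⟧-+ ((a , α) ∷ f) φ ψ = trans
    (+-cong (distribˡ a _ _) (⟦⟧-+ f φ ψ)) (interchange _ _ _ _)

  ⟦⟧-* : ∀ f a φ → ⟦ f ⟧ (λ α → a * φ α) ≈ a * ⟦ f ⟧ φ
  ⟦⟧-* []            a φ = sym (zeroʳ a)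
  ⟦⟧-* ((b , β) ∷ f) a φ = begin
    b * (a * φ β) + ⟦ f ⟧ (λ α → a * φ α)  ≈⟨ +-cong swap (⟦⟧-* f a φ) ⟩
    a * (b * φ β) + a * ⟦ f ⟧ φ            ≈⟨ distribˡ a _ _ ⟨
    a * (b * φ β + ⟦ f ⟧ φ)                ∎
    where
    swap : b * (a * φ β) ≈ a * (b * φ β)
    swap = trans (sym (*-assoc b a _)) (trans (*-congʳ (*-comm b a)) (*-assoc a b _))

  ⟦⟧-·ᵗ : ∀ a α f φ → ⟦ (a , α) ·ᵗ f ⟧ φ ≈ a * ⟦ f ⟧ (λ β → φ (α ∙ β))
  ⟦⟧-·ᵗ a α []            φ = sym (zeroʳ a)
  ⟦⟧-·ᵗ a α ((b , β) ∷ f) φ = trans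
    (+-cong (*-assoc a b _) (⟦⟧-·ᵗ a α f φ)) (sym (distribˡ a _ _))

  ⟦⟧-*ᴾ : ∀ f g φ → ⟦ f *ᴾ g ⟧ φ ≈ ⟦ f ⟧ (λ α → ⟦ g ⟧ (λ β → φ (α ∙ β)))
  ⟦⟧-*ᴾ []            g φ = refl
  ⟦⟧-*ᴾ ((a , α) ∷ f) g φ = trans
    (⟦⟧-++ ((a , α) ·ᵗ g) (f *ᴾ g) φ) (+-cong (⟦⟧-·ᵗ a α g φ) (⟦⟧-*ᴾ f g φ))

  ⟦⟧-swap : ∀ f g (ψ : Monomial → Monomial → Carrier) →
            ⟦ f ⟧ (λ α → ⟦ g ⟧ (ψ α)) ≈ ⟦ g ⟧ (λ β → ⟦ f ⟧ (λ α → ψ α β))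
  ⟦⟧-swap []            g ψ = sym (⟦⟧-0 g)
  ⟦⟧-swap ((a , α) ∷ f) g ψ = begin
    a * ⟦ g ⟧ (ψ α) + ⟦ f ⟧ (λ α → ⟦ g ⟧ (ψ α))
      ≈⟨ +-cong (sym (⟦⟧-* g a (ψ α))) (⟦⟧-swap f g ψ) ⟩
    ⟦ g ⟧ (λ β → a * ψ α β) + ⟦ g ⟧ (λ β → ⟦ f ⟧ (λ α → ψ α β))
      ≈⟨ ⟦⟧-+ g _ _ ⟨
    ⟦ g ⟧ (λ β → a * ψ α β + ⟦ f ⟧ (λ α → ψ α β))
      ∎

  -- Equal coefficients imply equal values of every linear extension: collect the
  -- terms of f with the same monomial as its head, and recurse on the rest.
  private
    drop : Monomial → Polynomial → Polynomial
    drop α [] = []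
    drop α ((b , β) ∷ f) with β ≟ᴹ α
    ... | yes _ = drop α f
    ... | no  _ = (b , β) ∷ drop α f

    length-drop : ∀ α f → length (drop α f) ℕ.≤ length f
    length-drop α [] = z≤n
    length-drop α ((b , β) ∷ f) with β ≟ᴹ α
    ... | yes _ = ℕₚ.m≤n⇒m≤1+n (length-drop α f)
    ... | no  _ = s≤s (length-drop α f)

    ⟦⟧-split : ∀ α f φ → ⟦ f ⟧ φ ≈ coeff f α * φ α + ⟦ drop α f ⟧ φ
    ⟦⟧-split α [] φ = sym (trans (+-identityʳ _) (zeroˡ _))
    ⟦⟧-split α ((b , β) ∷ f) φ with β ≟ᴹ α
    ... | yes ≡.refl = begin
      b * φ α + ⟦ f ⟧ φ
        ≈⟨ +-cong (*-congʳ (sym (*-identityʳ b))) (⟦⟧-split α f φ) ⟩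
      b * 1# * φ α + (coeff f α * φ α + ⟦ drop α f ⟧ φ)
        ≈⟨ +-assoc _ _ _ ⟨
      b * 1# * φ α + coeff f α * φ α + ⟦ drop α f ⟧ φ
        ≈⟨ +-congʳ (distribʳ _ _ _) ⟨
      (b * 1# + coeff f α) * φ α + ⟦ drop α f ⟧ φ
        ∎
    ... | no _ = begin
      b * φ β + ⟦ f ⟧ φ
        ≈⟨ +-congˡ (⟦⟧-split α f φ) ⟩
      b * φ β + (coeff f α * φ α + ⟦ drop α f ⟧ φ)
        ≈⟨ +-assoc _ _ _ ⟨
      b * φ β + coeff f α * φ α + ⟦ drop α f ⟧ φ
        ≈⟨ +-congʳ (+-comm _ _) ⟩
      coeff f α * φ α + b * φ β + ⟦ drop α f ⟧ φ
        ≈⟨ +-assoc _ _ _ ⟩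
      coeff f α * φ α + (b * φ β + ⟦ drop α f ⟧ φ)
        ≈⟨ +-congʳ (*-congʳ (trans (+-congʳ (zeroʳ b)) (+-identityˡ _))) ⟨
      (b * 0# + coeff f α) * φ α + (b * φ β + ⟦ drop α f ⟧ φ)
        ∎

    vanish : ∀ k f → length f ℕ.≤ k → (∀ α → coeff f α ≈ 0#) → ∀ φ → ⟦ f ⟧ φ ≈ 0#
    vanish k       []                  _       _    φ = refl
    vanish (suc k) f@((a , α) ∷ f′) (s≤s len) all0 φ = trans (f≈dropf φ)
      (vanish k (drop α f) (ℕₚ.≤-trans shorter len)
        (λ β → trans (sym (f≈dropf (δ β))) (all0 β)) φ)
      where
      shorter : length (drop α f) ℕ.≤ length f′
      shorter with α ≟ᴹ α
      ... | yes _  = length-drop α f′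
      ... | no α≢α = ⊥-elim (α≢α ≡.refl)

      f≈dropf : ∀ φ → ⟦ f ⟧ φ ≈ ⟦ drop α f ⟧ φ
      f≈dropf φ = begin
        ⟦ f ⟧ φ                              ≈⟨ ⟦⟧-split α f φ ⟩
        coeff f α * φ α + ⟦ drop α f ⟧ φ     ≈⟨ +-congʳ (*-congʳ (all0 α)) ⟩
        0# * φ α + ⟦ drop α f ⟧ φ            ≈⟨ +-congʳ (zeroˡ _) ⟩
        0# + ⟦ drop α f ⟧ φ                  ≈⟨ +-identityˡ _ ⟩
        ⟦ drop α f ⟧ φ                       ∎

  ⟦⟧-congˡ : ∀ {f g} → f ≈ᴾ g → ∀ φ → ⟦ f ⟧ φ ≈ ⟦ g ⟧ φ
  ⟦⟧-congˡ {f} {g} f≈g φ = KP.x∙y⁻¹≈ε⇒x≈y _ _ (begin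
    ⟦ f ⟧ φ + - ⟦ g ⟧ φ    ≈⟨ difference φ ⟨
    ⟦ f ++ -ᴾ g ⟧ φ        ≈⟨ vanish _ (f ++ -ᴾ g) ℕₚ.≤-refl zero-coeff φ ⟩
    0#                     ∎)
    where
    difference : ∀ φ → ⟦ f ++ -ᴾ g ⟧ φ ≈ ⟦ f ⟧ φ + - ⟦ g ⟧ φ
    difference φ = trans (⟦⟧-++ f (-ᴾ g) φ) (+-congˡ (⟦⟧-neg g φ))

    zero-coeff : ∀ α → coeff (f ++ -ᴾ g) α ≈ 0#
    zero-coeff α = trans (difference (δ α))
      (trans (+-congʳ (coeff-≈ f≈g α)) (-‿inverseʳ _))

  private
    ∙-comm : ∀ α β → α ∙ β ≡ β ∙ α
    ∙-comm = Vecₚ.zipWith-comm ℕₚ.+-comm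

    ∙-assoc : ∀ α β γ → (α ∙ β) ∙ γ ≡ α ∙ (β ∙ γ)
    ∙-assoc = Vecₚ.zipWith-assoc ℕₚ.+-assoc

    ∙-identityˡ : ∀ α → 𝟏 ∙ α ≡ α
    ∙-identityˡ = Vecₚ.zipWith-identityˡ ℕₚ.+-identityˡ

    ++-cong : ∀ {f f′ g g′} → f ≈ᴾ f′ → g ≈ᴾ g′ → f ++ g ≈ᴾ f′ ++ g′
    ++-cong {f} {f′} {g} {g′} e e′ = mk≈ λ α →
      trans (⟦⟧-++ f g _) (trans (+-cong (coeff-≈ e α) (coeff-≈ e′ α)) (sym (⟦⟧-++ f′ g′ _)))

    ++-assoc : ∀ f g h → (f ++ g) ++ h ≈ᴾ f ++ (g ++ h)
    ++-assoc f g h = mk≈ λ α → begin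
      coeff ((f ++ g) ++ h) α                ≈⟨ ⟦⟧-++ (f ++ g) h _ ⟩
      coeff (f ++ g) α + coeff h α           ≈⟨ +-congʳ (⟦⟧-++ f g _) ⟩
      coeff f α + coeff g α + coeff h α      ≈⟨ +-assoc _ _ _ ⟩
      coeff f α + (coeff g α + coeff h α)    ≈⟨ +-congˡ (⟦⟧-++ g h _) ⟨
      coeff f α + coeff (g ++ h) α           ≈⟨ ⟦⟧-++ f (g ++ h) _ ⟨
      coeff (f ++ (g ++ h)) α                ∎

    ++-comm : ∀ f g → f ++ g ≈ᴾ g ++ f
    ++-comm f g = mk≈ λ α → trans (⟦⟧-++ f g _) (trans (+-comm _ _) (sym (⟦⟧-++ g f _)))

    -ᴾ-cong : ∀ {f g} → f ≈ᴾ g → -ᴾ f ≈ᴾ -ᴾ g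
    -ᴾ-cong {f} {g} e = mk≈ λ α →
      trans (⟦⟧-neg f _) (trans (-‿cong (coeff-≈ e α)) (sym (⟦⟧-neg g _)))

    -ᴾ-inverseˡ : ∀ f → -ᴾ f ++ f ≈ᴾ []
    -ᴾ-inverseˡ f = mk≈ λ α →
      trans (⟦⟧-++ (-ᴾ f) f _) (trans (+-congʳ (⟦⟧-neg f _)) (-‿inverseˡ _))

    *ᴾ-cong : ∀ {f f′ g g′} → f ≈ᴾ f′ → g ≈ᴾ g′ → f *ᴾ g ≈ᴾ f′ *ᴾ g′
    *ᴾ-cong {f} {f′} {g} {g′} e e′ = mk≈ λ γ → begin
      coeff (f *ᴾ g) γ                             ≈⟨ ⟦⟧-*ᴾ f g _ ⟩
      ⟦ f ⟧ (λ α → ⟦ g ⟧ (λ β → δ γ (α ∙ β)))      ≈⟨ ⟦⟧-congˡ e _ ⟩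
      ⟦ f′ ⟧ (λ α → ⟦ g ⟧ (λ β → δ γ (α ∙ β)))     ≈⟨ ⟦⟧-congʳ f′ (λ α → ⟦⟧-congˡ e′ _) ⟩
      ⟦ f′ ⟧ (λ α → ⟦ g′ ⟧ (λ β → δ γ (α ∙ β)))    ≈⟨ ⟦⟧-*ᴾ f′ g′ _ ⟨
      coeff (f′ *ᴾ g′) γ                           ∎

    *ᴾ-comm : ∀ f g → f *ᴾ g ≈ᴾ g *ᴾ f
    *ᴾ-comm f g = mk≈ λ γ → begin
      coeff (f *ᴾ g) γ                             ≈⟨ ⟦⟧-*ᴾ f g _ ⟩
      ⟦ f ⟧ (λ α → ⟦ g ⟧ (λ β → δ γ (α ∙ β)))      ≈⟨ ⟦⟧-swap f g _ ⟩
      ⟦ g ⟧ (λ β → ⟦ f ⟧ (λ α → δ γ (α ∙ β)))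
        ≈⟨ ⟦⟧-congʳ g (λ β → ⟦⟧-congʳ f (λ α → reflexive (≡.cong (δ γ) (∙-comm α β)))) ⟩
      ⟦ g ⟧ (λ β → ⟦ f ⟧ (λ α → δ γ (β ∙ α)))      ≈⟨ ⟦⟧-*ᴾ g f _ ⟨
      coeff (g *ᴾ f) γ                             ∎

    *ᴾ-assoc : ∀ f g h → (f *ᴾ g) *ᴾ h ≈ᴾ f *ᴾ (g *ᴾ h)
    *ᴾ-assoc f g h = mk≈ λ ε → begin
      coeff ((f *ᴾ g) *ᴾ h) ε
        ≈⟨ ⟦⟧-*ᴾ (f *ᴾ g) h _ ⟩
      ⟦ f *ᴾ g ⟧ (λ α → ⟦ h ⟧ (λ γ → δ ε (α ∙ γ)))
        ≈⟨ ⟦⟧-*ᴾ f g _ ⟩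
      ⟦ f ⟧ (λ α → ⟦ g ⟧ (λ β → ⟦ h ⟧ (λ γ → δ ε ((α ∙ β) ∙ γ))))
        ≈⟨ ⟦⟧-congʳ f (λ α → ⟦⟧-congʳ g (λ β → ⟦⟧-congʳ h (λ γ →
             reflexive (≡.cong (δ ε) (∙-assoc α β γ))))) ⟩
      ⟦ f ⟧ (λ α → ⟦ g ⟧ (λ β → ⟦ h ⟧ (λ γ → δ ε (α ∙ (β ∙ γ)))))
        ≈⟨ ⟦⟧-congʳ f (λ α → ⟦⟧-*ᴾ g h _) ⟨
      ⟦ f ⟧ (λ α → ⟦ g *ᴾ h ⟧ (λ β → δ ε (α ∙ β)))
        ≈⟨ ⟦⟧-*ᴾ f (g *ᴾ h) _ ⟨
      coeff (f *ᴾ (g *ᴾ h)) ε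
        ∎

    *ᴾ-distribʳ : ∀ h f g → (f ++ g) *ᴾ h ≈ᴾ f *ᴾ h ++ g *ᴾ h
    *ᴾ-distribʳ h f g = mk≈ λ α → begin
      coeff ((f ++ g) *ᴾ h) α                  ≈⟨ ⟦⟧-*ᴾ (f ++ g) h _ ⟩
      ⟦ f ++ g ⟧ _                             ≈⟨ ⟦⟧-++ f g _ ⟩
      ⟦ f ⟧ _ + ⟦ g ⟧ _                        ≈⟨ +-cong (⟦⟧-*ᴾ f h _) (⟦⟧-*ᴾ g h _) ⟨
      coeff (f *ᴾ h) α + coeff (g *ᴾ h) α      ≈⟨ ⟦⟧-++ (f *ᴾ h) (g *ᴾ h) _ ⟨
      coeff (f *ᴾ h ++ g *ᴾ h) α               ∎

    *ᴾ-identityˡ : ∀ f → [ 1# , 𝟏 ] *ᴾ f ≈ᴾ f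
    *ᴾ-identityˡ f = mk≈ λ α → begin
      coeff ([ 1# , 𝟏 ] *ᴾ f) α                ≈⟨ ⟦⟧-*ᴾ [ 1# , 𝟏 ] f _ ⟩
      1# * ⟦ f ⟧ (λ β → δ α (𝟏 ∙ β)) + 0#      ≈⟨ +-identityʳ _ ⟩
      1# * ⟦ f ⟧ (λ β → δ α (𝟏 ∙ β))           ≈⟨ *-identityˡ _ ⟩
      ⟦ f ⟧ (λ β → δ α (𝟏 ∙ β))
        ≈⟨ ⟦⟧-congʳ f (λ β → reflexive (≡.cong (δ α) (∙-identityˡ β))) ⟩
      coeff f α                                ∎

    ≈ᴾ-isEquivalence : IsEquivalence _≈ᴾ_
    ≈ᴾ-isEquivalence = record
      { refl  = mk≈ λ _ → refl
      ; sym   = λ e → mk≈ λ α → sym (coeff-≈ e α)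
      ; trans = λ e e′ → mk≈ λ α → trans (coeff-≈ e α) (coeff-≈ e′ α)
      }
    module P = IsEquivalence ≈ᴾ-isEquivalence

  polynomialRing : CommutativeRing c ℓ
  polynomialRing = record
    { Carrier = Polynomial
    ; _≈_     = _≈ᴾ_
    ; _+_     = _++_
    ; _*_     = _*ᴾ_
    ; -_      = -ᴾ_
    ; 0#      = []
    ; 1#      = [ 1# , 𝟏 ]
    ; isCommutativeRing = record
      { isRing = record
        { +-isAbelianGroup = record
          { isGroup = record
            { isMonoid = record
              { isSemigroup = record
                { isMagma = record { isEquivalence = ≈ᴾ-isEquivalence ; ∙-cong = ++-cong }
                ; assoc   = ++-assoc
                }
              ; identity = (λ _ → P.refl) , λ f → ++-comm f []
              }
            ; inverse = -ᴾ-inverseˡ , λ f → P.trans (++-comm f (-ᴾ f)) (-ᴾ-inverseˡ f)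
            ; ⁻¹-cong = -ᴾ-cong
            }
          ; comm = ++-comm
          }
        ; *-cong     = *ᴾ-cong
        ; *-assoc    = *ᴾ-assoc
        ; *-identity = *ᴾ-identityˡ , λ f → P.trans (*ᴾ-comm f _) (*ᴾ-identityˡ f)
        ; distrib    =
            (λ h f g → P.trans (*ᴾ-comm h (f ++ g)) (P.trans (*ᴾ-distribʳ h f g)
              (++-cong (*ᴾ-comm f h) (*ᴾ-comm g h))))
          , *ᴾ-distribʳ
        }
      ; *-comm = *ᴾ-comm
      }
    }

  monomial : Monomial → Polynomial
  monomial α = [ 1# , α ]

  constant : RingHomomorphism rawRing (CommutativeRing.rawRing polynomialRing)
  constant = record
    { ⟦_⟧ = λ a → [ a , 𝟏 ]
    ; isRingHomomorphism = record
      { isSemiringHomomorphism = record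
        { isNearSemiringHomomorphism = record
          { +-isMonoidHomomorphism = record
            { isMagmaHomomorphism = record
              { isRelHomomorphism = record { cong = λ e → mk≈ λ α → +-congʳ (*-congʳ e) }
              ; homo = λ a b → mk≈ λ α → trans (+-congʳ (distribʳ _ a b)) (+-assoc _ _ _)
              }
            ; ε-homo = mk≈ λ α → trans (+-identityʳ _) (zeroˡ _)
            }
          ; *-homo = λ a b → mk≈ λ α → reflexive
              (≡.cong (λ β → a * b * δ α β + 0#) (≡.sym (∙-identityˡ 𝟏)))
          }
        ; 1#-homo = P.refl
        }
      ; -‿homo = λ a → P.refl
      }
    }

  -- f ↦ f(0), the quotient map by the ideal (x₁, …, xₙ).
  constantTerm : RingHomomorphism (CommutativeRing.rawRing polynomialRing) rawRing
  constantTerm = record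
    { ⟦_⟧ = λ f → coeff f 𝟏
    ; isRingHomomorphism = record
      { isSemiringHomomorphism = record
        { isNearSemiringHomomorphism = record
          { +-isMonoidHomomorphism = record
            { isMagmaHomomorphism = record
              { isRelHomomorphism = record { cong = λ e → coeff-≈ e 𝟏 }
              ; homo = λ f g → ⟦⟧-++ f g _
              }
            ; ε-homo = refl
            }
          ; *-homo = λ f g → begin
              coeff (f *ᴾ g) 𝟏
                ≈⟨ ⟦⟧-*ᴾ f g _ ⟩
              ⟦ f ⟧ (λ α → ⟦ g ⟧ (λ β → δ 𝟏 (α ∙ β)))
                ≈⟨ ⟦⟧-congʳ f (λ α → ⟦⟧-congʳ g (λ β → δ𝟏-∙ α β)) ⟩
              ⟦ f ⟧ (λ α → ⟦ g ⟧ (λ β → δ 𝟏 α * δ 𝟏 β))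
                ≈⟨ ⟦⟧-congʳ f (λ α → trans (⟦⟧-* g (δ 𝟏 α) (δ 𝟏)) (*-comm _ _)) ⟩
              ⟦ f ⟧ (λ α → coeff g 𝟏 * δ 𝟏 α)
                ≈⟨ ⟦⟧-* f (coeff g 𝟏) (δ 𝟏) ⟩
              coeff g 𝟏 * coeff f 𝟏
                ≈⟨ *-comm _ _ ⟩
              coeff f 𝟏 * coeff g 𝟏
                ∎
          }
        ; 1#-homo = trans (+-identityʳ _) (trans (*-identityˡ _) δ𝟏𝟏)
        }
      ; -‿homo = λ f → ⟦⟧-neg f _
      }
    }
    where
    ∙-conicalˡ : ∀ {k} (α β : Vec ℕ k) → zipWith ℕ._+_ α β ≡ Vec.replicate k 0 → α ≡ Vec.replicate k 0
    ∙-conicalˡ Vec.[]        Vec.[]      _ = ≡.refl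
    ∙-conicalˡ (zero Vec.∷ α) (b Vec.∷ β) e = ≡.cong (0 Vec.∷_) (∙-conicalˡ α β (Vecₚ.∷-injectiveʳ e))

    δ𝟏𝟏 : δ 𝟏 𝟏 ≈ 1#
    δ𝟏𝟏 with 𝟏 ≟ᴹ 𝟏
    ... | yes _   = refl
    ... | no 𝟏≢𝟏 = ⊥-elim (𝟏≢𝟏 ≡.refl)

    δ𝟏-∙ : ∀ α β → δ 𝟏 (α ∙ β) ≈ δ 𝟏 α * δ 𝟏 β
    δ𝟏-∙ α β with α ≟ᴹ 𝟏
    ... | yes ≡.refl = trans (reflexive (≡.cong (δ 𝟏) (∙-identityˡ β))) (sym (*-identityˡ _))
    ... | no α≢𝟏 with α ∙ β ≟ᴹ 𝟏
    ...   | yes e = ⊥-elim (α≢𝟏 (∙-conicalˡ α β e))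
    ...   | no  _ = sym (zeroˡ _)

module BettiNumbers {c ℓ₁ ℓ₂} (𝕂 : HeytingField c ℓ₁ ℓ₂) (n : ℕ) where

  K : CommutativeRing c ℓ₁
  K = HeytingCommutativeRing.commutativeRing (HeytingField.heytingCommutativeRing 𝕂)

  open Polynomials K n public using (polynomialRing; monomial; constant; constantTerm)

  R : CommutativeRing c ℓ₁
  R = polynomialRing

  open CommutativeRing K using () renaming (ring to K-ring)
  open CommutativeRing R using () renaming (ring to R-ring)
  open Modules R
  module Vect = Modules K

  residueField : LeftModule R-ring c ℓ₁
  residueField = restrictScalars R K constantTerm TensorUnit.leftModule

  asVectorSpace : LeftModule R-ring m ℓm → LeftModule K-ring m ℓm
  asVectorSpace = restrictScalars K R constant

  HasDimension : LeftModule K-ring m ℓm → ℕ → Set (c ⊔ ℓ₁ ⊔ m ⊔ ℓm)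
  HasDimension = Vect.Basis

  -- β_i(M) = b. Tor is only determined up to isomorphism, so the dimension is
  -- required for every resolution by free modules of finite rank (these suffice, R
  -- being noetherian and M finitely generated); the first component rules out that
  -- this holds vacuously.
  IsBettiNumber : LeftModule R-ring m ℓm → ℕ → ℕ → Set (c ⊔ ℓ₁ ⊔ m ⊔ ℓm)
  IsBettiNumber M i b =
    FreeResolution M ×
    (∀ (F : FreeResolution M) → HasDimension (asVectorSpace (Tor F residueField i)) b)

  -- ∏_{v ∈ e} x_v, whose exponent vector is the indicator of e.
  𝐱 : Subset n → CommutativeRing.Carrier R
  𝐱 e = monomial (Vec.map (λ b → if b then 1 else 0) e)

  circuitIdeal : ∀ {d} → Clutter n d → LeftModule R-ring (c ⊔ ℓ₁) ℓ₁
  circuitIdeal D =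
    submodule TensorUnit.leftModule (span TensorUnit.leftModule {J = ∃ (circuits D)} (𝐱 ∘ proj₁))

{-# OPTIONS --safe #-}

-- Removing an exposed circuit e adjoins x_e to the circuit ideal I of the complement, and I : x_e is
-- generated by the k variables outside the maximal clique K containing e: if v ∉ K then, by uniqueness
-- of K, e ∪ {v} is not a clique and so contains a d-set generating I; conversely all d-subsets of K are
-- circuits.  The mapping cone of the Koszul complex of these variables on a resolution of I therefore
-- resolves I + (x_e) and adds k C i to the i-th rank; the Koszul complexes arise from the same cone.
-- All generators lie in degree d, so the chain map can be chosen with homogeneous linear entries.
-- Hence the iterated cone is minimal, and it computes Tor from any resolution by chain homotopy.
module Submission where

open import Algebra.Apartness.Bundles using (HeytingField)
open import Algebra.Bundles using (CommutativeRing; CommutativeMonoid)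
open import Algebra.Module.Bundles using (LeftModule)
open import Algebra.Morphism.Bundles using (RingHomomorphism)
open import Data.Bool.Base using (Bool; true; false; if_then_else_; _∨_)
open import Data.Empty using (⊥-elim)
open import Data.Fin.Base using (Fin; zero; suc; inject₁; fromℕ; _↑ˡ_; _↑ʳ_; splitAt; join)
open import Data.Fin.Properties using (splitAt-↑ˡ; splitAt-↑ʳ; join-splitAt; any?)
open import Data.Fin.Subset using (Subset; _⊆_; ∣_∣; _∪_; ⁅_⁆) renaming (_∈_ to _∈ˢ_; _∉_ to _∉ˢ_)
open import Data.List.Base as List using ([]; [_])
open import Data.Nat.Base as ℕ using (ℕ; zero; suc; _≤_; _∸_; +-0-rawMonoid)
open import Data.Nat.Combinatorics using (_C_; k>n⇒nCk≡0; nCk+nC[k+1]≡[n+1]C[k+1])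
open import Data.Product.Base using (Σ-syntax; ∃; ∃-syntax; _×_; _,_; proj₁; proj₂)
open import Data.Sum.Base using (_⊎_; inj₁; inj₂; [_,_]′)
open import Data.Unit.Base using (⊤; tt)
open import Data.Vec.Base as Vec using (Vec; zipWith)
open import Data.Vec.Functional using (Vector; _∷_; _++_)
open import Function.Base using (_∘_; id)
open import Function.Bundles using (mk⇔; Equivalence)
open import Level using (Level; Lift; lift; lower; _⊔_; 0ℓ)
open import Relation.Binary.PropositionalEquality as ≡ using (_≡_; _≢_)
open import Relation.Nullary using (Dec; yes; no; does; ¬_; ¬?; _×-dec_)
open import Relation.Unary using (Pred; Decidable; _∈_)
open import Algebra.Definitions.RawMonoid +-0-rawMonoid using (sum)
import Algebra.Definitions.RawMonoid as RawMonoidDefs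
import Algebra.Module.Construct.TensorUnit as TensorUnit
import Algebra.Properties.AbelianGroup as AbelianGroupProperties
import Algebra.Properties.CommutativeMonoid.Sum as MonoidSum
import Algebra.Properties.CommutativeSemigroup as CommutativeSemigroupProperties
import Algebra.Properties.Ring as RingProperties
import Data.Bool.Properties as Boolₚ
import Data.Fin.Subset as Subset
import Data.Fin.Subset.Properties as Subsetₚ
import Data.Nat.Properties as ℕₚ
import Data.Vec.Properties as Vecₚ
import Relation.Binary.Reasoning.Setoid as SetoidReasoning
open import Defs

-- Linear algebra

-- Equality with zero in a Heyting field need not be decidable, so a resolution cannot be made
-- minimal afterwards by looking for unit entries to cancel. Minimality has to be built in: with all
-- generators in one degree, homogeneity can be stated without twisting the free modules, and every
-- map after the one onto the ideal has entries of degree 1, which have no constant term.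
-- Multiplication by x_e, the only map of degree d in the cone besides the map onto I, joins it in
-- the row that covers the enlarged ideal and so stays outside the complex that computes Tor.
--
-- The cone needs R in degree 0, so everything is done for R / I, and the i-th rank for the ideal I
-- sits in degree i + 1. The Koszul complex has rank k C i in degree i and enters the cone one
-- degree higher, which gives the term k C i without a shift.
--
-- For an arbitrary resolution F, comparison maps run both ways between F and the minimal G. After
-- tensoring with the residue field the differentials of G between degrees of positive index vanish,
-- so the unit vectors of G give the basis of Tor, transported along the comparison into F.

module Linear {c ℓ} (R : CommutativeRing c ℓ) where

  private
    variable
      m ℓm m′ ℓm′ m″ ℓm″ : Level
    module R = CommutativeRing R
  open R using (ring) renaming (Carrier to ∣R∣)
  open Modules R
  open _⟶_ using (⟦⟧-cong; +ᴹ-homo; *ₗ-homo; 0ᴹ-homo; -ᴹ-homo)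

  module ModuleProperties (M : LeftModule ring m ℓm) where
    open LeftModule M public
    open AbelianGroupProperties +ᴹ-abelianGroup public
    open CommutativeSemigroupProperties
      (CommutativeMonoid.commutativeSemigroup +ᴹ-commutativeMonoid) public using (interchange)
    open SetoidReasoning ≈ᴹ-setoid public

    scale-neg : ∀ r x → r *ₗ (-ᴹ x) ≈ᴹ -ᴹ (r *ₗ x)
    scale-neg r x = inverseˡ-unique _ _
      (≈ᴹ-trans (≈ᴹ-sym (*ₗ-distribˡ r (-ᴹ x) x))
        (≈ᴹ-trans (*ₗ-congˡ (-ᴹ‿inverseˡ x)) (*ₗ-zeroʳ r)))

  module _ (M : LeftModule ring m ℓm) where
    open ModuleProperties M
    open RawMonoidDefs +ᴹ-rawMonoid using () renaming (sum to sumᴹ)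
    module Σᴹ = MonoidSum +ᴹ-commutativeMonoid

    sum-scale : ∀ {k} r (x : Fin k → Carrierᴹ) → r *ₗ sumᴹ x ≈ᴹ sumᴹ (λ j → r *ₗ x j)
    sum-scale {zero}  r x = *ₗ-zeroʳ r
    sum-scale {suc k} r x = ≈ᴹ-trans (*ₗ-distribˡ r _ _) (+ᴹ-congˡ (sum-scale r (x ∘ suc)))

    comb : ∀ {k} → (Fin k → Carrierᴹ) → R^ k ⟶ M
    comb v = linear (λ x → sumᴹ (λ j → x j *ₗ v j))
      (λ x≈y → Σᴹ.sum-cong-≋ (λ j → *ₗ-congʳ (x≈y j)))
      (λ x y → ≈ᴹ-trans (Σᴹ.sum-cong-≋ (λ j → *ₗ-distribʳ (v j) (x j) (y j)))
        (Σᴹ.∑-distrib-+ (λ j → x j *ₗ v j) (λ j → y j *ₗ v j)))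
      (λ r x → ≈ᴹ-trans (Σᴹ.sum-cong-≋ (λ j → *ₗ-assoc r (x j) (v j))) (≈ᴹ-sym (sum-scale r (λ j → x j *ₗ v j))))

  unit : ∀ {k} → Fin k → Vector ∣R∣ k
  unit zero    = R.1# ∷ λ _ → R.0#
  unit (suc j) = R.0# ∷ unit j

  module _ {A : LeftModule ring m ℓm} {B : LeftModule ring m′ ℓm′} {N : LeftModule ring m″ ℓm″} where
    private
      module B = LeftModule B
      module N = LeftModule N

    infixr 9 _∘ₗ_
    _∘ₗ_ : B ⟶ N → A ⟶ B → A ⟶ N
    g ∘ₗ f = linear (to g ∘ to f) (⟦⟧-cong g ∘ ⟦⟧-cong f)
      (λ x y → N.≈ᴹ-trans (⟦⟧-cong g (+ᴹ-homo f x y)) (+ᴹ-homo g _ _))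
      (λ r x → N.≈ᴹ-trans (⟦⟧-cong g (*ₗ-homo f r x)) (*ₗ-homo g r _))

  idₗ : {A : LeftModule ring m ℓm} → A ⟶ A
  idₗ {A = A} = linear (λ x → x) (λ e → e) (λ _ _ → ≈ᴹ-refl) (λ _ _ → ≈ᴹ-refl)
    where open LeftModule A

  module _ {A : LeftModule ring m ℓm} {B : LeftModule ring m′ ℓm′} where
    open ModuleProperties B
    private module A = LeftModule A

    0ₗ : A ⟶ B
    0ₗ = linear (λ _ → 0ᴹ) (λ _ → ≈ᴹ-refl) (λ _ _ → ≈ᴹ-sym (+ᴹ-identityˡ 0ᴹ))
      (λ r _ → ≈ᴹ-sym (*ₗ-zeroʳ r))

    infixl 6 _+ₗ_
    _+ₗ_ : A ⟶ B → A ⟶ B → A ⟶ B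
    f +ₗ g = linear (λ x → to f x +ᴹ to g x) (λ e → +ᴹ-cong (⟦⟧-cong f e) (⟦⟧-cong g e))
      (λ x y → ≈ᴹ-trans (+ᴹ-cong (+ᴹ-homo f x y) (+ᴹ-homo g x y)) (interchange _ _ _ _))
      (λ r x → ≈ᴹ-trans (+ᴹ-cong (*ₗ-homo f r x) (*ₗ-homo g r x)) (≈ᴹ-sym (*ₗ-distribˡ r _ _)))

    infix 8 -ₗ_
    -ₗ_ : A ⟶ B → A ⟶ B
    -ₗ f = linear (λ x → -ᴹ to f x) (λ e → -ᴹ‿cong (⟦⟧-cong f e))
      (λ x y → ≈ᴹ-trans (-ᴹ‿cong (+ᴹ-homo f x y)) (≈ᴹ-sym (⁻¹-∙-comm _ _)))
      (λ r x → ≈ᴹ-trans (-ᴹ‿cong (*ₗ-homo f r x)) (≈ᴹ-sym (scale-neg r _)))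

  module _ {N : LeftModule ring m ℓm} where
    open ModuleProperties N
    open RawMonoidDefs +ᴹ-rawMonoid using () renaming (sum to sumᴹ)

    expand : ∀ {k} (f : R^ k ⟶ N) x → to f x ≈ᴹ to (comb N (to f ∘ unit)) x
    expand {zero}  f x = ≈ᴹ-trans (⟦⟧-cong f (λ ())) (0ᴹ-homo f)
    expand {suc k} f x = begin
      to f x
        ≈⟨ ⟦⟧-cong f (λ { zero → R.sym (R.trans (R.+-congʳ (R.*-identityʳ _)) (R.+-identityʳ _))
                        ; (suc i) → R.sym (R.trans (R.+-congʳ (R.zeroʳ _)) (R.+-identityˡ _)) }) ⟩
      to f (λ i → x zero R.* unit zero i R.+ (R.0# ∷ x ∘ suc) i)
        ≈⟨ ≈ᴹ-trans (+ᴹ-homo f _ _) (+ᴹ-congʳ (*ₗ-homo f _ _)) ⟩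
      x zero *ₗ to f (unit zero) +ᴹ to f (R.0# ∷ x ∘ suc)
        ≈⟨ +ᴹ-congˡ (expand (f ∘ₗ cons0) (x ∘ suc)) ⟩
      x zero *ₗ to f (unit zero) +ᴹ sumᴹ (λ j → x (suc j) *ₗ to f (R.0# ∷ unit j))
        ∎
      where
      cons0 : R^ k ⟶ R^ (suc k)
      cons0 = linear (R.0# ∷_)
        (λ { e zero → R.refl ; e (suc i) → e i })
        (λ { _ _ zero → R.sym (R.+-identityˡ _) ; _ _ (suc i) → R.refl })
        (λ { r _ zero → R.sym (R.zeroʳ r) ; _ _ (suc i) → R.refl })

    ext : ∀ {k} (f g : R^ k ⟶ N) → (∀ j → to f (unit j) ≈ᴹ to g (unit j)) → ∀ x → to f x ≈ᴹ to g x
    ext f g e x = ≈ᴹ-trans (expand f x)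
      (≈ᴹ-trans (Σᴹ.sum-cong-≋ N (λ j → *ₗ-congˡ (e j))) (≈ᴹ-sym (expand g x)))

    comb-0 : ∀ {k} (v : Fin k → Carrierᴹ) → to (comb N v) (λ _ → R.0#) ≈ᴹ 0ᴹ
    comb-0 v = 0ᴹ-homo (comb N v)

    comb-unit : ∀ {k} (v : Fin k → Carrierᴹ) j → to (comb N v) (unit j) ≈ᴹ v j
    comb-unit v zero    =
      ≈ᴹ-trans (+ᴹ-cong (*ₗ-identityˡ _) (comb-0 (v ∘ suc))) (+ᴹ-identityʳ _)
    comb-unit v (suc j) =
      ≈ᴹ-trans (+ᴹ-cong (*ₗ-zeroˡ _) (comb-unit (v ∘ suc) j)) (+ᴹ-identityˡ _)

  -- Projectivity of `R^ k`: preimages are chosen only for the finitely many unit vectors, and `ext`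
  -- carries the equation to all vectors.
  lift-free : ∀ {k} {N : LeftModule ring m ℓm} {P : LeftModule ring m′ ℓm′} (d : P ⟶ N) (f : R^ k ⟶ N) →
              let open LeftModule N using (_≈ᴹ_) in
              (∀ j → ∃[ p ] to d p ≈ᴹ to f (unit j)) →
              Σ[ g ∈ R^ k ⟶ P ] (∀ x → to d (to g x) ≈ᴹ to f x)
  lift-free {N = N} {P} d f h = g , ext (d ∘ₗ g) f
      (λ j → ≈ᴹ-trans (⟦⟧-cong d (comb-unit {N = P} (proj₁ ∘ h) j)) (proj₂ (h j)))
    where
    open LeftModule N using (≈ᴹ-trans)
    g = comb P (proj₁ ∘ h)

  π₁ : ∀ {m n} → R^ (m ℕ.+ n) ⟶ R^ m
  π₁ {n = n} = linear (λ x → x ∘ (_↑ˡ n)) (λ e i → e (i ↑ˡ n)) (λ _ _ _ → R.refl) (λ _ _ _ → R.refl)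

  π₂ : ∀ {m n} → R^ (m ℕ.+ n) ⟶ R^ n
  π₂ {m} = linear (λ x → x ∘ (m ↑ʳ_)) (λ e i → e (m ↑ʳ i)) (λ _ _ _ → R.refl) (λ _ _ _ → R.refl)

  split-≈ : ∀ {m n} {x y : Vector ∣R∣ (m ℕ.+ n)} →
            (∀ i → x (i ↑ˡ n) R.≈ y (i ↑ˡ n)) → (∀ i → x (m ↑ʳ i) R.≈ y (m ↑ʳ i)) → ∀ i → x i R.≈ y i
  split-≈ {m} {n} {x} {y} e₁ e₂ i =
    ≡.subst (λ j → x j R.≈ y j) (join-splitAt m n i) (go (splitAt m i))
    where
    go : ∀ s → x (join m n s) R.≈ y (join m n s)
    go (inj₁ j) = e₁ j
    go (inj₂ j) = e₂ j

  module _ {m n : ℕ} (x : Vector ∣R∣ m) (y : Vector ∣R∣ n) where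
    ++-↑ˡ : ∀ i → (x ++ y) (i ↑ˡ n) R.≈ x i
    ++-↑ˡ i = R.reflexive (≡.cong [ x , y ]′ (splitAt-↑ˡ m i n))

    ++-↑ʳ : ∀ i → (x ++ y) (m ↑ʳ i) R.≈ y i
    ++-↑ʳ i = R.reflexive (≡.cong [ x , y ]′ (splitAt-↑ʳ m n i))

  pair : ∀ {A : LeftModule ring m ℓm} {k l} → A ⟶ R^ k → A ⟶ R^ l → A ⟶ R^ (k ℕ.+ l)
  pair {A = A} {k} {l} f g = linear (λ x → to f x ++ to g x)
    (λ e → split-≈ (λ i → R.trans (ˡ _ i) (R.trans (⟦⟧-cong f e i) (R.sym (ˡ _ i))))
                   (λ i → R.trans (ʳ _ i) (R.trans (⟦⟧-cong g e i) (R.sym (ʳ _ i)))))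
    (λ x y → split-≈
      (λ i → R.trans (ˡ _ i) (R.trans (+ᴹ-homo f x y i) (R.sym (R.+-cong (ˡ _ i) (ˡ _ i)))))
      (λ i → R.trans (ʳ _ i) (R.trans (+ᴹ-homo g x y i) (R.sym (R.+-cong (ʳ _ i) (ʳ _ i))))))
    (λ r x → split-≈
      (λ i → R.trans (ˡ _ i) (R.trans (*ₗ-homo f r x i) (R.sym (R.*-congˡ (ˡ _ i)))))
      (λ i → R.trans (ʳ _ i) (R.trans (*ₗ-homo g r x i) (R.sym (R.*-congˡ (ʳ _ i))))))
    where
    ˡ : ∀ x i → (to f x ++ to g x) (i ↑ˡ l) R.≈ to f x i
    ˡ x = ++-↑ˡ (to f x) (to g x)
    ʳ : ∀ x i → (to f x ++ to g x) (k ↑ʳ i) R.≈ to g x i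
    ʳ x = ++-↑ʳ (to f x) (to g x)

-- Free resolutions

module Resolutions {c ℓ} (R : CommutativeRing c ℓ) where

  private
    variable
      p q m ℓm : Level
  open CommutativeRing R hiding (zero) renaming (Carrier to ∣R∣)
  open Modules R using (_⟶_; to; linear; R^_; Submodule; pred; submodule; FreeResolution)
  open _⟶_ using (⟦⟧-cong; +ᴹ-homo; *ₗ-homo; 0ᴹ-homo; -ᴹ-homo)
  open Linear R
  open RingProperties ring using (-0#≈0#; -1*x≈-x)
  open AbelianGroupProperties +-abelianGroup using (inverseʳ-unique) renaming (⁻¹-involutive to -‿involutive)
  open SetoidReasoning setoid

  infix 4 _≋_
  _≋_ : ∀ {k} → Vector ∣R∣ k → Vector ∣R∣ k → Set ℓ
  x ≋ y = ∀ j → x j ≈ y j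

  0ⱽ : ∀ {k} → Vector ∣R∣ k
  0ⱽ _ = 0#

  -- Prepends the free module R of the resolution of R / I, so `b i` is the rank in degree i + 1.
  aug : (ℕ → ℕ) → ℕ → ℕ
  aug b zero    = 1
  aug b (suc i) = b i

  -- In degree 0 a cycle is an element of `I`, the kernel of R → R / I; the quotient never has to be
  -- formed. `Lift` only makes the universe levels of the two cases agree.
  IsCycle : Pred ∣R∣ q → {b : ℕ → ℕ} → (∀ i → R^ aug b (suc i) ⟶ R^ aug b i) →
            ∀ i → Vector ∣R∣ (aug b i) → Set (ℓ ⊔ q)
  IsCycle     I ∂ zero    x = Lift ℓ (x zero ∈ I)
  IsCycle {q} I ∂ (suc i) x = Lift q (to (∂ i) x ≋ 0ⱽ)

  -- A free resolution of R / I, with R¹ in degree 0.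
  record Resolution (I : Pred ∣R∣ q) : Set (c ⊔ ℓ ⊔ q) where
    field
      rank           : ℕ → ℕ
      ∂              : ∀ i → R^ aug rank (suc i) ⟶ R^ aug rank i
      boundary-cycle : ∀ i y → IsCycle I {rank} ∂ i (to (∂ i) y)
      cycle-boundary : ∀ i x → IsCycle I {rank} ∂ i x → ∃[ y ] to (∂ i) y ≋ x

    Cycle : ∀ i → Vector ∣R∣ (aug rank i) → Set (ℓ ⊔ q)
    Cycle = IsCycle I {rank} ∂

    ∂∂≋0ⱽ : ∀ i y → to (∂ i) (to (∂ (suc i)) y) ≋ 0ⱽ
    ∂∂≋0ⱽ i y = lower (boundary-cycle (suc i) y)

  resolution-resp : {I : Pred ∣R∣ p} {J : Pred ∣R∣ q} →
                    (∀ {x} → x ∈ I → x ∈ J) → (∀ {x} → x ∈ J → x ∈ I) → Resolution I → Resolution J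
  resolution-resp I⊆J J⊆I P = record
    { rank = rank
    ; ∂ = ∂
    ; boundary-cycle = λ { zero y → lift (I⊆J (lower (boundary-cycle 0 y)))
                         ; (suc i) y → lift (∂∂≋0ⱽ i y) }
    ; cycle-boundary = λ { zero x z → cycle-boundary 0 x (lift (J⊆I (lower z)))
                         ; (suc i) x z → cycle-boundary (suc i) x (lift (lower z)) }
    }
    where open Resolution P

  -- M is identified with the ideal I by an injective map, and not required to be literally a
  -- submodule of R: module presentations are too large to be compared by the type checker.
  module _ {M : LeftModule ring m ℓm} (ι : M ⟶ TensorUnit.leftModule) {I : Pred ∣R∣ p}
           (ι-injective : ∀ {x y} → to ι x ≈ to ι y → LeftModule._≈ᴹ_ M x y)
           (ι∈I : ∀ x → to ι x ∈ I) (I⊆ι : ∀ {a} → a ∈ I → ∃[ x ] to ι x ≈ a)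
           where
    private
      module M = LeftModule M

      ι≈0⇒≈0 : ∀ {x} → to ι x ≈ 0# → x M.≈ᴹ M.0ᴹ
      ι≈0⇒≈0 e = ι-injective (trans e (sym (0ᴹ-homo ι)))

    fromFree : FreeResolution M → Resolution I
    fromFree F = record
      { rank = rank
      ; ∂ = λ { zero → linear (λ x _ → to ι (to augmentation x))
                  (λ e _ → ⟦⟧-cong ι (⟦⟧-cong augmentation e))
                  (λ x y _ → trans (⟦⟧-cong ι (+ᴹ-homo augmentation x y)) (+ᴹ-homo ι _ _))
                  (λ r x _ → trans (⟦⟧-cong ι (*ₗ-homo augmentation r x)) (*ₗ-homo ι r _))
              ; (suc i) → ∂ i }
      ; boundary-cycle = λ
          { zero          y → lift (ι∈I (to augmentation y))
          ; (suc zero)    y → lift (λ _ → trans (⟦⟧-cong ι (Equivalence.from (exact₀ _) (y , λ _ → refl))) (0ᴹ-homo ι))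
          ; (suc (suc i)) y → lift (Equivalence.from (exact i _) (y , λ _ → refl)) }
      ; cycle-boundary = λ
          { zero          x z → let a , e = I⊆ι (lower z) ; y , e′ = surjective a in
                                y , λ { zero → trans (⟦⟧-cong ι (e′ (λ _ → refl))) e }
          ; (suc zero)    x z → Equivalence.to (exact₀ x) (ι≈0⇒≈0 (lower z zero))
          ; (suc (suc i)) x z → Equivalence.to (exact i x) (lower z) }
      }
      where open FreeResolution F

    toFree : Resolution I → FreeResolution M
    toFree P = record
      { rank = rank
      ; ∂ = ∂ ∘ suc
      -- The chosen `ι`-preimages form a linear map because `ι` is injective and linearity holds
      -- after applying it.
      ; augmentation = linear (proj₁ ∘ pre)
          (λ {x} {y} e → ι-injective (trans (proj₂ (pre x)) (trans (⟦⟧-cong (∂ 0) e zero) (sym (proj₂ (pre y))))))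
          (λ x y → ι-injective (trans (proj₂ (pre _)) (trans (+ᴹ-homo (∂ 0) x y zero)
            (sym (trans (+ᴹ-homo ι _ _) (+-cong (proj₂ (pre x)) (proj₂ (pre y))))))))
          (λ r x → ι-injective (trans (proj₂ (pre _)) (trans (*ₗ-homo (∂ 0) r x zero)
            (sym (trans (*ₗ-homo ι r _) (*-congˡ (proj₂ (pre x))))))))
      ; surjective = λ x → let y , e = cycle-boundary 0 (λ _ → to ι x) (lift (ι∈I x)) in
          y , λ z≈y → ι-injective (trans (proj₂ (pre _)) (trans (⟦⟧-cong (∂ 0) z≈y zero) (e zero)))
      ; exact₀ = λ y → mk⇔
          (λ z → cycle-boundary 1 y (lift λ { zero → trans (sym (proj₂ (pre y))) (trans (⟦⟧-cong ι z) (0ᴹ-homo ι)) }))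
          (λ (x , e) → ι≈0⇒≈0 (trans (proj₂ (pre y))
            (trans (⟦⟧-cong (∂ 0) (λ j → sym (e j)) zero) (∂∂≋0ⱽ 0 x zero))))
      ; exact = λ i y → mk⇔
          (λ z → cycle-boundary (suc (suc i)) y (lift z))
          (λ (x , e) j → trans (⟦⟧-cong (∂ (suc i)) (λ j → sym (e j)) j) (∂∂≋0ⱽ (suc i) x j))
      }
      where
      open Resolution P
      pre : ∀ x → ∃[ a ] to ι a ≈ to (∂ 0) x zero
      pre x = I⊆ι (lower (boundary-cycle 0 x))

  module _ {I : Pred ∣R∣ p} {J : Pred ∣R∣ q} (P : Resolution I) (Q : Resolution J) where
    private
      module P = Resolution P
      module Q = Resolution Q

    Component : ℕ → Set (c ⊔ ℓ)
    Component i = R^ aug P.rank i ⟶ R^ aug Q.rank i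

    Lifts : ∀ i → Component i → Component (suc i) → Set (c ⊔ ℓ)
    Lifts i f g = ∀ x → to (Q.∂ i) (to g x) ≋ to f (to (P.∂ i) x)

    record ChainMap : Set (c ⊔ ℓ) where
      field
        component : ∀ i → Component i
        commutes  : ∀ i → Lifts i (component i) (component (suc i))

    module _ {g} (Good : ∀ i → Component i → Set g)
             (refine : ∀ i f g → Good i f → Lifts i f g → Σ[ g′ ∈ Component (suc i) ] Good (suc i) g′ × Lifts i f g′)
             (f₀ : Component 0) (good₀ : Good 0 f₀) (f₀-cycle : ∀ x → Q.Cycle 0 (to f₀ (to (P.∂ 0) x)))
             where
      private
        Stage : ℕ → Set (c ⊔ ℓ ⊔ q ⊔ g)
        Stage i = Σ[ f ∈ Component i ] Good i f × (∀ x → Q.Cycle i (to f (to (P.∂ i) x)))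

        next : ∀ i ((f , _) : Stage i) →
               Σ[ g ∈ Component (suc i) ] Good (suc i) g × Lifts i f g
        next i (f , good , f-cycle) =
          let g , g-lifts = lift-free (Q.∂ i) (f ∘ₗ P.∂ i) (λ j → Q.cycle-boundary i _ (f-cycle (unit j)))
          in refine i f g good g-lifts

        stage : ∀ i → Stage i
        stage zero    = f₀ , good₀ , f₀-cycle
        stage (suc i) = proj₁ step , proj₁ (proj₂ step) , λ x → lift λ j →
          trans (proj₂ (proj₂ step) (to (P.∂ (suc i)) x) j)
            (trans (⟦⟧-cong f (P.∂∂≋0ⱽ i x) j) (0ᴹ-homo f j))
          where
          step = next i (stage i)
          f = proj₁ (stage i)

      -- Each component sends boundaries to cycles of `Q`, which are boundaries, so the next
      -- component exists. `refine` may replace each lift by one satisfying `Good` before the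
      -- construction goes on; homogeneity is imposed in this way.
      extend : ChainMap
      extend = record
        { component = proj₁ ∘ stage
        ; commutes  = λ i → proj₂ (proj₂ (next i (stage i)))
        }

      extend-good : ∀ i → Good i (ChainMap.component extend i)
      extend-good i = proj₁ (proj₂ (stage i))

    record Homotopy (φ ψ : ChainMap) : Set (c ⊔ ℓ) where
      private
        module φ = ChainMap φ
        module ψ = ChainMap ψ
      field
        map      : ∀ i → R^ aug P.rank i ⟶ R^ aug Q.rank (suc i)
        -- Tor of the ideal starts in degree 1 of the resolution of R / I. There the term `map 0`
        -- after `P.∂ 0` has to disappear, and tensoring with the residue field alone would not
        -- remove it.
        map₀     : ∀ x → to (map 0) x ≋ 0ⱽ
        homotopy : ∀ i x j → to (φ.component (suc i)) x j ≈
          to (ψ.component (suc i)) x j + (to (Q.∂ (suc i)) (to (map (suc i)) x) j + to (map i) (to (P.∂ i) x) j)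

    module _ (φ ψ : ChainMap) (agree : ∀ x → to (ChainMap.component φ 0) x ≋ to (ChainMap.component ψ 0) x) where
      private
        module φ = ChainMap φ
        module ψ = ChainMap ψ

        -- Of the homotopy equation only its composite with the differential is kept. It makes the
        -- defect `u`, the difference of the two maps less h ∂, a cycle in the next degree, and at
        -- the start it holds for h = 0 because both maps agree in degree 0.
        Stage : ℕ → Set (c ⊔ ℓ)
        Stage i = Σ[ h ∈ R^ aug P.rank i ⟶ R^ aug Q.rank (suc i) ]
          (∀ x j → to (Q.∂ i) (to h (to (P.∂ i) x)) j ≈
                   to (φ.component i) (to (P.∂ i) x) j - to (ψ.component i) (to (P.∂ i) x) j)

        next : ∀ i ((h , _) : Stage i) → Σ[ h′ ∈ R^ aug P.rank (suc i) ⟶ R^ aug Q.rank (suc (suc i)) ]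
          (∀ x j → to (Q.∂ (suc i)) (to h′ x) j ≈
            to (φ.component (suc i)) x j - to (ψ.component (suc i)) x j - to h (to (P.∂ i) x) j)
        next i (h , inv) = lift-free (Q.∂ (suc i)) u (λ j → Q.cycle-boundary (suc i) _ (lift (cycle (unit j))))
          where
          u = φ.component (suc i) +ₗ -ₗ ψ.component (suc i) +ₗ -ₗ (h ∘ₗ P.∂ i)

          cycle : ∀ x j → to (Q.∂ i) (to u x) j ≈ 0#
          cycle x j = begin
            to (Q.∂ i) (to u x) j
              ≈⟨ trans (+ᴹ-homo (Q.∂ i) _ _ j) (+-cong (+ᴹ-homo (Q.∂ i) _ _ j) (-ᴹ-homo (Q.∂ i) _ j)) ⟩
            to (Q.∂ i) (to (φ.component (suc i)) x) j + to (Q.∂ i) (to (-ₗ ψ.component (suc i)) x) j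
              - to (Q.∂ i) (to h (to (P.∂ i) x)) j
              ≈⟨ +-cong (+-cong (φ.commutes i x j)
                   (trans (-ᴹ-homo (Q.∂ i) _ j) (-‿cong (ψ.commutes i x j)))) (-‿cong (inv x j)) ⟩
            to (φ.component i) (to (P.∂ i) x) j - to (ψ.component i) (to (P.∂ i) x) j
              - (to (φ.component i) (to (P.∂ i) x) j - to (ψ.component i) (to (P.∂ i) x) j)
              ≈⟨ -‿inverseʳ _ ⟩
            0# ∎

        stage : ∀ i → Stage i
        stage zero    = 0ₗ , λ x j → trans (0ᴹ-homo (Q.∂ 0) j)
          (sym (trans (+-congʳ (agree (to (P.∂ 0) x) j)) (-‿inverseʳ _)))
        stage (suc i) = proj₁ (next i (stage i)) , λ x j →
          trans (proj₂ (next i (stage i)) (to (P.∂ (suc i)) x) j)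
            (trans (+-congˡ (trans (-‿cong (trans (⟦⟧-cong (proj₁ (stage i)) (P.∂∂≋0ⱽ i x) j)
              (0ᴹ-homo (proj₁ (stage i)) j))) -0#≈0#)) (+-identityʳ _))

      homotopic : Homotopy φ ψ
      homotopic = record
        { map      = proj₁ ∘ stage
        ; map₀     = λ _ _ → refl
        ; homotopy = λ i x j → sym (begin
            to (ψ.component (suc i)) x j + (to (Q.∂ (suc i)) (to (h (suc i)) x) j + to (h i) (to (P.∂ i) x) j)
              ≈⟨ +-congˡ (+-congʳ (proj₂ (next i (stage i)) x j)) ⟩
            to (ψ.component (suc i)) x j + (to (φ.component (suc i)) x j - to (ψ.component (suc i)) x j
              - to (h i) (to (P.∂ i) x) j + to (h i) (to (P.∂ i) x) j)
              ≈⟨ +-congˡ (trans (+-assoc _ _ _) (trans (+-congˡ (-‿inverseˡ _)) (+-identityʳ _))) ⟩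
            to (ψ.component (suc i)) x j + (to (φ.component (suc i)) x j - to (ψ.component (suc i)) x j)
              ≈⟨ trans (+-comm _ _) (trans (+-assoc _ _ _) (trans (+-congˡ (-‿inverseˡ _)) (+-identityʳ _))) ⟩
            to (φ.component (suc i)) x j ∎)
        }
        where h = proj₁ ∘ stage

  idChain : {I : Pred ∣R∣ p} {P : Resolution I} → ChainMap P P
  idChain = record { component = λ _ → idₗ ; commutes = λ _ _ _ → refl }

  module _ {I : Pred ∣R∣ p} {P Q : Resolution I} where
    infixr 9 _∘ᶜ_
    _∘ᶜ_ : ChainMap Q P → ChainMap P Q → ChainMap P P
    ψ ∘ᶜ φ = record
      { component = λ i → ψ.component i ∘ₗ φ.component i
      ; commutes  = λ i x j →
          trans (ψ.commutes i _ j) (⟦⟧-cong (ψ.component i) (φ.commutes i x) j)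
      }
      where
      module φ = ChainMap φ
      module ψ = ChainMap ψ

  module _ {I : Pred ∣R∣ p} (P Q : Resolution I) where
    comparison : ChainMap P Q
    comparison = extend P Q (λ _ _ → ⊤) (λ i f g _ lifts → g , tt , lifts) idₗ tt
      (λ x → lift (lower (Resolution.boundary-cycle P 0 x)))

  module _ {I : Pred ∣R∣ p} (P Q : Resolution I) where
    -- Both maps are the identity on R in degree 0, and this determines a chain map of resolutions
    -- up to homotopy.
    comparison-inverse : Homotopy P P (comparison Q P ∘ᶜ comparison P Q) idChain
    comparison-inverse = homotopic P P _ _ (λ _ _ → refl)

  adjoin : Submodule (TensorUnit.leftModule {R = ring}) p → ∣R∣ → Submodule (TensorUnit.leftModule {R = ring}) (c ⊔ ℓ ⊔ p)
  adjoin I m = record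
    { pred     = λ x → ∃[ a ] ∃[ y ] a ∈ pred I × x ≈ a + y * m
    ; resp     = λ x≈x′ (a , y , a∈I , e) → a , y , a∈I , trans (sym x≈x′) e
    ; 0-closed = 0# , 0# , I.0-closed , sym (trans (+-identityˡ _) (zeroˡ m))
    ; +-closed = λ (a , y , a∈I , e) (a′ , y′ , a′∈I , e′) → a + a′ , y + y′ , I.+-closed a∈I a′∈I ,
        trans (+-cong e e′) (trans (interchange _ _ _ _) (+-congˡ (sym (distribʳ m y y′))))
    ; *-closed = λ r (a , y , a∈I , e) → r * a , r * y , I.*-closed r a∈I ,
        trans (*-congˡ e) (trans (distribˡ r _ _) (+-congˡ (sym (*-assoc r y m))))
    }
    where
    module I = Submodule I
    open CommutativeSemigroupProperties +-commutativeSemigroup using (interchange)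

  -- The mapping cone of a chain map over multiplication by m, from R / (I : m) to R / I,
  -- is a resolution of R / (I + (m)).
  module Cone (I : Submodule (TensorUnit.leftModule {R = ring}) p) {Q : Pred ∣R∣ q}
              (m : ∣R∣) (colon : ∀ {y} → y * m ∈ pred I → y ∈ Q)
              (G : Resolution (pred I)) (H : Resolution Q)
              (φ : ChainMap H G) (φ₀ : ∀ y → to (ChainMap.component φ 0) y zero ≈ y zero * m)
              where
    private
      module I = Submodule I
      module G = Resolution G
      module H = Resolution H
      open ChainMap φ renaming (component to ψ)

    -- Degree i + 1 of the cone joins degree i + 1 of `G` to degree i of `H`. For i = 0 the latter
    -- is R itself, which accounts for the new generator `m`.
    coneRank : ℕ → ℕ
    coneRank i = G.rank i ℕ.+ aug H.rank i

    D₁ : ∀ i → R^ coneRank i ⟶ R^ aug G.rank i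
    D₁ i = G.∂ i ∘ₗ π₁ +ₗ ψ i ∘ₗ π₂ {G.rank i}

    D : ∀ i → R^ aug coneRank (suc i) ⟶ R^ aug coneRank i
    D zero    = D₁ zero
    D (suc i) = pair (D₁ (suc i)) (-ₗ (H.∂ i ∘ₗ π₂ {G.rank (suc i)}))

    private
      D₁D₂ : ∀ i z → to (D₁ i) (to (D (suc i)) z) ≋ 0ⱽ
      D₁D₂ i z j = begin
        to (G.∂ i) (π₁ₗ (to (D (suc i)) z)) j + to (ψ i) (π₂ₗ (to (D (suc i)) z)) j
          ≈⟨ +-cong (⟦⟧-cong (G.∂ i) (++-↑ˡ _ _) j) (⟦⟧-cong (ψ i) (++-↑ʳ (to (D₁ (suc i)) z) _) j) ⟩
        to (G.∂ i) (λ k → to (G.∂ (suc i)) x k + to (ψ (suc i)) y k) j + to (ψ i) (λ k → - to (H.∂ i) y k) j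
          ≈⟨ +-cong (+ᴹ-homo (G.∂ i) _ _ j) (-ᴹ-homo (ψ i) _ j) ⟩
        to (G.∂ i) (to (G.∂ (suc i)) x) j + to (G.∂ i) (to (ψ (suc i)) y) j - to (ψ i) (to (H.∂ i) y) j
          ≈⟨ +-congʳ (trans (+-congʳ (G.∂∂≋0ⱽ i x j)) (trans (+-identityˡ _) (commutes i y j))) ⟩
        to (ψ i) (to (H.∂ i) y) j - to (ψ i) (to (H.∂ i) y) j
          ≈⟨ -‿inverseʳ _ ⟩
        0# ∎
        where
        π₁ₗ = to (π₁ {G.rank i} {aug H.rank i})
        π₂ₗ = to (π₂ {G.rank i} {aug H.rank i})
        x = to (π₁ {G.rank (suc i)} {H.rank i}) z
        y = to (π₂ {G.rank (suc i)} {H.rank i}) z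

      -- For a cycle (x, y), write y = ∂ y′. Then x + ψ y′ is a cycle of `G`, say ∂ x′, and (x′, -
      -- y′) has boundary (x, y); the sign matches the one in the lower row of `D`.
      fill : ∀ i z → to (D₁ i) z ≋ 0ⱽ → H.Cycle i (to (π₂ {G.rank i}) z) → ∃[ z′ ] to (D (suc i)) z′ ≋ z
      fill i z D₁z≋0ⱽ y-cycle = z′ , split-≈
          (λ j → begin
            to (D (suc i)) z′ (j ↑ˡ aug H.rank i)
              ≈⟨ ++-↑ˡ (to (D₁ (suc i)) z′) _ j ⟩
            to (D₁ (suc i)) z′ j
              ≈⟨ +-cong (⟦⟧-cong (G.∂ (suc i)) (++-↑ˡ x′ _) j) (⟦⟧-cong (ψ (suc i)) (++-↑ʳ x′ _) j) ⟩
            to (G.∂ (suc i)) x′ j + to (ψ (suc i)) (λ k → - y′ k) j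
              ≈⟨ +-cong (x′-lifts j) (-ᴹ-homo (ψ (suc i)) y′ j) ⟩
            x j + to (ψ (suc i)) y′ j - to (ψ (suc i)) y′ j
              ≈⟨ trans (+-assoc _ _ _) (trans (+-congˡ (-‿inverseʳ _)) (+-identityʳ _)) ⟩
            x j ∎)
          (λ j → begin
            to (D (suc i)) z′ (G.rank i ↑ʳ j)
              ≈⟨ ++-↑ʳ (to (D₁ (suc i)) z′) _ j ⟩
            - to (H.∂ i) (to (π₂ {G.rank (suc i)} {H.rank i}) z′) j
              ≈⟨ -‿cong (trans (⟦⟧-cong (H.∂ i) (++-↑ʳ x′ _) j) (-ᴹ-homo (H.∂ i) y′ j)) ⟩
            - - to (H.∂ i) y′ j
              ≈⟨ trans (-‿involutive _) (y′-lifts j) ⟩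
            y j ∎)
        where
        x = to (π₁ {G.rank i} {aug H.rank i}) z
        y = to (π₂ {G.rank i} {aug H.rank i}) z
        y′ = proj₁ (H.cycle-boundary i y y-cycle)
        y′-lifts = proj₂ (H.cycle-boundary i y y-cycle)

        cycle : to (G.∂ i) (λ j → x j + to (ψ (suc i)) y′ j) ≋ 0ⱽ
        cycle j = trans (+ᴹ-homo (G.∂ i) _ _ j)
          (trans (+-congˡ (trans (commutes i y′ j) (⟦⟧-cong (ψ i) y′-lifts j))) (D₁z≋0ⱽ j))

        x′ = proj₁ (G.cycle-boundary (suc i) _ (lift cycle))
        x′-lifts = proj₂ (G.cycle-boundary (suc i) _ (lift cycle))
        z′ = x′ ++ λ k → - y′ k

      boundary-cycle : ∀ i z → to (D i) (to (D (suc i)) z) ≋ 0ⱽ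
      boundary-cycle zero    z = D₁D₂ zero z
      boundary-cycle (suc i) z = split-≈
        (λ j → trans (++-↑ˡ (to (D₁ (suc i)) Dz) _ j) (D₁D₂ (suc i) z j))
        (λ j → trans (++-↑ʳ (to (D₁ (suc i)) Dz) _ j)
          (trans (-‿cong (trans (⟦⟧-cong (H.∂ i) (++-↑ʳ (to (D₁ (suc (suc i))) z) _) j)
            (trans (-ᴹ-homo (H.∂ i) _ j) (-‿cong (H.∂∂≋0ⱽ i _ j)))))
            (-‿involutive _)))
        where Dz = to (D (suc (suc i))) z

      cycle-boundary : ∀ i z → to (D i) z ≋ 0ⱽ → ∃[ z′ ] to (D (suc i)) z′ ≋ z
      -- The relation ∂ x + y m = 0 with ∂ x in I puts y m in I. This is the only place where
      -- exactness uses the colon ideal.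
      cycle-boundary zero    z Dz≋0ⱽ = fill 0 z Dz≋0ⱽ (lift (colon (I.resp
        (trans (sym (+-inverse-unique (Dz≋0ⱽ zero))) (φ₀ _)) (I.*-closed (- 1#) (lower (G.boundary-cycle 0 _))))))
        where
        +-inverse-unique : ∀ {a b} → a + b ≈ 0# → b ≈ - 1# * a
        +-inverse-unique e = trans (inverseʳ-unique _ _ e) (sym (-1*x≈-x _))
      cycle-boundary (suc i) z Dz≋0ⱽ = fill (suc i) z
        (λ j → trans (sym (++-↑ˡ (to (D₁ (suc i)) z) _ j)) (Dz≋0ⱽ (j ↑ˡ _)))
        (lift λ j → trans (sym (-‿involutive _))
          (trans (-‿cong (trans (sym (++-↑ʳ (to (D₁ (suc i)) z) _ j)) (Dz≋0ⱽ (G.rank i ↑ʳ j)))) -0#≈0#))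

    cone : Resolution (pred (adjoin I m))
    cone = record
      { rank = coneRank
      ; ∂ = D
      ; boundary-cycle = λ
          { zero z → lift (_ , _ , lower (G.boundary-cycle 0 _) , +-congˡ (φ₀ _))
          ; (suc i) z → lift (boundary-cycle i z) }
      ; cycle-boundary = λ
          { zero x (lift (a , y , a∈I , e)) →
              let x′ , x′-lifts = G.cycle-boundary 0 (λ _ → a) (lift a∈I) in
              (x′ ++ λ (_ : Fin 1) → y) , λ { zero → trans
                (+-cong (trans (⟦⟧-cong (G.∂ 0) (++-↑ˡ x′ _) zero) (x′-lifts zero))
                  (trans (φ₀ _) (*-congʳ (++-↑ʳ x′ (λ (_ : Fin 1) → y) zero)))) (sym e) }
          ; (suc i) z w → cycle-boundary i z (lower w) }
      }

-- Tor

module Betti {c ℓ c′ ℓ′} (R : CommutativeRing c ℓ) (K : CommutativeRing c′ ℓ′)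
  (κ : RingHomomorphism (CommutativeRing.rawRing R) (CommutativeRing.rawRing K))
  (ι : RingHomomorphism (CommutativeRing.rawRing K) (CommutativeRing.rawRing R))
  (κ∘ι : ∀ a → CommutativeRing._≈_ K (RingHomomorphism.⟦_⟧ κ (RingHomomorphism.⟦_⟧ ι a)) a)
  where

  private
    variable
      p m ℓm : Level
    module R = CommutativeRing R
    module K = CommutativeRing K
    module κ = RingHomomorphism κ
    module ι = RingHomomorphism ι
    module Vect = Modules K
    module KP = RingProperties K.ring
  open R using () renaming (Carrier to ∣R∣)
  open K using () renaming (Carrier to ∣K∣)
  open Modules R renaming (refl to reflᵀ; sym to symᵀ; trans to transᵀ)
    hiding (Basis; zero; resp; gen; add; mul; 𝟎)
  open Linear R
  open Resolutions R
  private
    module KLin = Linear K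

  residue : LeftModule R.ring c′ ℓ′
  residue = restrictScalars R K κ TensorUnit.leftModule

  asSpace : LeftModule R.ring m ℓm → LeftModule K.ring m ℓm
  asSpace = restrictScalars K R ι

  T : ℕ → LeftModule R.ring _ _
  T k = tensor (R^ k) residue

  ∣T∣ : ℕ → Set _
  ∣T∣ k = Tensor (R^ k) residue

  infix 4 _≃_
  _≃_ : ∀ {k} → ∣T∣ k → ∣T∣ k → Set _
  _≃_ {k} = _≈ᵀ_ (R^ k) residue

  map : ∀ {k l} → R^ k ⟶ R^ l → ∣T∣ k → ∣T∣ l
  map f = to (tensorMap f residue)

  map-cong : ∀ {k l} (f : R^ k ⟶ R^ l) {t u} → t ≃ u → map f t ≃ map f u
  map-cong f = _⟶_.⟦⟧-cong (tensorMap f residue)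

  map-id : ∀ {k} (t : ∣T∣ k) → map idₗ t ≡ t
  map-id (x ⊗ c) = ≡.refl
  map-id (t ⊕ u) = ≡.cong₂ _⊕_ (map-id t) (map-id u)
  map-id (r · t) = ≡.cong (r ·_) (map-id t)
  map-id (⊖ t)   = ≡.cong ⊖_ (map-id t)
  map-id 𝟘       = ≡.refl

  map-∘ : ∀ {k l m} (g : R^ l ⟶ R^ m) (f : R^ k ⟶ R^ l) t → map (g ∘ₗ f) t ≡ map g (map f t)
  map-∘ g f (x ⊗ c) = ≡.refl
  map-∘ g f (t ⊕ u) = ≡.cong₂ _⊕_ (map-∘ g f t) (map-∘ g f u)
  map-∘ g f (r · t) = ≡.cong (r ·_) (map-∘ g f t)
  map-∘ g f (⊖ t)   = ≡.cong ⊖_ (map-∘ g f t)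
  map-∘ g f 𝟘       = ≡.refl

  map-ext : ∀ {k l} {f g : R^ k ⟶ R^ l} → (∀ x → to f x ≋ to g x) → ∀ t → map f t ≃ map g t
  map-ext e (x ⊗ c) = ⊗-cong (e x) K.refl
  map-ext e (t ⊕ u) = ⊕-cong (map-ext e t) (map-ext e u)
  map-ext e (r · t) = ·-cong R.refl (map-ext e t)
  map-ext e (⊖ t)   = ⊖-cong (map-ext e t)
  map-ext e 𝟘       = reflᵀ

  map-0 : ∀ {k l} (t : ∣T∣ k) → map {k} {l} 0ₗ t ≃ 𝟘
  map-0 {k} {l} = go
    where
    open ModuleProperties (T l)
    go : (t : ∣T∣ k) → map {k} {l} 0ₗ t ≃ 𝟘
    go (x ⊗ c) = transᵀ (⊗-cong (λ _ → R.sym (R.zeroˡ R.0#)) K.refl)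
                   (transᵀ (⊗-scaleˡ R.0# (λ _ → R.0#) c) (*ₗ-zeroˡ _))
    go (t ⊕ u) = transᵀ (⊕-cong (go t) (go u)) (⊕-identityˡ _)
    go (r · t) = transᵀ (·-cong R.refl (go t)) (*ₗ-zeroʳ r)
    go (⊖ t)   = transᵀ (⊖-cong (go t)) ε⁻¹≈ε
    go 𝟘       = reflᵀ

  map-+ : ∀ {k l} (f g : R^ k ⟶ R^ l) t → map (f +ₗ g) t ≃ map f t ⊕ map g t
  map-+ {k} {l} f g = go
    where
    open ModuleProperties (T l)
    go : ∀ t → map (f +ₗ g) t ≃ map f t ⊕ map g t
    go (x ⊗ c) = ⊗-distribʳ c (to f x) (to g x)
    go (t ⊕ u) = transᵀ (⊕-cong (go t) (go u)) (interchange _ _ _ _)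
    go (r · t) = transᵀ (·-cong R.refl (go t)) (·-distribˡ r _ _)
    go (⊖ t)   = transᵀ (⊖-cong (go t)) (symᵀ (⁻¹-∙-comm _ _))
    go 𝟘       = symᵀ (⊕-identityˡ 𝟘)

  ≡⇒≃ : ∀ {k} {t u : ∣T∣ k} → t ≡ u → t ≃ u
  ≡⇒≃ ≡.refl = reflᵀ

  -- The isomorphism from R^k ⊗ K to K^k, by recursion on tensor expressions; `coev` is its inverse.
  -- Through it, equality of tensors becomes a comparison of coordinates.
  ev : ∀ {k} → ∣T∣ k → Vector ∣K∣ k
  ev (x ⊗ c) j = κ.⟦ x j ⟧ K.* c
  ev (t ⊕ u) j = ev t j K.+ ev u j
  ev (r · t) j = κ.⟦ r ⟧ K.* ev t j
  ev (⊖ t)   j = K.- ev t j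
  ev 𝟘       j = K.0#

  ev-cong : ∀ {k} {t u : ∣T∣ k} → t ≃ u → ∀ j → ev t j K.≈ ev u j
  ev-cong reflᵀ               j = K.refl
  ev-cong (symᵀ e)            j = K.sym (ev-cong e j)
  ev-cong (transᵀ e e′)       j = K.trans (ev-cong e j) (ev-cong e′ j)
  ev-cong (⊗-cong e e′)       j = K.*-cong (κ.⟦⟧-cong (e j)) e′
  ev-cong (⊕-cong e e′)       j = K.+-cong (ev-cong e j) (ev-cong e′ j)
  ev-cong (·-cong e e′)       j = K.*-cong (κ.⟦⟧-cong e) (ev-cong e′ j)
  ev-cong (⊖-cong e)          j = K.-‿cong (ev-cong e j)
  ev-cong (⊕-assoc t u v)     j = K.+-assoc _ _ _
  ev-cong (⊕-comm t u)        j = K.+-comm _ _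
  ev-cong (⊕-identityˡ t)     j = K.+-identityˡ _
  ev-cong (⊖-inverseˡ t)      j = K.-‿inverseˡ _
  ev-cong (·-distribˡ r t u)  j = K.distribˡ _ _ _
  ev-cong (·-distribʳ t r s)  j = K.trans (K.*-congʳ (κ.+-homo r s)) (K.distribʳ _ _ _)
  ev-cong (·-assoc r s t)     j = K.trans (K.*-congʳ (κ.*-homo r s)) (K.*-assoc _ _ _)
  ev-cong (·-identityˡ t)     j = K.trans (K.*-congʳ κ.1#-homo) (K.*-identityˡ _)
  ev-cong (⊗-distribʳ y x x′) j = K.trans (K.*-congʳ (κ.+-homo _ _)) (K.distribʳ _ _ _)
  ev-cong (⊗-distribˡ x y y′) j = K.distribˡ _ _ _
  ev-cong (⊗-scaleˡ r x y)    j = K.trans (K.*-congʳ (κ.*-homo _ _)) (K.*-assoc _ _ _)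
  ev-cong (⊗-scaleʳ r x y)    j = K.trans (K.sym (K.*-assoc _ _ _))
    (K.trans (K.*-congʳ (K.*-comm _ _)) (K.*-assoc _ _ _))

  ev-map-𝔪 : ∀ {k l} (f : R^ k ⟶ R^ l) → (∀ x j → κ.⟦ to f x j ⟧ K.≈ K.0#) →
              ∀ t j → ev (map f t) j K.≈ K.0#
  ev-map-𝔪 f f≈0 (x ⊗ c) j = K.trans (K.*-congʳ (f≈0 x j)) (K.zeroˡ c)
  ev-map-𝔪 f f≈0 (t ⊕ u) j =
    K.trans (K.+-cong (ev-map-𝔪 f f≈0 t j) (ev-map-𝔪 f f≈0 u j)) (K.+-identityˡ _)
  ev-map-𝔪 f f≈0 (r · t) j = K.trans (K.*-congˡ (ev-map-𝔪 f f≈0 t j)) (K.zeroʳ _)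
  ev-map-𝔪 f f≈0 (⊖ t)   j = K.trans (K.-‿cong (ev-map-𝔪 f f≈0 t j)) KP.-0#≈0#
  ev-map-𝔪 f f≈0 𝟘       j = K.refl

  e⊗1 : ∀ {k} → Fin k → ∣T∣ k
  e⊗1 j = unit j ⊗ K.1#

  -- A scalar can be moved to the residue field factor, where it acts only through its image under
  -- `κ`; there `r` and `ι.⟦ κ.⟦ r ⟧ ⟧` agree since `κ` after `ι` is the identity.
  act : ∀ {k} r (t : ∣T∣ k) → r · t ≃ ι.⟦ κ.⟦ r ⟧ ⟧ · t
  act {k} r = go
    where
    open ModuleProperties (T k)
    swap : ∀ r s t → r · (s · t) ≃ s · (r · t)
    swap r s t = transᵀ (symᵀ (·-assoc r s t)) (transᵀ (·-cong (R.*-comm r s) reflᵀ) (·-assoc s r t))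
    go : ∀ t → r · t ≃ ι.⟦ κ.⟦ r ⟧ ⟧ · t
    go (x ⊗ c) = transᵀ (symᵀ (⊗-scaleʳ r x c))
      (transᵀ (⊗-cong (λ _ → R.refl) (K.*-congʳ (K.sym (κ∘ι _)))) (⊗-scaleʳ _ x c))
    go (t ⊕ u) = transᵀ (·-distribˡ r t u) (transᵀ (⊕-cong (go t) (go u)) (symᵀ (·-distribˡ _ t u)))
    go (s · t) = transᵀ (swap r s t) (transᵀ (·-cong R.refl (go t)) (swap s _ t))
    go (⊖ t)   = transᵀ (scale-neg r t) (transᵀ (⊖-cong (go t)) (symᵀ (scale-neg _ t)))
    go 𝟘       = transᵀ (*ₗ-zeroʳ r) (symᵀ (*ₗ-zeroʳ _))

  coev : ∀ {k} → Vect._⟶_ (Vect.R^ k) (asSpace (T k))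
  coev {k} = KLin.comb (asSpace (T k)) e⊗1

  evₗ : ∀ {k} → Vect._⟶_ (asSpace (T k)) (Vect.R^ k)
  evₗ {k} = Vect.linear {M = asSpace (T k)} {N = Vect.R^ k} ev ev-cong
    (λ _ _ _ → K.refl) (λ a t j → K.*-congʳ (κ∘ι a))

  ev∘coev : ∀ {k} (a : Vector ∣K∣ k) j → ev (Vect.to coev a) j K.≈ a j
  ev∘coev {k} = KLin.ext (KLin._∘ₗ_ evₗ coev) KLin.idₗ λ j l →
    K.trans (ev-cong (KLin.comb-unit {N = asSpace (T k)} e⊗1 j) l)
      (K.trans (K.*-identityʳ _) (κ-unit j l))
    where
    κ-unit : ∀ {k} (j l : Fin k) → κ.⟦ unit j l ⟧ K.≈ KLin.unit j l
    κ-unit zero    zero    = κ.1#-homo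
    κ-unit zero    (suc l) = κ.0#-homo
    κ-unit (suc j) zero    = κ.0#-homo
    κ-unit (suc j) (suc l) = κ-unit j l

  coev∘ev : ∀ {k} (t : ∣T∣ k) → Vect.to coev (ev t) ≃ t
  coev∘ev {k} = go
    where
    open ModuleProperties (T k)
    module coev = Vect._⟶_ (coev {k})
    pure : ∣K∣ → R^ k ⟶ T k
    pure c = linear (_⊗ c) (λ e → ⊗-cong e K.refl) (⊗-distribʳ c) (λ r x → ⊗-scaleˡ r x c)
    go : (t : ∣T∣ k) → Vect.to coev (ev t) ≃ t
    go (x ⊗ c) = symᵀ (transᵀ (expand (pure c) x) (Σᴹ.sum-cong-≋ (T k) {k} term))
      where
      term : ∀ j → x j · (unit j ⊗ c) ≃ ι.⟦ κ.⟦ x j ⟧ K.* c ⟧ · e⊗1 j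
      term j = transᵀ (symᵀ (⊗-scaleʳ _ _ c)) (transᵀ (⊗-cong (λ _ → R.refl)
        (K.sym (K.trans (K.*-identityʳ _) (κ∘ι _)))) (⊗-scaleʳ _ _ K.1#))
    go (t ⊕ u) = transᵀ (coev.+ᴹ-homo _ _) (⊕-cong (go t) (go u))
    go (r · t) = transᵀ (coev.*ₗ-homo κ.⟦ r ⟧ _)
                   (transᵀ (symᵀ (act r _)) (·-cong R.refl (go t)))
    go (⊖ t)   = transᵀ (coev.-ᴹ-homo _) (⊖-cong (go t))
    go 𝟘       = coev.0ᴹ-homo

  ev-injective : ∀ {k} {t u : ∣T∣ k} → (∀ j → ev t j K.≈ ev u j) → t ≃ u
  ev-injective e = transᵀ (symᵀ (coev∘ev _)) (transᵀ (Vect._⟶_.⟦⟧-cong coev e) (coev∘ev _))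

  map-𝔪 : ∀ {k l} (f : R^ k ⟶ R^ l) → (∀ x j → κ.⟦ to f x j ⟧ K.≈ K.0#) → ∀ t → map f t ≃ 𝟘
  map-𝔪 f f≈0 t = ev-injective (ev-map-𝔪 f f≈0 t)

  module _ {I : Pred ∣R∣ p} {P : Resolution I} {φ : ChainMap P P} (η : Homotopy P P φ idChain) where
    private
      module P = Resolution P
      module φ = ChainMap φ
      module η = Homotopy η

    map-homotopy : ∀ i t → map (φ.component (suc i)) t ≃
                   t ⊕ (map (P.∂ (suc i)) (map (η.map (suc i)) t) ⊕ map (η.map i ∘ₗ P.∂ i) t)
    map-homotopy i t =
      transᵀ (map-ext {g = idₗ +ₗ (P.∂ (suc i) ∘ₗ η.map (suc i) +ₗ η.map i ∘ₗ P.∂ i)} (η.homotopy i) t)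
        (transᵀ (map-+ idₗ _ t) (⊕-cong (≡⇒≃ (map-id t))
          (transᵀ (map-+ (P.∂ (suc i) ∘ₗ η.map (suc i)) _ t)
            (⊕-cong (≡⇒≃ (map-∘ (P.∂ (suc i)) (η.map (suc i)) t)) reflᵀ))))

  -- H stands for the homology at T k, with rep choosing representatives.  It is abstract since
  -- two presentations of the same homology module are too costly to compare by unfolding.
  module _ {k l b : ℕ} (∂ : R^ l ⟶ R^ k) (φ : R^ b ⟶ R^ k) {H : LeftModule K.ring m ℓm} where
    private
      module H = LeftModule H
      open ModuleProperties (T k) using (ε⁻¹≈ε; +ᴹ-identityʳ)
      open RawMonoidDefs H.+ᴹ-rawMonoid using () renaming (sum to sumᴴ)

    homology-basis :
      (rep : H.Carrierᴹ → ∣T∣ k) →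
      rep H.0ᴹ ≡ 𝟘 →
      (∀ x y → rep (x H.+ᴹ y) ≡ rep x ⊕ rep y) →
      (∀ a x → rep (a H.*ₗ x) ≡ ι.⟦ a ⟧ · rep x) →
      (∀ {x y} → x H.≈ᴹ y → ∃[ u ] map ∂ u ≃ rep x ⊕ ⊖ rep y) →
      (∀ {x y} → ∃[ u ] map ∂ u ≃ rep x ⊕ ⊖ rep y → x H.≈ᴹ y) →
      (class : Fin b → H.Carrierᴹ) →
      (∀ j → rep (class j) ≡ map φ (e⊗1 j)) →
      (∀ x → ∃[ a ] ∃[ u ] map ∂ u ≃ rep x ⊕ ⊖ map φ (Vect.to coev a)) →
      (∀ a u → map φ (Vect.to coev a) ≃ map ∂ u → ∀ j → a j K.≈ K.0#) →
      Vect.Basis H b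
    homology-basis rep rep-0 rep-+ rep-* ≈⇒ ⇒≈ class rep-class span indep = record
      { vector      = class
      ; spanning    = spanning
      ; independent = independent
      }
      where
      rep-sum : ∀ a → rep (sumᴴ (λ j → a j H.*ₗ class j)) ≡ map φ (Vect.to coev a)
      rep-sum a = go a class e⊗1 rep-class
        where
        -- Freed from `class` and `e⊗1` so that the induction can drop the head of both families.
        go : ∀ {c} (a : Fin c → ∣K∣) (x : Fin c → H.Carrierᴹ) (t : Fin c → ∣T∣ b) → (∀ j → rep (x j) ≡ map φ (t j)) →
          rep (sumᴴ (λ j → a j H.*ₗ x j)) ≡
          map φ (RawMonoidDefs.sum (LeftModule.+ᴹ-rawMonoid (T b)) (λ j → ι.⟦ a j ⟧ · t j))
        go {zero}  a x t e = rep-0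
        go {suc c} a x t e = ≡.trans (rep-+ _ _) (≡.cong₂ _⊕_
          (≡.trans (rep-* _ _) (≡.cong (_ ·_) (e zero))) (go (a ∘ suc) (x ∘ suc) (t ∘ suc) (e ∘ suc)))

      spanning : ∀ x → Σ[ a ∈ (Fin b → ∣K∣) ] x H.≈ᴹ sumᴴ (λ j → a j H.*ₗ class j)
      spanning x with span x
      ... | a , u , e = a , ⇒≈ (u , ≡.subst (λ s → map ∂ u ≃ rep x ⊕ ⊖ s) (≡.sym (rep-sum a)) e)

      independent : ∀ (a : Fin b → ∣K∣) → sumᴴ (λ j → a j H.*ₗ class j) H.≈ᴹ H.0ᴹ → ∀ j → a j K.≈ K.0#
      independent a e = let u , e′ = ≈⇒ e in indep a u
        (symᵀ (transᵀ e′ (transᵀ (⊕-cong (≡⇒≃ (rep-sum a)) (transᵀ (⊖-cong (≡⇒≃ rep-0)) ε⁻¹≈ε)) (+ᴹ-identityʳ _))))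

  κ-vanishes : ∀ {k l} (f : R^ k ⟶ R^ l) → (∀ i j → κ.⟦ to f (unit i) j ⟧ K.≈ K.0#) →
               ∀ x j → κ.⟦ to f x j ⟧ K.≈ K.0#
  κ-vanishes {k} f vanishes x j = ext κf (0ₗ {B = residue}) (λ i → vanishes i j) x
    where
    module f = _⟶_ f
    κf : R^ k ⟶ residue
    κf = linear (λ x → κ.⟦ to f x j ⟧) (λ e → κ.⟦⟧-cong (f.⟦⟧-cong e j))
      (λ x y → K.trans (κ.⟦⟧-cong (f.+ᴹ-homo x y j)) (κ.+-homo _ _))
      (λ r x → K.trans (κ.⟦⟧-cong (f.*ₗ-homo r x j)) (κ.*-homo _ _))

  -- `∂ 0` is exempt: it maps onto the ideal and is not a differential of the complex whose homology
  -- is Tor of the ideal.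
  Minimal : {I : Pred ∣R∣ p} → Resolution I → Set _
  Minimal G = ∀ i x j → κ.⟦ to (Resolution.∂ G (suc i)) x j ⟧ K.≈ K.0#

  module _ {I : Pred ∣R∣ p} (P G : Resolution I) (minimal : Minimal G) where
    private
      module P = Resolution P
      module G = Resolution G
      φ = comparison G P
      ψ = comparison P G
      ηP = comparison-inverse P G
      ηG = comparison-inverse G P
      module φ = ChainMap φ
      module ψ = ChainMap ψ
      module ηP = Homotopy ηP
      module ηG = Homotopy ηG

    class : ∀ i → Fin (G.rank i) → ∣T∣ (P.rank i)
    class i j = map (φ.component (suc i)) (e⊗1 j)

    map-0∘ : ∀ {k l m} (h : R^ l ⟶ R^ m) (f : R^ k ⟶ R^ l) → (∀ x → to h x ≋ 0ⱽ) → ∀ t → map (h ∘ₗ f) t ≃ 𝟘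
    map-0∘ h f h≈0 t = transᵀ (map-ext {g = 0ₗ} (λ x → h≈0 (to f x)) t) (map-0 t)

    map-∘-cycle : ∀ {k l m} (h : R^ l ⟶ R^ m) (f : R^ k ⟶ R^ l) t → map f t ≃ 𝟘 → map (h ∘ₗ f) t ≃ 𝟘
    map-∘-cycle h f t e = transᵀ (≡⇒≃ (map-∘ h f t)) (map-cong h e)

    map-square : ∀ {k l m n} (f : R^ l ⟶ R^ n) (g : R^ k ⟶ R^ l) (f′ : R^ m ⟶ R^ n) (g′ : R^ k ⟶ R^ m) →
                 (∀ x → to f (to g x) ≋ to f′ (to g′ x)) → ∀ t → map f (map g t) ≃ map f′ (map g′ t)
    map-square f g f′ g′ e t = transᵀ (≡⇒≃ (≡.sym (map-∘ f g t)))
      (transᵀ (map-ext {f = f ∘ₗ g} {g = f′ ∘ₗ g′} e t) (≡⇒≃ (map-∘ f′ g′ t)))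

    ηG-vanishes : ∀ i t → map (ηG.map i ∘ₗ G.∂ i) t ≃ 𝟘
    ηG-vanishes zero    = map-0∘ (ηG.map 0) (G.∂ 0) ηG.map₀
    ηG-vanishes (suc i) t = map-∘-cycle (ηG.map (suc i)) (G.∂ (suc i)) t (map-𝔪 (G.∂ (suc i)) (minimal i) t)

    module _ (i : ℕ) where
      open ModuleProperties (T (P.rank i)) using (⁻¹-anti-homo-∙; ε⁻¹≈ε; +ᴹ-identityʳ; -ᴹ‿inverseʳ)
      φᵢ = map (φ.component (suc i))
      ψᵢ = map (ψ.component (suc i))
      ∂P = map (P.∂ (suc i))

      -- The composite φψ is homotopic to the identity of `P`, so t differs from φ (ψ t) by a
      -- boundary, and ψ t is rebuilt from its coordinates. The hypothesis covers all degrees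
      -- uniformly: for i = 0 it always holds, as `ηP.map 0` is zero, and later it follows from t
      -- being a cycle.
      cycle≃class : ∀ t → map (ηP.map i ∘ₗ P.∂ i) t ≃ 𝟘 →
                    ∂P (⊖ map (ηP.map (suc i)) t) ≃ t ⊕ ⊖ φᵢ (Vect.to coev (ev (ψᵢ t)))
      cycle≃class t vanishes = symᵀ (transᵀ (⊕-cong reflᵀ (⊖-cong φψt))
        (transᵀ (⊕-cong reflᵀ (transᵀ (⁻¹-anti-homo-∙ t (∂P h)) (⊕-comm _ _)))
          (transᵀ (symᵀ (⊕-assoc _ _ _)) (transᵀ (⊕-cong (-ᴹ‿inverseʳ t) reflᵀ) (⊕-identityˡ _)))))
        where
        h = map (ηP.map (suc i)) t
        φψt : φᵢ (Vect.to coev (ev (ψᵢ t))) ≃ t ⊕ ∂P h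
        φψt = transᵀ (map-cong (φ.component (suc i)) (coev∘ev (ψᵢ t)))
          (transᵀ (≡⇒≃ (≡.sym (map-∘ (φ.component (suc i)) (ψ.component (suc i)) t)))
            (transᵀ (map-homotopy ηP i t)
              (⊕-cong reflᵀ (transᵀ (⊕-cong reflᵀ vanishes) (+ᴹ-identityʳ _)))))

      -- Apply ψ and take coordinates. On the left ψφ is the identity, as minimality kills both
      -- homotopy terms (the second, for i = 0, is killed by `map₀`); on the right ψ yields a
      -- boundary of `G`, whose coordinates vanish by minimality.
      class-boundary⇒0 : ∀ a u → φᵢ (Vect.to coev a) ≃ ∂P u → ∀ j → a j K.≈ K.0#
      class-boundary⇒0 a u boundary j = begin
        a j
          ≈⟨ ev∘coev a j ⟨
        ev w j
          ≈⟨ K.trans (K.+-congˡ (K.trans (K.+-cong (ev-map-𝔪 (G.∂ (suc i)) (minimal i) (map (ηG.map (suc i)) w) j)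
               (ev-cong (ηG-vanishes i w) j)) (K.+-identityˡ _))) (K.+-identityʳ _) ⟨
        ev (w ⊕ (map (G.∂ (suc i)) (map (ηG.map (suc i)) w) ⊕ map (ηG.map i ∘ₗ G.∂ i) w)) j
          ≈⟨ ev-cong (map-homotopy ηG i w) j ⟨
        ev (map (ψ.component (suc i) ∘ₗ φ.component (suc i)) w) j
          ≈⟨ ev-cong (≡⇒≃ (map-∘ (ψ.component (suc i)) (φ.component (suc i)) w)) j ⟩
        ev (ψᵢ (φᵢ w)) j
          ≈⟨ ev-cong (map-cong (ψ.component (suc i)) boundary) j ⟩
        ev (ψᵢ (∂P u)) j
          ≈⟨ ev-cong (map-square (ψ.component (suc i)) (P.∂ (suc i)) (G.∂ (suc i)) (ψ.component (suc (suc i)))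
               (λ x k → R.sym (ψ.commutes (suc i) x k)) u) j ⟩
        ev (map (G.∂ (suc i)) (map (ψ.component (suc (suc i))) u)) j
          ≈⟨ ev-map-𝔪 (G.∂ (suc i)) (minimal i) (map (ψ.component (suc (suc i))) u) j ⟩
        K.0# ∎
        where
        open SetoidReasoning K.setoid
        w = Vect.to coev a

    class-cycle : ∀ i j → map (P.∂ (suc i)) (class (suc i) j) ≃ 𝟘
    class-cycle i j = transᵀ
      (map-square (P.∂ (suc i)) (φ.component (suc (suc i))) (φ.component (suc i)) (G.∂ (suc i))
        (φ.commutes (suc i)) (e⊗1 j))
      (map-cong (φ.component (suc i)) (map-𝔪 (G.∂ (suc i)) (minimal i) (e⊗1 j)))

    spans : ∀ i t → map (ηP.map i ∘ₗ P.∂ i) t ≃ 𝟘 → ∃[ a ] ∃[ u ]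
            map (P.∂ (suc i)) u ≃ t ⊕ ⊖ map (φ.component (suc i)) (Vect.to coev a)
    spans i t vanishes = ev (ψᵢ i t) , ⊖ map (ηP.map (suc i)) t , cycle≃class i t vanishes

    spans₀ : ∀ t → ∃[ a ] ∃[ u ] map (P.∂ 1) u ≃ t ⊕ ⊖ map (φ.component 1) (Vect.to coev a)
    spans₀ t = spans 0 t (map-0∘ (ηP.map 0) (P.∂ 0) ηP.map₀ t)

    spans₊ : ∀ i t → map (P.∂ (suc i)) t ≃ 𝟘 → ∃[ a ] ∃[ u ]
             map (P.∂ (suc (suc i))) u ≃ t ⊕ ⊖ map (φ.component (suc (suc i))) (Vect.to coev a)
    spans₊ i t z = spans (suc i) t (map-∘-cycle (ηP.map (suc i)) (P.∂ (suc i)) t z)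

-- Squarefree monomial ideals

positive : ℕ → Bool
positive zero    = false
positive (suc _) = true

supp : ∀ {n} → Vec ℕ n → Subset n
supp = Vec.map positive

indicator : ∀ {n} → Subset n → Vec ℕ n
indicator = Vec.map (λ b → if b then 1 else 0)

supp-∙ : ∀ {n} (α β : Vec ℕ n) → supp (zipWith ℕ._+_ α β) ≡ supp α ∪ supp β
supp-∙ Vec.[]      Vec.[]      = ≡.refl
supp-∙ (a Vec.∷ α) (b Vec.∷ β) = ≡.cong₂ Vec._∷_ (positive-+ a b) (supp-∙ α β)
  where
  positive-+ : ∀ a b → positive (a ℕ.+ b) ≡ positive a ∨ positive b
  positive-+ zero    b = ≡.refl
  positive-+ (suc a) b = ≡.refl

supp-indicator : ∀ {n} (e : Subset n) → supp (indicator e) ≡ e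
supp-indicator Vec.[]          = ≡.refl
supp-indicator (true  Vec.∷ e) = ≡.cong (true Vec.∷_) (supp-indicator e)
supp-indicator (false Vec.∷ e) = ≡.cong (false Vec.∷_) (supp-indicator e)

degree : ∀ {n} → Vec ℕ n → ℕ
degree = Vec.sum

degree-∙ : ∀ {n} (α β : Vec ℕ n) → degree (zipWith ℕ._+_ α β) ≡ degree α ℕ.+ degree β
degree-∙ Vec.[]      Vec.[]      = ≡.refl
degree-∙ (a Vec.∷ α) (b Vec.∷ β) = ≡.trans (≡.cong (a ℕ.+ b ℕ.+_) (degree-∙ α β))
  (ℕ-interchange a b (degree α) (degree β))
  where
  open import Algebra.Properties.CommutativeSemigroup ℕₚ.+-commutativeSemigroup
    using () renaming (interchange to ℕ-interchange)

degree-indicator : ∀ {n} (e : Subset n) → degree (indicator e) ≡ ∣ e ∣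
degree-indicator Vec.[]          = ≡.refl
degree-indicator (true  Vec.∷ e) = ≡.cong suc (degree-indicator e)
degree-indicator (false Vec.∷ e) = degree-indicator e

degree-𝟏 : ∀ n → degree (Vec.replicate n 0) ≡ 0
degree-𝟏 zero    = ≡.refl
degree-𝟏 (suc n) = degree-𝟏 n

infixl 7 _÷_
_÷_ : ∀ {n} → Vec ℕ n → Vec ℕ n → Vec ℕ n
_÷_ = zipWith ℕ._∸_

∙-÷ : ∀ {n} (α β : Vec ℕ n) → zipWith ℕ._+_ α β ÷ β ≡ α
∙-÷ Vec.[]      Vec.[]      = ≡.refl
∙-÷ (a Vec.∷ α) (b Vec.∷ β) = ≡.cong₂ Vec._∷_ (ℕₚ.m+n∸n≡m a b) (∙-÷ α β)

÷-∙ : ∀ {n} (α : Vec ℕ n) (e : Subset n) → e ⊆ supp α →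
      zipWith ℕ._+_ (α ÷ indicator e) (indicator e) ≡ α
÷-∙ Vec.[]          Vec.[]          _ = ≡.refl
÷-∙ (a     Vec.∷ α) (false Vec.∷ e) s = ≡.cong₂ Vec._∷_ (ℕₚ.+-identityʳ a) (÷-∙ α e (Subsetₚ.drop-∷-⊆ s))
÷-∙ (zero  Vec.∷ α) (true  Vec.∷ e) s with () ← s Vec.here
÷-∙ (suc a Vec.∷ α) (true  Vec.∷ e) s = ≡.cong₂ Vec._∷_ (ℕₚ.+-comm a 1) (÷-∙ α e (Subsetₚ.drop-∷-⊆ s))

-- Encodes a squarefree monomial ideal by the supports of the monomials in it. Membership of
-- supports is decidable even though coefficients cannot be tested.
record UpSet (n : ℕ) : Set₁ where
  field
    has       : Pred (Subset n) 0ℓ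
    has?      : Decidable has
    up-closed : ∀ {S T} → S ⊆ T → S ∈ has → T ∈ has

open UpSet public using (has)

module MonomialIdeals {c ℓ} (K : CommutativeRing c ℓ) (n : ℕ) where

  open Polynomials K n
  open CommutativeRing K hiding (zero)
  open SetoidReasoning setoid
  private
    R = polynomialRing
    module R = CommutativeRing R
  open Modules R using (Submodule; pred; R^_; to; linear; module _⟶_; _⟶_)
  open _⟶_ using (⟦⟧-cong; +ᴹ-homo; *ₗ-homo; 0ᴹ-homo; -ᴹ-homo)
  open Linear R
  open Resolutions R

  Unit : LeftModule R.ring c ℓ
  Unit = TensorUnit.leftModule

  gate : {P : Pred Monomial 0ℓ} → Decidable P → (Monomial → Carrier) → Monomial → Carrier
  gate P? φ α = if does (P? α) then φ α else 0#

  gate-cong : {P : Pred Monomial 0ℓ} (P? : Decidable P) (φ ψ : Monomial → Carrier) →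
              ∀ α → (P α → φ α ≈ ψ α) → gate P? φ α ≈ gate P? ψ α
  gate-cong P? φ ψ α e with P? α
  ... | yes p = e p
  ... | no  _ = refl

  gate-yes : {P : Pred Monomial 0ℓ} (P? : Decidable P) (φ : Monomial → Carrier) → ∀ α → P α → gate P? φ α ≈ φ α
  gate-yes P? φ α p with P? α
  ... | yes _ = refl
  ... | no ¬p = ⊥-elim (¬p p)

  gate-no : {P : Pred Monomial 0ℓ} (P? : Decidable P) (φ : Monomial → Carrier) → ∀ α → ¬ P α → gate P? φ α ≈ 0#
  gate-no P? φ α ¬p with P? α
  ... | yes p = ⊥-elim (¬p p)
  ... | no  _ = refl

  gate-0 : {P : Pred Monomial 0ℓ} (P? : Decidable P) → ∀ α → gate P? (λ _ → 0#) α ≈ 0#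
  gate-0 P? α with P? α
  ... | yes _ = refl
  ... | no  _ = refl

  part : {P : Pred Monomial 0ℓ} → Decidable P → Polynomial → Polynomial
  part P? []              = []
  part P? ((a , α) List.∷ f) = if does (P? α) then (a , α) List.∷ part P? f else part P? f

  ⟦part⟧ : {P : Pred Monomial 0ℓ} (P? : Decidable P) → ∀ f φ → ⟦ part P? f ⟧ φ ≈ ⟦ f ⟧ (gate P? φ)
  ⟦part⟧ P? []                 φ = refl
  ⟦part⟧ P? ((a , α) List.∷ f) φ with P? α
  ... | yes _ = +-congˡ (⟦part⟧ P? f φ)
  ... | no  _ = trans (⟦part⟧ P? f φ) (sym (trans (+-congʳ (zeroʳ a)) (+-identityˡ _)))

  𝐱^ : Subset n → Polynomial
  𝐱^ e = monomial (indicator e)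

  ⟦monomial⟧ : ∀ α φ → ⟦ monomial α ⟧ φ ≈ φ α
  ⟦monomial⟧ α φ = trans (+-identityʳ _) (*-identityˡ _)

  ⟦*monomial⟧ : ∀ f β φ → ⟦ f *ᴾ monomial β ⟧ φ ≈ ⟦ f ⟧ (λ α → φ (α ∙ β))
  ⟦*monomial⟧ f β φ = trans (⟦⟧-*ᴾ f (monomial β) φ) (⟦⟧-congʳ f (λ α → ⟦monomial⟧ β (λ γ → φ (α ∙ γ))))

  monomial-∙ : ∀ α β → monomial α *ᴾ monomial β ≈ᴾ monomial (α ∙ β)
  monomial-∙ α β = mk≈ λ γ → trans (⟦*monomial⟧ (monomial α) β (δ γ))
    (trans (⟦monomial⟧ α (λ γ′ → δ γ (γ′ ∙ β))) (sym (⟦monomial⟧ (α ∙ β) (δ γ))))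

  VanishesOn : UpSet n → (Monomial → Carrier) → Set ℓ
  VanishesOn U φ = ∀ α → supp α ∈ has U → φ α ≈ 0#

  -- The ideal spanned by the monomials with support in U, described by duality: a linear
  -- form on R kills it iff it vanishes on these monomials.  Thus no coefficient has to
  -- be compared with zero.
  ⟨_⟩ : UpSet n → Submodule Unit (c ⊔ ℓ)
  ⟨ U ⟩ = record
    { pred     = λ f → ∀ φ → VanishesOn U φ → ⟦ f ⟧ φ ≈ 0#
    ; resp     = λ f≈g f∈U φ v → trans (sym (⟦⟧-congˡ f≈g φ)) (f∈U φ v)
    ; 0-closed = λ φ v → refl
    ; +-closed = λ {f} {g} f∈U g∈U φ v →
        trans (⟦⟧-++ f g φ) (trans (+-cong (f∈U φ v) (g∈U φ v)) (+-identityˡ 0#))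
    ; *-closed = λ r {f} f∈U φ v → trans (⟦⟧-*ᴾ r f φ)
        (trans (⟦⟧-congʳ r (λ α → f∈U _ (λ β β∈U → v (α ∙ β)
          (≡.subst (_∈ has U) (≡.sym (supp-∙ α β)) (UpSet.up-closed U (Subsetₚ.q⊆p∪q (supp α) (supp β)) β∈U)))))
          (⟦⟧-0 r))
    }

  monomial∈ : ∀ U {α} → supp α ∈ has U → monomial α ∈ pred ⟨ U ⟩
  monomial∈ U {α} α∈U φ v = trans (⟦monomial⟧ α φ) (v α α∈U)

  ⟨⟩-mono : ∀ U V → (∀ {S} → S ∈ has U → S ∈ has V) → ∀ {f} → f ∈ pred ⟨ U ⟩ → f ∈ pred ⟨ V ⟩
  ⟨⟩-mono U V U⊆V f∈U φ v = f∈U φ (λ α → v α ∘ U⊆V)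

  module _ {q} (U : UpSet n) (J : Submodule Unit q) where
    private
      module J = Submodule J

      inU? : Decidable (λ α → supp α ∈ has U)
      inU? α = UpSet.has? U (supp α)

      outside : (Monomial → Carrier) → Monomial → Carrier
      outside φ α = if does (inU? α) then 0# else φ α

      outside-vanishes : ∀ φ → VanishesOn U (outside φ)
      outside-vanishes φ α α∈U with inU? α
      ... | yes _ = refl
      ... | no ¬u = ⊥-elim (¬u α∈U)

      gate+outside : ∀ φ α → φ α ≈ gate inU? φ α + outside φ α
      gate+outside φ α with inU? α
      ... | yes _ = sym (+-identityʳ _)
      ... | no  _ = sym (+-identityˡ _)

      ≈part : ∀ {f} → f ∈ pred ⟨ U ⟩ → part inU? f ≈ᴾ f
      ≈part {f} f∈U = mk≈ λ γ → begin
        ⟦ part inU? f ⟧ (δ γ)                                     ≈⟨ ⟦part⟧ inU? f (δ γ) ⟩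
        ⟦ f ⟧ (gate inU? (δ γ))                                   ≈⟨ +-identityʳ _ ⟨
        ⟦ f ⟧ (gate inU? (δ γ)) + 0#                              ≈⟨ +-congˡ (f∈U _ (outside-vanishes (δ γ))) ⟨
        ⟦ f ⟧ (gate inU? (δ γ)) + ⟦ f ⟧ (outside (δ γ))           ≈⟨ ⟦⟧-+ f _ _ ⟨
        ⟦ f ⟧ (λ α → gate inU? (δ γ) α + outside (δ γ) α)         ≈⟨ ⟦⟧-congʳ f (gate+outside (δ γ)) ⟨
        ⟦ f ⟧ (δ γ)                                               ∎

    -- Dropping the terms of f with support outside `U` leaves all coefficients unchanged: the
    -- dropped part of each coefficient form vanishes on `U`, so f is killed by it. The remaining
    -- terms are multiples of monomials in `J`.
    ⟨⟩-least : (∀ α → supp α ∈ has U → monomial α ∈ pred J) → ∀ {f} → f ∈ pred ⟨ U ⟩ → f ∈ pred J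
    ⟨⟩-least h {f} f∈U = J.resp (≈part f∈U) (part∈J f)
      where
      part∈J : ∀ f → part inU? f ∈ pred J
      part∈J []                 = J.0-closed
      part∈J ((a , α) List.∷ f) with inU? α
      ... | no  _ = part∈J f
      ... | yes u = J.resp
        (mk≈ λ γ → +-congʳ (trans (*-congʳ (*-identityʳ a))
          (*-congˡ (reflexive (≡.cong (δ γ) (Vecₚ.zipWith-identityˡ ℕₚ.+-identityˡ α))))))
        (J.+-closed (J.*-closed [ a , 𝟏 ] (h α u)) (part∈J f))

  module _ (U W : UpSet n) (e : Subset n) where
    private
      supp-shift : ∀ α → supp (α ∙ indicator e) ≡ supp α ∪ e
      supp-shift α = ≡.trans (supp-∙ α (indicator e)) (≡.cong (supp α ∪_) (supp-indicator e))

    -- By duality a form φ vanishing on `W` must be extended along multiplication by x_e to a form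
    -- vanishing on `U`. Set it to 0 on `U` and divide exponents elsewhere; the two rules agree on
    -- multiples of x_e, since α x_e in `U` forces α into `W`. Values at other monomials do not
    -- matter.
    colon⁻ : (∀ {S} → S ∪ e ∈ has U → S ∈ has W) → ∀ {f} → f *ᴾ 𝐱^ e ∈ pred ⟨ U ⟩ → f ∈ pred ⟨ W ⟩
    colon⁻ U⇒W {f} fx∈U φ v = begin
      ⟦ f ⟧ φ                              ≈⟨ ⟦⟧-congʳ f φ≈φ′ ⟩
      ⟦ f ⟧ (λ α → φ′ (α ∙ indicator e))   ≈⟨ ⟦*monomial⟧ f (indicator e) φ′ ⟨
      ⟦ f *ᴾ 𝐱^ e ⟧ φ′                      ≈⟨ fx∈U φ′ φ′-vanishes ⟩
      0#                                   ∎
      where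
      φ′ : Monomial → Carrier
      φ′ γ = if does (UpSet.has? U (supp γ)) then 0# else φ (γ ÷ indicator e)

      φ′-vanishes : VanishesOn U φ′
      φ′-vanishes γ γ∈U with UpSet.has? U (supp γ)
      ... | yes _ = refl
      ... | no ¬u = ⊥-elim (¬u γ∈U)

      φ≈φ′ : ∀ α → φ α ≈ φ′ (α ∙ indicator e)
      φ≈φ′ α with UpSet.has? U (supp (α ∙ indicator e))
      ... | yes u = v α (U⇒W (≡.subst (_∈ has U) (supp-shift α) u))
      ... | no  _ = reflexive (≡.cong φ (≡.sym (∙-÷ α (indicator e))))

    colon⁺ : (∀ {S} → S ∈ has W → S ∪ e ∈ has U) → ∀ {f} → f ∈ pred ⟨ W ⟩ → f *ᴾ 𝐱^ e ∈ pred ⟨ U ⟩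
    colon⁺ W⇒U {f} f∈W φ v = trans (⟦*monomial⟧ f (indicator e) φ)
      (f∈W _ (λ α α∈W → v _ (≡.subst (_∈ has U) (≡.sym (supp-shift α)) (W⇒U α∈W))))

  monomial-÷ : ∀ α e → e ⊆ supp α → monomial (α ÷ indicator e) *ᴾ 𝐱^ e ≈ᴾ monomial α
  monomial-÷ α e e⊆α = R.trans (monomial-∙ (α ÷ indicator e) (indicator e))
    (R.reflexive (≡.cong monomial (÷-∙ α e e⊆α)))

  -- Homogeneous maps and linear resolutions

  component : ℕ → Polynomial → Polynomial
  component p = part (λ α → degree α ℕₚ.≟ p)

  private
    deg? : ∀ p → Decidable (λ (α : Monomial) → degree α ≡ p)
    deg? p α = degree α ℕₚ.≟ p

  component-cong : ∀ p {f g} → f ≈ᴾ g → component p f ≈ᴾ component p g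
  component-cong p {f} {g} e = mk≈ λ γ →
    trans (⟦part⟧ (deg? p) f _) (trans (⟦⟧-congˡ e _) (sym (⟦part⟧ (deg? p) g _)))

  component-++ : ∀ p f g → component p (f List.++ g) ≈ᴾ component p f List.++ component p g
  component-++ p f g = mk≈ λ γ → trans (⟦part⟧ (deg? p) (f List.++ g) _) (trans (⟦⟧-++ f g _)
    (trans (sym (+-cong (⟦part⟧ (deg? p) f _) (⟦part⟧ (deg? p) g _)))
      (sym (⟦⟧-++ (component p f) (component p g) _))))

  coeff-component-≢ : ∀ p f {γ} → degree γ ≢ p → coeff (component p f) γ ≈ 0#
  coeff-component-≢ p f {γ} |γ|≢p = trans (⟦part⟧ (deg? p) f (δ γ))
    (trans (⟦⟧-congʳ f {ψ = λ _ → 0#} off) (⟦⟧-0 f))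
    where
    δ-≢ : ∀ {α} → α ≢ γ → δ γ α ≈ 0#
    δ-≢ {α} α≢γ with α ≟ᴹ γ
    ... | yes α≡γ = ⊥-elim (α≢γ α≡γ)
    ... | no _    = refl

    off : ∀ α → gate (deg? p) (δ γ) α ≈ 0#
    off α = by-cases (α ≟ᴹ γ)
      where
      by-cases : Dec (α ≡ γ) → gate (deg? p) (δ γ) α ≈ 0#
      by-cases (yes α≡γ) = gate-no (deg? p) (δ γ) α (|γ|≢p ∘ ≡.trans (≡.cong degree (≡.sym α≡γ)))
      by-cases (no α≢γ)  = trans (gate-cong (deg? p) (δ γ) (λ _ → 0#) α (λ _ → δ-≢ α≢γ)) (gate-0 (deg? p) α)

  component-neg : ∀ p f → component p (-ᴾ f) ≈ᴾ -ᴾ component p f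
  component-neg p f = mk≈ λ γ → trans (⟦part⟧ (deg? p) (-ᴾ f) _) (trans (⟦⟧-neg f _)
    (trans (sym (-‿cong (⟦part⟧ (deg? p) f _))) (sym (⟦⟧-neg (component p f) _))))

  component-idem : ∀ p f → component p (component p f) ≈ᴾ component p f
  component-idem p f = mk≈ λ γ → trans (⟦part⟧ (deg? p) (component p f) (δ γ))
    (trans (⟦part⟧ (deg? p) f (gate (deg? p) (δ γ))) (trans
      (⟦⟧-congʳ f (λ α → gate-cong (deg? p) (gate (deg? p) (δ γ)) (δ γ) α (gate-yes (deg? p) (δ γ) α)))
      (sym (⟦part⟧ (deg? p) f (δ γ)))))

  -- Once g is restricted to its terms of degree s, a product α ∙ β has degree s + p exactly when α
  -- has degree p, so the restriction passes from the product to f.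
  component-* : ∀ s p f g → component s g ≈ᴾ g → component (s ℕ.+ p) (f *ᴾ g) ≈ᴾ component p f *ᴾ g
  component-* s p f g homogeneous = mk≈ λ γ → begin
    ⟦ component (s ℕ.+ p) (f *ᴾ g) ⟧ (δ γ)
      ≈⟨ ⟦part⟧ (deg? (s ℕ.+ p)) (f *ᴾ g) (δ γ) ⟩
    ⟦ f *ᴾ g ⟧ (gate (deg? (s ℕ.+ p)) (δ γ))
      ≈⟨ ⟦⟧-*ᴾ f g (gate (deg? (s ℕ.+ p)) (δ γ)) ⟩
    ⟦ f ⟧ (λ α → ⟦ g ⟧ (λ β → gate (deg? (s ℕ.+ p)) (δ γ) (α ∙ β)))
      ≈⟨ ⟦⟧-congʳ f (λ α → g-graded (λ β → gate (deg? (s ℕ.+ p)) (δ γ) (α ∙ β))) ⟩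
    ⟦ f ⟧ (λ α → ⟦ g ⟧ (gate (deg? s) (λ β → gate (deg? (s ℕ.+ p)) (δ γ) (α ∙ β))))
      ≈⟨ ⟦⟧-congʳ f (λ α → sum-degree γ α) ⟩
    ⟦ f ⟧ (gate (deg? p) (λ α → ⟦ g ⟧ (gate (deg? s) (λ β → δ γ (α ∙ β)))))
      ≈⟨ ⟦⟧-congʳ f (λ α → gate-cong (deg? p) (λ α → ⟦ g ⟧ (λ β → δ γ (α ∙ β)))
           (λ α → ⟦ g ⟧ (gate (deg? s) (λ β → δ γ (α ∙ β)))) α (λ _ → g-graded (λ β → δ γ (α ∙ β)))) ⟨
    ⟦ f ⟧ (gate (deg? p) (λ α → ⟦ g ⟧ (λ β → δ γ (α ∙ β))))
      ≈⟨ ⟦part⟧ (deg? p) f (λ α → ⟦ g ⟧ (λ β → δ γ (α ∙ β))) ⟨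
    ⟦ component p f ⟧ (λ α → ⟦ g ⟧ (λ β → δ γ (α ∙ β)))
      ≈⟨ ⟦⟧-*ᴾ (component p f) g (δ γ) ⟨
    ⟦ component p f *ᴾ g ⟧ (δ γ)
      ∎
    where
    g-graded : ∀ φ → ⟦ g ⟧ φ ≈ ⟦ g ⟧ (gate (deg? s) φ)
    g-graded φ = trans (sym (⟦⟧-congˡ homogeneous φ)) (⟦part⟧ (deg? s) g φ)

    sum-degree : ∀ γ α → ⟦ g ⟧ (gate (deg? s) (λ β → gate (deg? (s ℕ.+ p)) (δ γ) (α ∙ β))) ≈
                 gate (deg? p) (λ α → ⟦ g ⟧ (gate (deg? s) (λ β → δ γ (α ∙ β)))) α
    sum-degree γ α = by-cases (deg? p α)
      where
      sum-gate : Monomial → Carrier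
      sum-gate α = ⟦ g ⟧ (gate (deg? s) (λ β → δ γ (α ∙ β)))

      total-gate : Monomial → Carrier
      total-gate β = gate (deg? (s ℕ.+ p)) (δ γ) (α ∙ β)

      by-cases : Dec (degree α ≡ p) → ⟦ g ⟧ (gate (deg? s) total-gate) ≈ gate (deg? p) sum-gate α
      by-cases (yes |α|≡p) = trans
        (⟦⟧-congʳ g (λ β → gate-cong (deg? s) total-gate (λ β → δ γ (α ∙ β)) β λ |β|≡s →
          gate-yes (deg? (s ℕ.+ p)) (δ γ) (α ∙ β)
            (≡.trans (degree-∙ α β) (≡.trans (≡.cong₂ ℕ._+_ |α|≡p |β|≡s) (ℕₚ.+-comm p s)))))
        (sym (gate-yes (deg? p) sum-gate α |α|≡p))
      by-cases (no |α|≢p) = trans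
        (trans
          (⟦⟧-congʳ g {ψ = λ _ → 0#} (λ β → trans
            (gate-cong (deg? s) total-gate (λ _ → 0#) β λ |β|≡s →
              gate-no (deg? (s ℕ.+ p)) (δ γ) (α ∙ β) λ |αβ|≡s+p →
                |α|≢p (ℕₚ.+-cancelˡ-≡ s _ _ (≡.trans (≡.cong (ℕ._+ degree α) (≡.sym |β|≡s))
                  (≡.trans (ℕₚ.+-comm (degree β) _) (≡.trans (≡.sym (degree-∙ α β)) |αβ|≡s+p)))))
            (gate-0 (deg? s) β)))
          (⟦⟧-0 g))
        (sym (gate-no (deg? p) sum-gate α |α|≢p))

  component-monomial : ∀ {p} α → degree α ≡ p → component p (monomial α) ≈ᴾ monomial α
  component-monomial {p} α eq = mk≈ λ γ → trans (⟦part⟧ (deg? p) (monomial α) (δ γ))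
    (trans (⟦monomial⟧ α (gate (deg? p) (δ γ)))
      (trans (gate-yes (deg? p) (δ γ) α eq) (sym (⟦monomial⟧ α (δ γ)))))

  componentⱽ : ∀ {k} → ℕ → Vector Polynomial k → Vector Polynomial k
  componentⱽ p x = component p ∘ x

  -- Homogeneity of degree `s` as compatibility with taking components. Indexing the target by
  -- `s + p` avoids subtraction of degrees.
  Graded : ∀ {k l} → ℕ → R^ k ⟶ R^ l → Set _
  Graded s f = ∀ p x → to f (componentⱽ p x) ≋ componentⱽ (s ℕ.+ p) (to f x)

  comb-graded : ∀ {k l s} (v : Fin k → Vector Polynomial l) → (∀ j → componentⱽ s (v j) ≋ v j) → Graded s (comb (R^ l) v)
  comb-graded {zero}  v v-hom p x i = R.refl
  comb-graded {suc k} {l} {s} v v-hom p x i = R.sym (R.trans (component-++ (s ℕ.+ p) (x zero *ᴾ v zero i) _)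
    (R.+-cong (component-* s p (x zero) (v zero i) (v-hom zero i))
      (R.sym (comb-graded {k} {l} {s} (v ∘ suc) (v-hom ∘ suc) p (x ∘ suc) i))))

  ∘-graded : ∀ {k l m s t} (g : R^ l ⟶ R^ m) (f : R^ k ⟶ R^ l) → Graded t g → Graded s f → Graded (t ℕ.+ s) (g ∘ₗ f)
  ∘-graded {s = s} {t} g f g-graded f-graded p x i = R.trans (⟦⟧-cong g (f-graded p x) i)
    (R.trans (g-graded (s ℕ.+ p) (to f x) i)
      (R.reflexive (≡.cong (λ q → component q (to g (to f x) i)) (≡.sym (ℕₚ.+-assoc t s p)))))

  +-graded : ∀ {k l s} (f g : R^ k ⟶ R^ l) → Graded s f → Graded s g → Graded s (f +ₗ g)
  +-graded {s = s} f g f-graded g-graded p x i =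
    R.trans (R.+-cong (f-graded p x i) (g-graded p x i)) (R.sym (component-++ (s ℕ.+ p) (to f x i) (to g x i)))

  neg-graded : ∀ {k l s} (f : R^ k ⟶ R^ l) → Graded s f → Graded s (-ₗ f)
  neg-graded {s = s} f f-graded p x i =
    R.trans (R.-‿cong (f-graded p x i)) (R.sym (component-neg (s ℕ.+ p) (to f x i)))

  pair-graded : ∀ {k l m s} (f : R^ k ⟶ R^ l) (g : R^ k ⟶ R^ m) → Graded s f → Graded s g → Graded s (pair f g)
  pair-graded {l = l} {m} {s} f g f-graded g-graded p x = split-≈ {l} {m}
    (λ i → R.trans (++-↑ˡ (to f x′) (to g x′) i) (R.trans (f-graded p x i)
      (component-cong (s ℕ.+ p) (R.sym (++-↑ˡ (to f x) (to g x) i)))))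
    (λ i → R.trans (++-↑ʳ (to f x′) (to g x′) i) (R.trans (g-graded p x i)
      (component-cong (s ℕ.+ p) (R.sym (++-↑ʳ (to f x) (to g x) i)))))
    where x′ = componentⱽ p x

  unit-homogeneous : ∀ {k} (j : Fin k) → componentⱽ 0 (unit j) ≋ unit j
  unit-homogeneous zero    zero    = component-monomial 𝟏 (degree-𝟏 n)
  unit-homogeneous zero    (suc i) = R.refl
  unit-homogeneous (suc j) zero    = R.refl
  unit-homogeneous (suc j) (suc i) = unit-homogeneous j i

  unit-image : ∀ {k l s} (f : R^ k ⟶ R^ l) → Graded s f → ∀ j → componentⱽ s (to f (unit j)) ≋ to f (unit j)
  unit-image {s = s} f f-graded j i = R.sym (R.trans (⟦⟧-cong f (λ i → R.sym (unit-homogeneous j i)) i)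
    (R.trans (f-graded 0 (unit j) i)
      (R.reflexive (≡.cong (λ q → component q (to f (unit j) i)) (ℕₚ.+-identityʳ s)))))

  -- Degrees of the entries in a d-linear resolution: d for the generators of the ideal, 1 for every
  -- later map.
  shift : ℕ → ℕ → ℕ
  shift d zero    = d
  shift d (suc i) = 1

  record LinearResolution (U : UpSet n) (d : ℕ) : Set (c ⊔ ℓ) where
    field
      resolution : Resolution (pred ⟨ U ⟩)
    open Resolution resolution public
    field
      graded : ∀ i → Graded (shift d i) (∂ i)

  -- On supports, `W` is the colon of `U` by x_e and `V` is `U` with x_e adjoined. As `W` is
  -- resolved linearly from degree 1, x_e times `H.∂ 0` has degree d + 1 and lifts through `G.∂ 0`,
  -- of degree d, with linear entries; every later square has degree 2 and lifts in the same way.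
  module LinearCone {U W V : UpSet n} {d : ℕ} (e : Subset n) (∣e∣≡d : ∣ e ∣ ≡ d)
    (W⇒U : ∀ {S} → S ∈ has W → S ∪ e ∈ has U) (U⇒W : ∀ {S} → S ∪ e ∈ has U → S ∈ has W)
    (V⇒ : ∀ {S} → S ∈ has V → S ∈ has U ⊎ e ⊆ S)
    (U⇒V : ∀ {S} → S ∈ has U → S ∈ has V) (e⇒V : ∀ {S} → e ⊆ S → S ∈ has V)
    (Gˡ : LinearResolution U d) (Hˡ : LinearResolution W 1) where
    private
      module G = LinearResolution Gˡ
      module H = LinearResolution Hˡ
      G = G.resolution
      H = H.resolution

    mult : R^ 1 ⟶ R^ 1
    mult = comb (R^ 1) (λ _ _ → 𝐱^ e)

    mult-* : ∀ y → to mult y zero R.≈ y zero *ᴾ 𝐱^ e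
    mult-* y = R.+-identityʳ _

    -- `shift 1 i` is always 1, but reduces only after i is split.
    H-graded : ∀ i → Graded 1 (H.∂ i)
    H-graded zero    = H.graded zero
    H-graded (suc i) = H.graded (suc i)

    -- The degree 1 components of a lift along homogeneous maps are again a lift.
    refine : ∀ i (f : Component H G i) (g : Component H G (suc i)) → Graded (shift d i) f → Lifts H G i f g →
             Σ[ g′ ∈ Component H G (suc i) ] Graded (shift d (suc i)) g′ × Lifts H G i f g′
    refine i f g f-graded lifts = g′ , comb-graded v (λ j k → component-idem 1 (to g (unit j) k)) ,
        ext (G.∂ i ∘ₗ g′) (f ∘ₗ H.∂ i) (λ j k → R.trans
          (⟦⟧-cong (G.∂ i) (comb-unit {N = R^ aug G.rank (suc i)} v j) k)
          (R.trans (G.graded i 1 (to g (unit j)) k)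
            (R.trans (component-cong (shift d i ℕ.+ 1) (lifts (unit j) k))
              (unit-image (f ∘ₗ H.∂ i) (∘-graded f (H.∂ i) f-graded (H-graded i)) j k))))
      where
      v = λ j → componentⱽ 1 (to g (unit j))
      g′ = comb (R^ aug G.rank (suc i)) v

    mult-graded : Graded d mult
    mult-graded = comb-graded (λ (_ : Fin 1) (_ : Fin 1) → 𝐱^ e)
      (λ _ _ → component-monomial (indicator e) (≡.trans (degree-indicator e) ∣e∣≡d))

    mult-cycle : ∀ x → G.Cycle 0 (to mult (to (H.∂ 0) x))
    mult-cycle x = lift (Submodule.resp ⟨ U ⟩ {y *ᴾ 𝐱^ e} (R.sym (mult-* (to (H.∂ 0) x)))
      (colon⁺ U W e W⇒U {y} (lower (H.boundary-cycle 0 x))))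
      where y = to (H.∂ 0) x zero

    private
      Good : ∀ i → Component H G i → Set (c ⊔ ℓ)
      Good i = Graded (shift d i)

      ψ : ChainMap H G
      ψ = extend H G Good refine mult mult-graded mult-cycle

      ψ-graded : ∀ i → Graded (shift d i) (ChainMap.component ψ i)
      ψ-graded = extend-good H G Good refine mult mult-graded mult-cycle

    open Cone ⟨ U ⟩ {Q = pred ⟨ W ⟩} (𝐱^ e) (λ {y} → colon⁻ U W e U⇒W {y}) G H ψ (λ y → mult-* y)

    private
      V⊆ : ∀ {f} → f ∈ pred ⟨ V ⟩ → f ∈ pred (adjoin ⟨ U ⟩ (𝐱^ e))
      V⊆ = ⟨⟩-least V (adjoin ⟨ U ⟩ (𝐱^ e)) λ α α∈V → case (V⇒ α∈V)
        where
        case : ∀ {α} → supp α ∈ has U ⊎ e ⊆ supp α → monomial α ∈ pred (adjoin ⟨ U ⟩ (𝐱^ e))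
        case {α} (inj₁ u) = monomial α , [] , monomial∈ U u , R.sym (R.+-identityʳ _)
        case {α} (inj₂ s) = [] , monomial (α ÷ indicator e) , Submodule.0-closed ⟨ U ⟩ ,
          R.sym (R.trans (R.+-identityˡ _) (monomial-÷ α e s))

      ⊆V : ∀ {f} → f ∈ pred (adjoin ⟨ U ⟩ (𝐱^ e)) → f ∈ pred ⟨ V ⟩
      ⊆V {f} (a , y , a∈U , eq) = Submodule.resp ⟨ V ⟩ {a List.++ y *ᴾ 𝐱^ e} {f} (R.sym eq)
        (Submodule.+-closed ⟨ V ⟩ {a} {y *ᴾ 𝐱^ e} (⟨⟩-mono U V U⇒V {a} a∈U) (Submodule.*-closed ⟨ V ⟩ y {𝐱^ e} (monomial∈ V
          (e⇒V (≡.subst (e ⊆_) (≡.sym (supp-indicator e)) Subsetₚ.⊆-refl)))))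

      D₁-graded : ∀ i → Graded (shift d i) (D₁ i)
      D₁-graded i = +-graded (G.∂ i ∘ₗ π₁) (ChainMap.component ψ i ∘ₗ π₂ {G.rank i})
        (λ p x → G.graded i p _) (λ p x → ψ-graded i p _)

      D-graded : ∀ i → Graded (shift d i) (D i)
      D-graded zero    = D₁-graded zero
      D-graded (suc i) = pair-graded (D₁ (suc i)) (-ₗ (H.∂ i ∘ₗ π₂ {G.rank (suc i)})) (D₁-graded (suc i))
        (neg-graded (H.∂ i ∘ₗ π₂ {G.rank (suc i)}) (λ p x → H-graded i p _))

    linearCone : LinearResolution V d
    linearCone = record
      { resolution = resolution-resp ⊆V V⊆ cone
      ; graded = D-graded
      }

-- Exposed circuits

_≟ˢ_ : ∀ {n} (S T : Subset n) → Dec (S ≡ T)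
_≟ˢ_ = Vecₚ.≡-dec Boolₚ._≟_

∪-least : ∀ {n} {p q r : Subset n} → p ⊆ r → q ⊆ r → p ∪ q ⊆ r
∪-least {p = p} {q} p⊆r q⊆r x∈ = [ p⊆r , q⊆r ]′ (Subsetₚ.x∈p∪q⁻ p q x∈)

⁅⁆⊆ : ∀ {n} {v : Fin n} {p : Subset n} → v ∈ˢ p → ⁅ v ⁆ ⊆ p
⁅⁆⊆ {v = v} {p} v∈p x∈ = ≡.subst (_∈ˢ p) (≡.sym (Subsetₚ.x∈⁅y⁆⇒x≡y v x∈)) v∈p

∣∪⁅⁆∣ : ∀ {n} {v : Fin n} {p : Subset n} → v ∉ˢ p → ∣ p ∪ ⁅ v ⁆ ∣ ≡ suc ∣ p ∣
∣∪⁅⁆∣ {v = zero}  {Subset.outside Vec.∷ p} v∉p =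
  ≡.cong (suc ∘ ∣_∣) (Subsetₚ.∪-identityʳ p)
∣∪⁅⁆∣ {v = zero}  {Subset.inside Vec.∷ p} v∉p = ⊥-elim (v∉p Vec.here)
∣∪⁅⁆∣ {v = suc v} {Subset.outside Vec.∷ p} v∉p = ∣∪⁅⁆∣ (v∉p ∘ Vec.there)
∣∪⁅⁆∣ {v = suc v} {Subset.inside Vec.∷ p} v∉p = ≡.cong suc (∣∪⁅⁆∣ (v∉p ∘ Vec.there))

⊈⇒∃∉ : ∀ {n} {S K : Subset n} → ¬ (S ⊆ K) → ∃[ v ] v ∈ˢ S × v ∉ˢ K
⊈⇒∃∉ {S = S} {K} S⊈K with any? (λ v → (v Subsetₚ.∈? S) ×-dec ¬? (v Subsetₚ.∈? K))
... | yes v = v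
... | no none = ⊥-elim (S⊈K λ {v} v∈S → case (v Subsetₚ.∈? K) v∈S)
  where
  case : ∀ {v} → Dec (v ∈ˢ K) → v ∈ˢ S → v ∈ˢ K
  case (yes v∈K) _   = v∈K
  case (no v∉K)  v∈S = ⊥-elim (none (_ , v∈S , v∉K))

-- Supports of the monomials in the ideal generated by the variables outside `K`.
beyond : ∀ {n} → Subset n → UpSet n
beyond K = record
  { has       = λ S → ¬ (S ⊆ K)
  ; has?      = λ S → ¬? (S Subsetₚ.⊆? K)
  ; up-closed = λ S⊆T S⊈K T⊆K → S⊈K (T⊆K ∘ S⊆T)
  }

containing : ∀ {n d} → Clutter n d → UpSet n
containing D = record
  { has       = λ S → ∃[ f ] circuits D f × f ⊆ S
  ; has?      = λ S → Subsetₚ.anySubset? (λ f → Clutter.circuit? D f ×-dec (f Subsetₚ.⊆? S))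
  ; up-closed = λ S⊆T (f , f∈D , f⊆S) → f , f∈D , S⊆T ∘ f⊆S
  }

module _ {n d : ℕ} (Γ : Clutter n d) where

  -- A clique with no maximal clique above it would itself be maximal, because any strictly larger
  -- clique falls to the same argument with a smaller complement; `fuel` bounds the size of that
  -- complement. The double negation spares a search through all cliques.
  ¬¬extendToMaximal : ∀ S → IsClique Γ S → ¬ (∀ M → IsMaximalClique Γ M → ¬ (S ⊆ M))
  ¬¬extendToMaximal S S-clique none = go (n ∸ ∣ S ∣) S S-clique none ℕₚ.≤-refl
    where
    go : ∀ fuel S → IsClique Γ S → (∀ M → IsMaximalClique Γ M → ¬ (S ⊆ M)) → ¬ (n ∸ ∣ S ∣ ℕ.≤ fuel)
    go fuel S S-clique none n∸∣S∣≤fuel = none S (S-clique , maximal) id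
      where
      larger : ∀ fuel T → IsClique Γ T → S ⊆ T → T ≢ S → n ∸ ∣ S ∣ ℕ.≤ fuel → T ≡ S
      larger fuel T T-clique S⊆T T≢S le with ⊈⇒∃∉ {S = T} {S} (λ T⊆S → T≢S (Subsetₚ.⊆-antisym T⊆S S⊆T))
      ... | v , v∈T , v∉S with fuel | ℕₚ.<-≤-trans
            (ℕₚ.∸-monoʳ-< (Subsetₚ.p⊂q⇒∣p∣<∣q∣ (S⊆T , v , v∈T , v∉S)) (Subsetₚ.∣p∣≤n T)) le
      ... | suc fuel | ℕ.s≤s lt = ⊥-elim (go fuel T T-clique (λ M M-max T⊆M → none M M-max (T⊆M ∘ S⊆T)) lt)
      maximal : ∀ T → IsClique Γ T → S ⊆ T → T ≡ S
      maximal T T-clique S⊆T with T ≟ˢ S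
      ... | yes T≡S = T≡S
      ... | no T≢S = larger fuel T T-clique S⊆T T≢S n∸∣S∣≤fuel

  -- In terms of ideals: I_Γ̄ : x_e is generated by the variables outside K.
  module _ {e K : Subset n} (exposed : IsExposed Γ e) (K-maximal : IsMaximalClique Γ K) (e⊆K : e ⊆ K) where
    private
      ∣e∣≡d : ∣ e ∣ ≡ d
      ∣e∣≡d = Clutter.uniform Γ (proj₁ exposed)

      maximal⊇e : ∀ {M} → IsMaximalClique Γ M → e ⊆ M → M ≡ K
      maximal⊇e M-max e⊆M = let _ , _ , unique = proj₂ exposed in
        ≡.trans (≡.sym (unique (M-max , e⊆M))) (unique (K-maximal , e⊆K))

    beyond⇒colon : ∀ {S} → has (beyond K) S → has (containing (complement Γ)) (S ∪ e)
    beyond⇒colon {S} S⊈K with ⊈⇒∃∉ S⊈K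
    ... | v , v∈S , v∉K with UpSet.has? (containing (complement Γ)) (e ∪ ⁅ v ⁆)
    ...   | yes has-ev = UpSet.up-closed (containing (complement Γ))
              (∪-least (Subsetₚ.q⊆p∪q S e) (⁅⁆⊆ (Subsetₚ.p⊆p∪q e v∈S))) has-ev
    -- Only a contradiction is sought here, so the doubly negated extension can stand in for an
    -- actual maximal clique.
    ...   | no ¬has-ev = ⊥-elim (¬¬extendToMaximal (e ∪ ⁅ v ⁆) clique λ M M-max ev⊆M →
              v∉K (≡.subst (v ∈ˢ_) (maximal⊇e M-max (ev⊆M ∘ Subsetₚ.p⊆p∪q ⁅ v ⁆))
                (ev⊆M (Subsetₚ.q⊆p∪q e ⁅ v ⁆ (Subsetₚ.x∈⁅x⁆ v)))))
      where
      circuit : ∀ f → f ⊆ e ∪ ⁅ v ⁆ → ∣ f ∣ ≡ d → circuits Γ f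
      circuit f f⊆ ∣f∣≡d with Clutter.circuit? Γ f
      ... | yes f∈Γ = f∈Γ
      ... | no f∉Γ = ⊥-elim (¬has-ev (f , (∣f∣≡d , f∉Γ) , f⊆))
      clique : IsClique Γ (e ∪ ⁅ v ⁆)
      clique = (v , Subsetₚ.q⊆p∪q e ⁅ v ⁆ (Subsetₚ.x∈⁅x⁆ v)) ,
        inj₂ (≡.subst (ℕ._≤ ∣ e ∪ ⁅ v ⁆ ∣) ∣e∣≡d (Subsetₚ.∣p∣≤∣p∪q∣ e ⁅ v ⁆) , circuit)

    colon⇒beyond : ∀ {S} → has (containing (complement Γ)) (S ∪ e) → has (beyond K) S
    colon⇒beyond {S} (f , (∣f∣≡d , f∉Γ) , f⊆S∪e) S⊆K with proj₂ (proj₁ K-maximal)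
    -- `K` contains `e` and so has at least `d` elements; it is not a clique merely by being small.
    ... | inj₁ ∣K∣<d = ℕₚ.<⇒≱ ∣K∣<d (≡.subst (ℕ._≤ ∣ K ∣) ∣e∣≡d (Subsetₚ.p⊆q⇒∣p∣≤∣q∣ e⊆K))
    ... | inj₂ (_ , all∈Γ) = f∉Γ (all∈Γ f (∪-least S⊆K e⊆K ∘ f⊆S∪e) ∣f∣≡d)

  module _ {Γ′ : Clutter n d} {e : Subset n} (Γ′≐Γ∖e : Γ′ ≐ᶜ Γ ∖ e) (e∈Γ : circuits Γ e) where

    removed⇒ : ∀ {S} → has (containing (complement Γ′)) S → has (containing (complement Γ)) S ⊎ e ⊆ S
    removed⇒ (f , (∣f∣≡d , f∉Γ′) , f⊆S) with Clutter.circuit? Γ f | f ≟ˢ e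
    ... | no f∉Γ  | _          = inj₁ (f , (∣f∣≡d , f∉Γ) , f⊆S)
    ... | yes _   | yes ≡.refl = inj₂ f⊆S
    ... | yes f∈Γ | no f≢e     = ⊥-elim (f∉Γ′ (proj₂ Γ′≐Γ∖e (f∈Γ , f≢e)))

    ⇒removed : ∀ {S} → has (containing (complement Γ)) S → has (containing (complement Γ′)) S
    ⇒removed (f , (∣f∣≡d , f∉Γ) , f⊆S) = f , (∣f∣≡d , λ f∈Γ′ → f∉Γ (proj₁ (proj₁ Γ′≐Γ∖e f∈Γ′))) , f⊆S

    e⇒removed : ∀ {S} → e ⊆ S → has (containing (complement Γ′)) S
    e⇒removed e⊆S = e , (Clutter.uniform Γ e∈Γ , λ e∈Γ′ → proj₂ (proj₁ Γ′≐Γ∖e e∈Γ′) ≡.refl) , e⊆S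

-- Koszul complexes and iterated removal of circuits

module LinearResolutions {c ℓ} (𝕜 : CommutativeRing c ℓ) (n : ℕ) where

  open Polynomials 𝕜 n using (polynomialRing; δ)
  private
    module 𝕜 = CommutativeRing 𝕜
    module R = CommutativeRing polynomialRing
  open Modules polynomialRing using (module Submodule)
  open Linear polynomialRing
  open Resolutions polynomialRing
  open MonomialIdeals 𝕜 n

  zeroResolution : ∀ {U : UpSet n} {d} → (∀ {S} → ¬ has U S) → LinearResolution U d
  zeroResolution {U} {d} empty = record
    { resolution = record
      { rank = λ _ → 0
      ; ∂ = λ _ → 0ₗ
      ; boundary-cycle = λ { zero _ → lift (Submodule.0-closed ⟨ U ⟩) ; (suc i) _ → lift λ _ → R.refl }
      ; cycle-boundary = λ
          -- Every form vanishes on an empty `U`, in particular each coefficient form `δ γ`.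
          { zero x x∈U → (λ ()) , λ { zero → Polynomials.mk≈ λ γ →
              𝕜.sym (lower x∈U (δ γ) (λ α α∈U → ⊥-elim (empty α∈U))) }
          ; (suc i) x _ → (λ ()) , λ () }
      }
    ; graded = λ _ _ _ _ → R.refl
    }

  -- Variables are added one at a time. Multiplication by x_v is injective modulo the ideal of the
  -- variables outside `K′`, so the colon ideal is that ideal again and the cone is built from two
  -- copies of one resolution; its ranks add by Pascal's rule. The `suc i` is the shift from R / I
  -- to the ideal.
  koszul : ∀ k K → n ∸ ∣ K ∣ ≡ k → Σ[ L ∈ LinearResolution (beyond K) 1 ] ∀ i → LinearResolution.rank L i ≡ k C suc i
  koszul zero K n∸∣K∣≡0 = zeroResolution (λ S⊈K → S⊈K (≡.subst (_ ⊆_) (≡.sym K≡⊤) Subsetₚ.⊆⊤)) ,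
      λ i → ≡.sym (k>n⇒nCk≡0 {n = 0} {k = suc i} (ℕ.s≤s ℕ.z≤n))
    where
    K≡⊤ : K ≡ Subset.⊤
    K≡⊤ = Subsetₚ.∣p∣≡n⇒p≡⊤ (ℕₚ.≤-antisym (Subsetₚ.∣p∣≤n K) (ℕₚ.m∸n≡0⇒m≤n n∸∣K∣≡0))
  koszul (suc k) K n∸∣K∣≡1+k = linearCone , ranks
    where
    outsider : ∃[ v ] v ∈ˢ Subset.⊤ × v ∉ˢ K
    outsider = ⊈⇒∃∉ λ ⊤⊆K → ℕₚ.1+n≢0 (≡.trans (≡.sym n∸∣K∣≡1+k) (≡.trans
      (≡.cong (λ K → n ∸ ∣ K ∣) (Subsetₚ.⊆-antisym Subsetₚ.⊆⊤ ⊤⊆K))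
      (≡.trans (≡.cong (n ∸_) (Subsetₚ.∣⊤∣≡n n)) (ℕₚ.n∸n≡0 n))))

    v = proj₁ outsider
    v∉K = proj₂ (proj₂ outsider)
    K′ = K ∪ ⁅ v ⁆

    n∸∣K′∣≡k : n ∸ ∣ K′ ∣ ≡ k
    n∸∣K′∣≡k = ≡.trans (≡.cong (n ∸_) (∣∪⁅⁆∣ v∉K))
      (≡.trans (≡.sym (ℕₚ.pred[m∸n]≡m∸[1+n] n ∣ K ∣)) (≡.cong ℕ.pred n∸∣K∣≡1+k))

    smaller = koszul k K′ n∸∣K′∣≡k
    module L = LinearResolution (proj₁ smaller)

    split : ∀ {S} → ¬ (S ⊆ K) → ¬ (S ⊆ K′) ⊎ ⁅ v ⁆ ⊆ S
    split {S} S⊈K with v Subsetₚ.∈? S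
    ... | yes v∈S = inj₂ (⁅⁆⊆ v∈S)
    ... | no v∉S = inj₁ λ S⊆K′ → S⊈K λ {x} x∈S → [ id , (λ x∈v →
            ⊥-elim (v∉S (≡.subst (_∈ˢ S) (Subsetₚ.x∈⁅y⁆⇒x≡y v x∈v) x∈S))) ]′ (Subsetₚ.x∈p∪q⁻ K ⁅ v ⁆ (S⊆K′ x∈S))

    open LinearCone {U = beyond K′} {W = beyond K′} {V = beyond K} ⁅ v ⁆ (Subsetₚ.∣⁅x⁆∣≡1 v)
      (λ {S} S⊈K′ S∪v⊆K′ → S⊈K′ (S∪v⊆K′ ∘ Subsetₚ.p⊆p∪q ⁅ v ⁆))
      (λ S∪v⊈K′ S⊆K′ → S∪v⊈K′ (∪-least S⊆K′ (Subsetₚ.q⊆p∪q K ⁅ v ⁆)))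
      split
      (λ S⊈K′ S⊆K → S⊈K′ (Subsetₚ.p⊆p∪q ⁅ v ⁆ ∘ S⊆K))
      (λ v⊆S S⊆K → v∉K (S⊆K (v⊆S (Subsetₚ.x∈⁅x⁆ v))))
      (proj₁ smaller) (proj₁ smaller)

    ranks : ∀ i → L.rank i ℕ.+ aug L.rank i ≡ suc k C suc i
    ranks i = ≡.trans (≡.cong₂ ℕ._+_ (proj₂ smaller i) (aug-rank i))
      (≡.trans (ℕₚ.+-comm (k C suc i) (k C i)) (nCk+nC[k+1]≡[n+1]C[k+1] k i))
      where
      aug-rank : ∀ i → aug L.rank i ≡ k C i
      aug-rank zero    = ≡.refl
      aug-rank (suc i) = proj₂ smaller i

  module _ {d} {Γ Γ′ : Clutter n d} {e K : Subset n} (Γ′≐Γ∖e : Γ′ ≐ᶜ Γ ∖ e) (exposed : IsExposed Γ e)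
           (K-maximal : IsMaximalClique Γ K) (e⊆K : e ⊆ K)
           (L : LinearResolution (containing (complement Γ)) d) where

    private
      k = n ∸ ∣ K ∣
      H = koszul k K ≡.refl

    open LinearCone {U = containing (complement Γ)} {W = beyond K} {V = containing (complement Γ′)} e
      (Clutter.uniform Γ (proj₁ exposed))
      (λ {S} → beyond⇒colon Γ exposed K-maximal e⊆K {S}) (λ {S} → colon⇒beyond Γ exposed K-maximal e⊆K {S})
      (removed⇒ Γ {Γ′} Γ′≐Γ∖e (proj₁ exposed)) (⇒removed Γ {Γ′} Γ′≐Γ∖e (proj₁ exposed))
      (e⇒removed Γ {Γ′} Γ′≐Γ∖e (proj₁ exposed))
      L (proj₁ H)

    -- `H` enters the cone with R in front, and the 1 in `aug` is k C 0; this undoes the shift in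
    -- the ranks of `koszul`.
    removeExposed : Σ[ L′ ∈ LinearResolution (containing (complement Γ′)) d ]
      ∀ i → LinearResolution.rank L′ i ≡ LinearResolution.rank L i ℕ.+ k C i
    removeExposed = linearCone , λ i → ≡.cong (LinearResolution.rank L i ℕ.+_) (aug-rank i)
      where
      aug-rank : ∀ i → aug (LinearResolution.rank (proj₁ H)) i ≡ k C i
      aug-rank zero    = ≡.refl
      aug-rank (suc i) = proj₂ H i

  -- The starting resolution is arbitrary because the induction removes the first circuit and
  -- restarts from the clutter that remains.
  removeAll : ∀ {d} r (𝒞 : Fin (suc r) → Clutter n d) (e K : Fin r → Subset n) →
    (∀ j → 𝒞 (suc j) ≐ᶜ 𝒞 (inject₁ j) ∖ e j) →
    (∀ j → IsExposed (𝒞 (inject₁ j)) (e j)) →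
    (∀ j → IsMaximalClique (𝒞 (inject₁ j)) (K j) × e j ⊆ K j) →
    (L : LinearResolution (containing (complement (𝒞 zero))) d) →
    Σ[ L′ ∈ LinearResolution (containing (complement (𝒞 (fromℕ r)))) d ]
      ∀ i → LinearResolution.rank L′ i ≡ LinearResolution.rank L i ℕ.+ sum (λ j → (n ∸ ∣ K j ∣) C i)
  removeAll zero    𝒞 e K removed exposed K-maximal L = L , λ i → ≡.sym (ℕₚ.+-identityʳ _)
  removeAll (suc r) 𝒞 e K removed exposed K-maximal L =
    let L₁ , rank₁ = removeExposed {Γ = 𝒞 zero} {𝒞 (suc zero)} (removed zero) (exposed zero)
                       (proj₁ (K-maximal zero)) (proj₂ (K-maximal zero)) L
        L₂ , rank₂ = removeAll r (𝒞 ∘ suc) (e ∘ suc) (K ∘ suc) (removed ∘ suc) (exposed ∘ suc) (K-maximal ∘ suc) L₁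
    in L₂ , λ i → ≡.trans (rank₂ i) (≡.trans (≡.cong (ℕ._+ sum (λ j → (n ∸ ∣ K (suc j) ∣) C i)) (rank₁ i))
                (ℕₚ.+-assoc (LinearResolution.rank L i) _ _))

-- Betti numbers of circuit ideals

module CircuitIdeals {c ℓ₁ ℓ₂} (𝕂 : HeytingField c ℓ₁ ℓ₂) (n : ℕ) where

  open BettiNumbers 𝕂 n
  private
    variable
      p m ℓm : Level
    module K = CommutativeRing K
    module R = CommutativeRing R
  open R using () renaming (Carrier to ∣R∣)
  open Polynomials K n using (𝟏; δ; _≟ᴹ_; coeff-≈; _∙_)
  open Modules R using (_⟶_; to; linear; module _⟶_; FreeResolution; Tor;
    Submodule; pred; Span; span; gen; resp; zero; add; mul)
  open Linear R using (unit)
  open Resolutions R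
  open MonomialIdeals K n
  open LinearResolutions K n

  constantTerm-constant : ∀ a → RingHomomorphism.⟦_⟧ constantTerm (RingHomomorphism.⟦_⟧ constant a) K.≈ a
  constantTerm-constant a = K.trans (K.+-identityʳ _) (K.trans (K.*-congˡ δ𝟏𝟏) (K.*-identityʳ a))
    where
    δ𝟏𝟏 : δ 𝟏 𝟏 K.≈ K.1#
    δ𝟏𝟏 = K.trans (K.sym (K.trans (K.+-identityʳ _) (K.*-identityˡ _))) (RingHomomorphism.1#-homo constantTerm)

  open Betti R K constantTerm constant constantTerm-constant hiding (asSpace; residue)

  module _ {U : UpSet n} {d : ℕ} (L : LinearResolution U d) where
    private
      module L = LinearResolution L

    -- The entries of `∂ (suc i)` on unit vectors equal their own degree 1 components, and such a
    -- component has constant term zero.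
    linear⇒minimal : Minimal L.resolution
    linear⇒minimal i = κ-vanishes (L.∂ (suc i)) λ j l → K.trans
      (K.sym (coeff-≈ (unit-image (L.∂ (suc i)) (L.graded (suc i)) j l) 𝟏))
      (component₁ (to (L.∂ (suc i)) (unit j) l))
      where
      component₁ : ∀ f → RingHomomorphism.⟦_⟧ constantTerm (component 1 f) K.≈ K.0#
      component₁ f = coeff-component-≢ 1 f (λ e → ℕₚ.0≢1+n (≡.trans (≡.sym (degree-𝟏 n)) e))

  module _ {M : LeftModule R.ring m ℓm} (ι : M ⟶ TensorUnit.leftModule) {I : Pred ∣R∣ p}
           (ι-injective : ∀ {x y} → to ι x R.≈ to ι y → LeftModule._≈ᴹ_ M x y)
           (ι∈I : ∀ x → to ι x ∈ I) (I⊆ι : ∀ {a} → a ∈ I → ∃[ x ] to ι x R.≈ a)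
           (G : Resolution I) (minimal : Minimal G) (F : FreeResolution M) where
    private
      P = fromFree ι ι-injective ι∈I I⊆ι F
      module φ = ChainMap (comparison G P)
      module F = FreeResolution F

    -- Degree i of `F` is degree i + 1 of the resolution of R / I, whence `component (suc i)`. An
    -- element of the homology is a tensor paired with a proof that it is a cycle, so `proj₁` serves
    -- as the representative; in degree 0 that proof is trivial.
    Tor-basis : ∀ i → HasDimension (asVectorSpace (Tor F residueField i)) (Resolution.rank G i)
    Tor-basis zero    = homology-basis (F.∂ 0) (φ.component 1)
      proj₁ ≡.refl (λ _ _ → ≡.refl) (λ _ _ → ≡.refl) (λ e → e) (λ e → e)
      (λ j → class P G minimal 0 j , _) (λ _ → ≡.refl)
      (λ (t , _) → spans₀ P G minimal t) (class-boundary⇒0 P G minimal 0)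
    Tor-basis (suc i) = homology-basis (F.∂ (suc i)) (φ.component (suc (suc i)))
      proj₁ ≡.refl (λ _ _ → ≡.refl) (λ _ _ → ≡.refl) (λ e → e) (λ e → e)
      (λ j → class P G minimal (suc i) j , class-cycle P G minimal i j) (λ _ → ≡.refl)
      (λ (t , z) → spans₊ P G minimal i t z) (class-boundary⇒0 P G minimal (suc i))

  module _ {d s : ℕ} (D : Clutter n d) (L : LinearResolution (containing D) s) where
    private
      U = containing D
      generators : ∃ (circuits D) → ∣R∣
      generators (f , _) = 𝐱 f

      generator∈ : ∀ j → generators j ∈ pred ⟨ U ⟩
      generator∈ (f , f∈D) = monomial∈ U (f , f∈D , ≡.subst (f ⊆_) (≡.sym (supp-indicator f)) Subsetₚ.⊆-refl)

      Span⊆ : ∀ {x} → x ∈ Span Unit generators → x ∈ pred ⟨ U ⟩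
      Span⊆ (gen j)                   = generator∈ j
      Span⊆ (resp {x} {y} x≈y x∈)     = Submodule.resp ⟨ U ⟩ {x} {y} x≈y (Span⊆ x∈)
      Span⊆ zero                      = Submodule.0-closed ⟨ U ⟩
      Span⊆ (add {x} {y} x∈ y∈)       = Submodule.+-closed ⟨ U ⟩ {x} {y} (Span⊆ x∈) (Span⊆ y∈)
      Span⊆ (mul r {x} x∈)            = Submodule.*-closed ⟨ U ⟩ r {x} (Span⊆ x∈)

      ⊆Span : ∀ {x} → x ∈ pred ⟨ U ⟩ → x ∈ Span Unit generators
      ⊆Span = ⟨⟩-least U (span Unit generators) λ α (f , f∈D , f⊆α) →
        resp (monomial-÷ α f f⊆α) (mul (monomial (α ÷ indicator f)) (gen (f , f∈D)))

      ι : circuitIdeal D ⟶ Unit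
      ι = linear proj₁ (λ e → e) (λ _ _ → R.refl) (λ _ _ → R.refl)

      module L = LinearResolution L

    linear⇒IsBettiNumber : ∀ i → IsBettiNumber (circuitIdeal D) i (L.rank i)
    linear⇒IsBettiNumber i =
        toFree ι (λ e → e) (λ (_ , x∈) → Span⊆ x∈) (λ {a} a∈ → (a , ⊆Span a∈) , R.refl) L.resolution
      , λ F → Tor-basis ι (λ e → e) (λ (_ , x∈) → Span⊆ x∈) (λ {a} a∈ → (a , ⊆Span a∈) , R.refl)
                L.resolution (linear⇒minimal L) F i

corollary3p8 : ∀ {c ℓ₁ ℓ₂} (𝕂 : HeytingField c ℓ₁ ℓ₂) (n d r : ℕ) → 1 ≤ d →
    (𝒞 : Fin (suc r) → Clutter n d) (e : Fin r → Subset n) →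
    𝒞 zero ≐ᶜ complete →
    (∀ (j : Fin r) → 𝒞 (suc j) ≐ᶜ 𝒞 (inject₁ j) ∖ e j) →
    (∀ (j : Fin r) → IsExposed (𝒞 (inject₁ j)) (e j)) →
    (K : Fin r → Subset n) →
    (∀ (j : Fin r) → IsMaximalClique (𝒞 (inject₁ j)) (K j) × e j ⊆ K j) →
    ∀ (i : ℕ) →
    BettiNumbers.IsBettiNumber 𝕂 n
    (BettiNumbers.circuitIdeal 𝕂 n (complement (𝒞 (fromℕ r)))) i
    (sum (λ (j : Fin r) → (n ∸ ∣ K j ∣) C i))
corollary3p8 𝕂 n d r _ 𝒞 e complete₀ removed exposed K K-maximal i =
  ≡.subst (BettiNumbers.IsBettiNumber 𝕂 n (BettiNumbers.circuitIdeal 𝕂 n (complement (𝒞 (fromℕ r)))) i)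
    (proj₂ L i) (linear⇒IsBettiNumber (complement (𝒞 (fromℕ r))) (proj₁ L) i)
  where
  open CircuitIdeals 𝕂 n
  open LinearResolutions (BettiNumbers.K 𝕂 n) n

  -- The complement of the complete clutter has no circuits, so the induction starts from the zero
  -- ideal; its ranks are 0, and the resulting `0 + sum` reduces to the stated sum.
  L = removeAll r 𝒞 e K removed exposed K-maximal
    (zeroResolution λ (f , (∣f∣≡d , f∉𝒞₀) , _) → f∉𝒞₀ (proj₂ complete₀ ∣f∣≡d))
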